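{- For every integer $n\ge0$, $$Q_{T_n}(t)=\sum_{k=0}^{\lfloor n/2\rfloor}\Big(\sum_{i=0}^{k}\ \sum_{j=k-i}^{\lfloor (n-3i)/2\rfloor}\frac{(j+1)(n-3i-j+2)(n-3i-2j+1)^2\,n!}{i!\,(i+j+1)!\,(n-2i-j+2)!}\Big)t^k .$$
   Context: $T_n$ is the graphic matroid of $K_{1,1,n}$ (vertices $A,B,1,\dots,n$, edges $AB,Aj,Bj$ for $1\le j\le n$). For a loopless matroid $\mathrm M$ (lattice of flats $\mathcal L(\mathrm M)$, characteristic polynomial $\chi$, restriction $\mathrm M|_F$, contraction $\mathrm M/F$), the inverse Kazhdan--Lusztig polynomial $Q_{\mathrm M}(t)\in\mathbb Z[t]$ is the unique polynomial with $Q_{\mathrm M}=1$ if $\operatorname{rk}\mathrm M=0$, $\deg Q_{\mathrm M}<\tfrac12\operatorname{rk}\mathrm M$ if $\operatorname{rk}\mathrm M>0$, and $t^{\operatorname{rk}\mathrm M}(-1)^{\operatorname{rk}\mathrm M}Q_{\mathrm M}(t^{ -1})=\sum_{F\in\mathcal L(\mathrm M)}(-1)^{\operatorname{rk}\mathrm M|_F}Q_{\mathrm M|_F}(t)\,t^{\operatorname{rk}\mathrm M/F}\chi_{\mathrm M/F}(t^{ -1})$. -}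

module Defs where

open import Data.Bool using (Bool; true; false; if_then_else_)
open import Data.Nat as ℕ using (ℕ; zero; suc; _∸_; _≤_; _≤ᵇ_; _<ᵇ_; _!; NonZero)
open import Data.Nat.Properties using (_!≢0; m*n≢0)
open import Data.Nat.DivMod using (_/_)
open import Data.Integer as ℤ using (ℤ; +_; -_)
open import Data.Rational as ℚ using (ℚ)
open import Data.Fin using (Fin; zero; suc; _≟_)
open import Data.Fin.Subset using (Subset; inside; outside; _∈_; _⊆_; _∪_; _∩_; _─_; ∣_∣; ⁅_⁆; ⊤)
open import Data.Fin.Subset.Properties using (_⊆?_; _∈?_)
open import Data.Vec as Vec using (Vec; []; _∷_; tabulate)
open import Data.List as List using (List; []; _∷_; filter; applyUpTo; upTo)
open import Data.Product using (_×_; _,_)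
open import Relation.Binary.PropositionalEquality using (_≡_)
open import Relation.Nullary using (Dec; yes; no; ¬_)
open import Relation.Nullary.Decidable using (_×-dec_)

-- Integer polynomials, as coefficient lists (constant term first).

Poly : Set
Poly = List ℤ

coeff : Poly → ℕ → ℤ
coeff []       _       = + 0
coeff (a ∷ p)  zero    = a
coeff (a ∷ p)  (suc k) = coeff p k

infixl 6 _⊕_
_⊕_ : Poly → Poly → Poly
[]      ⊕ q       = q
p       ⊕ []      = p
(a ∷ p) ⊕ (b ∷ q) = (a ℤ.+ b) ∷ (p ⊕ q)

scale : ℤ → Poly → Poly
scale c = List.map (c ℤ.*_)

infixl 7 _⊗_
_⊗_ : Poly → Poly → Poly
[]      ⊗ q = []
(a ∷ p) ⊗ q = scale a q ⊕ (+ 0 ∷ (p ⊗ q))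

polySum : List Poly → Poly
polySum = List.foldr _⊕_ []

one : Poly
one = + 1 ∷ []

monomial : ℕ → Poly
monomial zero    = one
monomial (suc d) = + 0 ∷ monomial d

-- t^r · p(t⁻¹)  (a polynomial whenever deg p ≤ r)
rev : ℕ → Poly → Poly
rev r p = applyUpTo (λ k → coeff p (r ∸ k)) (suc r)

sign : ℕ → ℤ
sign zero    = + 1
sign (suc r) = - sign r

allSubsets : (m : ℕ) → List (Subset m)
allSubsets zero    = [] ∷ []
allSubsets (suc m) =
  List.map (outside ∷_) (allSubsets m) List.++ List.map (inside ∷_) (allSubsets m)

-- Matroids given by a rank function.  A matroid lives on a ground set
-- E ⊆ Fin m, with rank function rk (only its values on subsets of E matter).

record RankData : Set where
  constructor mkRankData
  field
    m  : ℕ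
    E  : Subset m
    rk : Subset m → ℕ
open RankData public

record IsMatroid (M : RankData) : Set where
  field
    rk-bound : ∀ X → X ⊆ E M → rk M X ≤ ∣ X ∣
    rk-mono  : ∀ X Y → X ⊆ E M → Y ⊆ E M → X ⊆ Y → rk M X ≤ rk M Y
    rk-submod : ∀ X Y → X ⊆ E M → Y ⊆ E M →
                rk M (X ∪ Y) ℕ.+ rk M (X ∩ Y) ≤ rk M X ℕ.+ rk M Y

Loopless : RankData → Set
Loopless M = ∀ e → e ∈ E M → rk M ⁅ e ⁆ ≡ 1

rank : RankData → ℕ
rank M = rk M (E M)

IsFlat : (M : RankData) → Subset (m M) → Set
IsFlat M F = F ⊆ E M × (∀ e → e ∈ E M → ¬ (e ∈ F) → ¬ (rk M (F ∪ ⁅ e ⁆) ≡ rk M F))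

isFlat? : (M : RankData) → (F : Subset (m M)) → Dec (IsFlat M F)
isFlat? M F = (F ⊆? E M) ×-dec allDec
  where
  open import Data.Fin.Properties using (all?)
  open import Data.Nat.Properties using () renaming (_≟_ to _≟ℕ_)
  open import Relation.Nullary.Decidable using (¬?)
  open import Relation.Nullary.Decidable using (_→-dec_)
  allDec : Dec (∀ e → e ∈ E M → ¬ (e ∈ F) → ¬ (rk M (F ∪ ⁅ e ⁆) ≡ rk M F))
  allDec = all? (λ e → (e ∈? E M) →-dec ((¬? (e ∈? F)) →-dec ¬? (rk M (F ∪ ⁅ e ⁆) ≟ℕ rk M F)))

flats : (M : RankData) → List (Subset (m M))
flats M = filter (isFlat? M) (allSubsets (m M))

restrict : (M : RankData) → Subset (m M) → RankData
restrict M F = mkRankData (m M) F (rk M)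

contract : (M : RankData) → Subset (m M) → RankData
contract M F = mkRankData (m M) (E M ─ F) (λ X → rk M (X ∪ F) ∸ rk M F)

charPoly : RankData → Poly
charPoly M = polySum (List.map term (filter (_⊆? E M) (allSubsets (m M))))
  where
  term : Subset (m M) → Poly
  term X = scale (sign ∣ X ∣) (monomial (rank M ∸ rk M X))

klRHS : (RankData → Poly) → RankData → Poly
klRHS Q M = polySum (List.map term (flats M))
  where
  term : Subset (m M) → Poly
  term F = scale (sign (rank (restrict M F)))
                 (Q (restrict M F) ⊗ rev (rank (contract M F)) (charPoly (contract M F)))

record IsInverseKL (Q : RankData → Poly) : Set where
  field
    rank-zero : ∀ M → IsMatroid M → Loopless M → rank M ≡ 0 →
                ∀ k → coeff (Q M) k ≡ coeff one k
    degree    : ∀ M → IsMatroid M → Loopless M → ¬ (rank M ≡ 0) →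
                ∀ k → rank M ≤ 2 ℕ.* k → coeff (Q M) k ≡ + 0
    identity  : ∀ M → IsMatroid M → Loopless M →
                ∀ k → sign (rank M) ℤ.* coeff (rev (rank M) (Q M)) k ≡ coeff (klRHS Q M) k

-- Graphic matroids: rank of an edge set X = number of edges in a
-- greedily built spanning forest (= #vertices - #components of (V, X)).

module _ {v : ℕ} where
  relabel : (Fin v → Fin v) → Fin v → Fin v → (Fin v → Fin v)
  relabel lab old new x with lab x ≟ old
  ... | yes _ = new
  ... | no  _ = lab x

  forestRank : ∀ {m} → Vec (Fin v × Fin v) m → Subset m → (Fin v → Fin v) → ℕ
  forestRank []             []             lab = 0
  forestRank (_ ∷ es)       (outside ∷ X)  lab = forestRank es X lab
  forestRank ((a , b) ∷ es) (inside ∷ X)   lab with lab a ≟ lab b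
  ... | yes _ = forestRank es X lab
  ... | no  _ = suc (forestRank es X (relabel lab (lab b) (lab a)))

graphicRank : ∀ {v m} → Vec (Fin v × Fin v) m → Subset m → ℕ
graphicRank es X = forestRank es X (λ x → x)

-- K_{1,1,n}: vertices A = 0, B = 1, j ↦ 2 + j (j : Fin n);
-- edges: AB, then Aj (j = 1..n), then Bj (j = 1..n).
edgesK11 : (n : ℕ) → Vec (Fin (suc (suc n)) × Fin (suc (suc n))) (suc (n ℕ.+ n))
edgesK11 n = (zero , suc zero)
           ∷ (tabulate (λ j → (zero , suc (suc j))) Vec.++ tabulate (λ j → (suc zero , suc (suc j))))

T : ℕ → RankData
T n = mkRankData (suc (n ℕ.+ n)) ⊤ (graphicRank (edgesK11 n))

ℚsum : List ℚ → ℚ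
ℚsum = List.foldr ℚ._+_ ℚ.0ℚ

-- Σ_{j = lo}^{hi} f j  (empty if lo > hi)
sumFromTo : ℕ → ℕ → (ℕ → ℚ) → ℚ
sumFromTo lo hi f = ℚsum (applyUpTo (λ d → f (lo ℕ.+ d)) (suc hi ∸ lo))

summand : ℕ → ℕ → ℕ → ℚ
summand n i j =
  ((+ ((j ℕ.+ 1) ℕ.* (n ∸ 3 ℕ.* i ∸ j ℕ.+ 2) ℕ.* ((n ∸ 3 ℕ.* i ∸ 2 ℕ.* j ℕ.+ 1) ℕ.^ 2) ℕ.* n !))
    ℚ./ (i ! ℕ.* (i ℕ.+ j ℕ.+ 1) ! ℕ.* (n ∸ 2 ℕ.* i ∸ j ℕ.+ 2) !))
    {{nz}}
  where
  nz : NonZero (i ! ℕ.* (i ℕ.+ j ℕ.+ 1) ! ℕ.* (n ∸ 2 ℕ.* i ∸ j ℕ.+ 2) !)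
  nz = m*n≢0 _ _ {{m*n≢0 _ _ {{i !≢0}} {{(i ℕ.+ j ℕ.+ 1) !≢0}}}} {{(n ∸ 2 ℕ.* i ∸ j ℕ.+ 2) !≢0}}

-- inner double sum for fixed k: Σ_{i=0}^{k} Σ_{j=k-i}^{⌊(n-3i)/2⌋};
-- when 3i > n the upper bound ⌊(n-3i)/2⌋ is negative and the j-sum is empty.
formulaCoeff : ℕ → ℕ → ℚ
formulaCoeff n k =
  if k ≤ᵇ n / 2
  then sumFromTo 0 k (λ i →
         if 3 ℕ.* i ≤ᵇ n
         then sumFromTo (k ∸ i) ((n ∸ 3 ℕ.* i) / 2) (λ j → summand n i j)
         else ℚ.0ℚ)
  else ℚ.0ℚ

{-# OPTIONS --safe #-}
-- A flat of T_n containing AB is a copy of some T_s, and all its other flats are independent.  The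
-- defining recursion of Q_n = Q_{T_n} therefore reads
--   t^{n+1} Q_n(1/t) = (t − 1)(1 + 2t)^n + Σ_{S ⊆ [n]} (t − 1)^{n − ∣S∣} Q_{∣S∣}(t).
-- In terms of R_n = Σ_{S ⊆ [n]} (−1)^{n − ∣S∣} Q_{∣S∣} it becomes
--   t^{n+1} R_n(1/t) = R_n(t) − (1 − t)(1 + t)^n,
-- so R_n is the truncation of (1 − t)(1 + t)^n to degrees at most n/2, with coefficients the numbers
-- f^{(n−k,k)} of standard tableaux.  Thus [t^k] Q_n = Σ_s C(n,s) f^{(s−k,k)}, which by Pieri's rule is
-- the sum of (λ₁ − λ₂ + 1) f^λ over the partitions λ of n with three rows and λ₃ ≤ k ≤ λ₂.  With
-- λ = (n − 2i − j, i + j, i), the hook length formula for f^λ gives the summand of the theorem.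
module Submission where

open import Defs
open import Data.Nat using (ℕ)
open import Data.Rational using (ℚ; _/_)
open import Relation.Binary.PropositionalEquality using (_≡_)
open import Data.Bool as Bool using (Bool; true; false; if_then_else_; _∧_; _∨_; not)
import Data.Bool.Properties as Boolₚ
open import Data.Empty using (⊥-elim)
open import Data.Fin using (Fin; zero; suc; _≟_; _↑ˡ_; _↑ʳ_; splitAt; join)
import Data.Fin.Properties as Finₚ
open import Data.Fin.Subset using (Subset; inside; outside; _∈_; _∉_; _⊆_; _∪_; _∩_; _─_; ∣_∣; ⁅_⁆; ⊤; ⊥)
open import Data.Fin.Subset.Properties
open import Data.Integer as ℤ using (ℤ; +_; -_; _+_; _*_; _-_; -1ℤ; 0ℤ; 1ℤ)
import Data.Integer.Properties as ℤₚ
open import Data.Integer.Tactic.RingSolver using (solve-∀)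
open import Data.List as List using (List; []; _∷_; filter; applyUpTo)
open import Data.Nat as ℕ using (zero; suc; _∸_; _≤_; _<_; _≤ᵇ_; z≤n; s≤s; _!; NonZero)
open import Data.Nat.Combinatorics using (_C_; nCn≡1; nCk≡nC[n∸k]; k>n⇒nCk≡0; nCk+nC[k+1]≡[n+1]C[k+1])
open import Data.Nat.DivMod using (m/n*n≤m; m/n≤m; m*n/n≡m; /-monoˡ-≤) renaming (_/_ to _div_)
import Data.Nat.Properties as ℕₚ
import Data.Nat.Tactic.RingSolver as ℕSolver
open import Data.Product using (_×_; _,_; proj₁; proj₂; ∃)
import Data.Rational as ℚ
import Data.Rational.Properties as ℚₚ
open import Data.Rational.Unnormalised as ℚᵘ using (mkℚᵘ; *≡*)
import Data.Rational.Unnormalised.Properties as ℚᵘₚ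
open import Data.Sum as Sum using (_⊎_; inj₁; inj₂; [_,_])
open import Data.Vec as Vec using (Vec; []; _∷_; here; there; lookup; tabulate; zip) renaming (_++_ to _++ᵛ_)
import Data.Vec.Properties as Vecₚ
open import Function using (_∘_; id)
open import Level using (0ℓ)
open import Relation.Binary.PropositionalEquality hiding (_≡_; [_])
open import Relation.Nullary using (Dec; yes; no; does; contradiction)
open import Relation.Unary using (Pred; Decidable)

-- `Q` is given only as a function on rank data, so trading a flat of `T n` for an isomorphic `T s`
-- would first require invariance of `Q`. The recursion is instead solved inside one ground set: `τ`
-- assigns a candidate to every flat `F`, the candidates satisfy the recursion of every restriction
-- to a flat, and induction on the size of `F` identifies them with `Q`. Contractions enter only
-- through multiplication by `t^rk χ(1/t)`. This is the operator
-- `Σ_Y (−1)^∣Y∣ t^(rk(Y ∪ G) − rk G)`, whose sums factorise over the vertices `j`. The equation for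
-- `R_n` arises because reversal turns a sum over `S` with weight 1 per missing element into one
-- with weight `t = (t − 1) + 1`. Truncation solves it because `(1 − t)(1 + t)^n` changes sign under
-- reversal. Pieri's rule is proved by recurrence in `n`: both sides obey the rule for removing the
-- largest entry. The obstacle is that the bounds on the row lengths do not shift evenly; the
-- mismatch is repaired by extending the tableau numbers antisymmetrically, so that they vanish
-- where two shifted row lengths coincide.

-- Coefficient sequences and multiplication by linear factors

Seq : Set
Seq = ℕ → ℤ

δ₀ : Seq
δ₀ zero    = 1ℤ
δ₀ (suc _) = 0ℤ

𝟎 : Seq
𝟎 _ = 0ℤ

infixl 6 _⊞_
_⊞_ : Seq → Seq → Seq
(u ⊞ v) k = u k + v k

infixr 7 _•_
_•_ : ℤ → Seq → Seq
(c • u) k = c * u k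

sh : Seq → Seq
sh u zero    = 0ℤ
sh u (suc k) = u k

-- Multiplication by the polynomial `a + b t`. The factors `1 − t`, `1 + t`, `1 + 2t` and `t − 1` of
-- the recursions are all of this kind.
lin : ℤ → ℤ → Seq → Seq
lin a b u = (a • u) ⊞ (b • sh u)

⊞-cong : ∀ {u u′ v v′} → u ≗ u′ → v ≗ v′ → u ⊞ v ≗ u′ ⊞ v′
⊞-cong p q k = cong₂ _+_ (p k) (q k)

•-cong : ∀ c {u v} → u ≗ v → c • u ≗ c • v
•-cong c p k = cong (c *_) (p k)

sh-cong : ∀ {u v} → u ≗ v → sh u ≗ sh v
sh-cong p zero    = refl
sh-cong p (suc k) = p k

sh-⊞ : ∀ u v → sh (u ⊞ v) ≗ sh u ⊞ sh v
sh-⊞ u v zero    = refl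
sh-⊞ u v (suc k) = refl

sh-• : ∀ c u → sh (c • u) ≗ c • sh u
sh-• c u zero    = sym (ℤₚ.*-zeroʳ c)
sh-• c u (suc k) = refl

lin-cong : ∀ a b {u v} → u ≗ v → lin a b u ≗ lin a b v
lin-cong a b p = ⊞-cong (•-cong a p) (•-cong b (sh-cong p))

lin-⊞ : ∀ a b u v → lin a b (u ⊞ v) ≗ lin a b u ⊞ lin a b v
lin-⊞ a b u v k rewrite sh-⊞ u v k = distr a b (u k) (v k) (sh u k) (sh v k)
  where
  distr : ∀ a b x y x′ y′ → a * (x + y) + b * (x′ + y′) ≡ (a * x + b * x′) + (a * y + b * y′)
  distr = solve-∀

lin-• : ∀ a b c u → lin a b (c • u) ≗ c • lin a b u
lin-• a b c u k rewrite sh-• c u k = distr a b c (u k) (sh u k)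
  where
  distr : ∀ a b c x x′ → a * (c * x) + b * (c * x′) ≡ c * (a * x + b * x′)
  distr = solve-∀

lin-sum : ∀ a b c d u → lin a b u ⊞ lin c d u ≗ lin (a + c) (b + d) u
lin-sum a b c d u k = distr a b c d (u k) (sh u k)
  where
  distr : ∀ a b c d x x′ → (a * x + b * x′) + (c * x + d * x′) ≡ (a + c) * x + (b + d) * x′
  distr = solve-∀

sh-lin : ∀ a b u → sh (lin a b u) ≗ lin a b (sh u)
sh-lin a b u k = trans (sh-⊞ (a • u) (b • sh u) k) (cong₂ _+_ (sh-• a u k) (sh-• b (sh u) k))

lin-comm : ∀ a b c d u → lin a b (lin c d u) ≗ lin c d (lin a b u)
lin-comm a b c d u k rewrite sh-lin c d u k | sh-lin a b u k =
  distr a b c d (u k) (sh u k) (sh (sh u) k)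
  where
  distr : ∀ a b c d x y z →
          a * (c * x + d * y) + b * (c * y + d * z) ≡ c * (a * x + b * y) + d * (a * y + b * z)
  distr = solve-∀

sh-𝟎 : sh 𝟎 ≗ 𝟎
sh-𝟎 zero    = refl
sh-𝟎 (suc k) = refl

lin-t : ∀ u → lin 0ℤ 1ℤ u ≗ sh u
lin-t u k = distr (u k) (sh u k)
  where
  distr : ∀ x y → 0ℤ * x + 1ℤ * y ≡ y
  distr = solve-∀

lin-id : ∀ u → lin 1ℤ 0ℤ u ≗ u
lin-id u k = distr (u k) (sh u k)
  where
  distr : ∀ x y → 1ℤ * x + 0ℤ * y ≡ x
  distr = solve-∀

-- Binomial transforms

-- binomial a b w n = Σ_{S ⊆ [n]} (a + b t)^{n − ∣S∣} w_{∣S∣}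
binomial : ℤ → ℤ → (ℕ → Seq) → ℕ → Seq
binomial a b w zero    = w 0
binomial a b w (suc n) = lin a b (binomial a b w n) ⊞ binomial a b (w ∘ suc) n

binomial-cong : ∀ a b {w w′} → (∀ j → w j ≗ w′ j) → ∀ n → binomial a b w n ≗ binomial a b w′ n
binomial-cong a b p zero    = p 0
binomial-cong a b p (suc n) =
  ⊞-cong (lin-cong a b (binomial-cong a b p n)) (binomial-cong a b (p ∘ suc) n)

+-interchange : ∀ x y z t → (x + y) + (z + t) ≡ (x + z) + (y + t)
+-interchange = solve-∀

binomial-⊞ : ∀ a b w w′ n →
             binomial a b (λ j → w j ⊞ w′ j) n ≗ binomial a b w n ⊞ binomial a b w′ n
binomial-⊞ a b w w′ zero    k = refl
binomial-⊞ a b w w′ (suc n) k = begin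
  lin a b (binomial a b (λ j → w j ⊞ w′ j) n) k + binomial a b (λ j → w (suc j) ⊞ w′ (suc j)) n k
    ≡⟨ cong₂ _+_ (trans (lin-cong a b (binomial-⊞ a b w w′ n) k)
                        (lin-⊞ a b (binomial a b w n) (binomial a b w′ n) k))
                 (binomial-⊞ a b (w ∘ suc) (w′ ∘ suc) n k) ⟩
  _ ≡⟨ +-interchange (lin a b (binomial a b w n) k) _ _ _ ⟩
  _ ∎
  where
  open ≡-Reasoning

binomial-lin : ∀ a b c d w n → binomial a b (lin c d ∘ w) n ≗ lin c d (binomial a b w n)
binomial-lin a b c d w zero    k = refl
binomial-lin a b c d w (suc n) k = begin
  lin a b (binomial a b (lin c d ∘ w) n) k + binomial a b (lin c d ∘ w ∘ suc) n k
    ≡⟨ cong₂ _+_ (trans (lin-cong a b (binomial-lin a b c d w n) k)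
                        (lin-comm a b c d (binomial a b w n) k))
                 (binomial-lin a b c d (w ∘ suc) n k) ⟩
  lin c d (lin a b (binomial a b w n)) k + lin c d (binomial a b (w ∘ suc) n) k
    ≡⟨ lin-⊞ c d (lin a b (binomial a b w n)) (binomial a b (w ∘ suc) n) k ⟨
  lin c d (binomial a b w (suc n)) k ∎
  where open ≡-Reasoning

-- An element outside the inner set is dropped either at the outer or at the inner choice, so its
-- total weight is `(a + b t) + (c + d t)`. Binomial transforms thus compose by adding their
-- weights; this is what converts between `Q_n` and `R_n`.
binomial-∘ : ∀ a b c d w n →
             binomial a b (binomial c d w) n ≗ binomial (a + c) (b + d) w n
binomial-∘ a b c d w zero    k = refl
binomial-∘ a b c d w (suc n) k = begin
  lin a b (binomial a b (binomial c d w) n) k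
    + binomial a b (λ j → lin c d (binomial c d w j) ⊞ binomial c d (w ∘ suc) j) n k
    ≡⟨ cong₂ _+_ (lin-cong a b (binomial-∘ a b c d w n) k)
         (trans (binomial-⊞ a b (lin c d ∘ binomial c d w) (binomial c d (w ∘ suc)) n k)
                (cong₂ _+_ (trans (binomial-lin a b c d (binomial c d w) n k)
                                  (lin-cong c d (binomial-∘ a b c d w n) k))
                           (binomial-∘ a b c d (w ∘ suc) n k))) ⟩
  lin a b v k + (lin c d v k + v′ k)
    ≡⟨ ℤₚ.+-assoc (lin a b v k) (lin c d v k) (v′ k) ⟨
  lin a b v k + lin c d v k + v′ k
    ≡⟨ cong (_+ v′ k) (lin-sum a b c d v k) ⟩
  lin (a + c) (b + d) v k + v′ k ∎
  where
  open ≡-Reasoning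
  v  = binomial (a + c) (b + d) w n
  v′ = binomial (a + c) (b + d) (w ∘ suc) n

linPow : ℤ → ℤ → ℕ → Seq → Seq
linPow a b zero    u = u
linPow a b (suc n) u = lin a b (linPow a b n u)

-- The binomial theorem, for `w j = (c + d t)^j w 0`.
binomial-geometric : ∀ a b c d w → (∀ j → w (suc j) ≗ lin c d (w j)) →
                     ∀ n → binomial a b w n ≗ linPow (a + c) (b + d) n (w 0)
binomial-geometric a b c d w geo zero    k = refl
binomial-geometric a b c d w geo (suc n) k = begin
  lin a b (binomial a b w n) k + binomial a b (w ∘ suc) n k
    ≡⟨ cong (λ x → lin a b (binomial a b w n) k + x) (trans (binomial-cong a b geo n k) (binomial-lin a b c d w n k)) ⟩
  lin a b (binomial a b w n) k + lin c d (binomial a b w n) k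
    ≡⟨ lin-sum a b c d (binomial a b w n) k ⟩
  lin (a + c) (b + d) (binomial a b w n) k
    ≡⟨ lin-cong (a + c) (b + d) (binomial-geometric a b c d w geo n) k ⟩
  lin (a + c) (b + d) (linPow (a + c) (b + d) n (w 0)) k ∎
  where open ≡-Reasoning

linPow-sign : ∀ a b n u → linPow (- a) (- b) n u ≗ sign n • linPow a b n u
linPow-sign a b zero    u k = sym (ℤₚ.*-identityˡ (u k))
linPow-sign a b (suc n) u k = begin
  lin (- a) (- b) (linPow (- a) (- b) n u) k
    ≡⟨ lin-cong (- a) (- b) (linPow-sign a b n u) k ⟩
  lin (- a) (- b) (sign n • linPow a b n u) k
    ≡⟨ lin-• (- a) (- b) (sign n) (linPow a b n u) k ⟩
  sign n * lin (- a) (- b) (linPow a b n u) k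
    ≡⟨ flip a b (sign n) (linPow a b n u k) (sh (linPow a b n u) k) ⟩
  - sign n * lin a b (linPow a b n u) k ∎
  where
  open ≡-Reasoning
  flip : ∀ a b s x y → s * (- a * x + - b * y) ≡ - s * (a * x + b * y)
  flip = solve-∀

linPow-lin : ∀ a b c d n u → linPow a b n (lin c d u) ≗ lin c d (linPow a b n u)
linPow-lin a b c d zero    u k = refl
linPow-lin a b c d (suc n) u k =
  trans (lin-cong a b (linPow-lin a b c d n u) k) (lin-comm a b c d (linPow a b n u) k)

-- Reversal of polynomials

-- v = t^r u(1/t), for u of degree at most r.
Reversal : ℕ → Seq → Seq → Set
Reversal r u v = (∀ i j → i ℕ.+ j ≡ r → v i ≡ u j) × (∀ k → r < k → v k ≡ 0ℤ)

Reversal-⊞ : ∀ {r u v u′ v′} → Reversal r u v → Reversal r u′ v′ → Reversal r (u ⊞ u′) (v ⊞ v′)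
Reversal-⊞ (p , z) (p′ , z′) =
  (λ i j e → cong₂ _+_ (p i j e) (p′ i j e)) , (λ k l → cong₂ _+_ (z k l) (z′ k l))

Reversal-sh : ∀ {r u v} → u (suc r) ≡ 0ℤ → Reversal r u v → Reversal (suc r) u (sh v)
Reversal-sh {r} {u} {v} u≡0 (p , z) = p′ , z′
  where
  p′ : ∀ i j → i ℕ.+ j ≡ suc r → sh v i ≡ u j
  p′ zero    .(suc r) refl = sym u≡0
  p′ (suc i) j        e    = p i j (ℕₚ.suc-injective e)
  z′ : ∀ k → suc r < k → sh v k ≡ 0ℤ
  z′ (suc k) (s≤s l) = z k l

Reversal-cong : ∀ {r u u′ v v′} → u ≗ u′ → v ≗ v′ → Reversal r u v → Reversal r u′ v′
Reversal-cong p q (r , z) =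
  (λ i j e → trans (sym (q i)) (trans (r i j e) (p j))) , (λ k l → trans (sym (q k)) (z k l))

lin-vanish : ∀ a b u k → u k ≡ 0ℤ → sh u k ≡ 0ℤ → lin a b u k ≡ 0ℤ
lin-vanish a b u k p q = trans (cong₂ (λ x y → a * x + b * y) p q) (zeros a b)
  where
  zeros : ∀ a b → a * 0ℤ + b * 0ℤ ≡ 0ℤ
  zeros = solve-∀

binomial₁-vanish : ∀ w k n → (∀ j → j ≤ n → w j k ≡ 0ℤ) → binomial 1ℤ 0ℤ w n k ≡ 0ℤ
binomial₁-vanish w k zero    z = z 0 z≤n
binomial₁-vanish w k (suc n) z = cong₂ _+_
  (trans (lin-id (binomial 1ℤ 0ℤ w n) k)
         (binomial₁-vanish w k n (λ j l → z j (ℕₚ.m≤n⇒m≤1+n l))))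
  (binomial₁-vanish (w ∘ suc) k n (λ j l → z (suc j) (s≤s l)))

-- Since `w j` is reversed in degree `i + j`, each element outside `S` is missing from the degree of
-- its summand and is made up for by a factor `t`. So weight 1 becomes weight `t`. The offset `i` is
-- there for the induction, which replaces `w` by `w ∘ suc`.
Reversal-binomial : ∀ i w w′ → (∀ j → Reversal (i ℕ.+ j) (w j) (w′ j)) →
                    (∀ j k → i ℕ.+ j < k → w j k ≡ 0ℤ) →
                    ∀ n → Reversal (i ℕ.+ n) (binomial 1ℤ 0ℤ w n) (binomial 0ℤ 1ℤ w′ n)
Reversal-binomial i w w′ rv dg zero    = rv 0
Reversal-binomial i w w′ rv dg (suc n) =
  Reversal-⊞ (Reversal-cong (λ k → sym (lin-id u k)) (λ k → sym (lin-t v k)) first) second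
  where
  u = binomial 1ℤ 0ℤ w n
  v = binomial 0ℤ 1ℤ w′ n
  u≡0 : u (suc (i ℕ.+ n)) ≡ 0ℤ
  u≡0 = binomial₁-vanish w (suc (i ℕ.+ n)) n
          (λ j l → dg j (suc (i ℕ.+ n)) (s≤s (ℕₚ.+-monoʳ-≤ i l)))
  first : Reversal (i ℕ.+ suc n) u (sh v)
  first = subst (λ r → Reversal r u (sh v)) (sym (ℕₚ.+-suc i n))
            (Reversal-sh u≡0 (Reversal-binomial i w w′ rv dg n))
  second : Reversal (i ℕ.+ suc n) (binomial 1ℤ 0ℤ (w ∘ suc) n) (binomial 0ℤ 1ℤ (w′ ∘ suc) n)
  second = subst (λ r → Reversal r (binomial 1ℤ 0ℤ (w ∘ suc) n) (binomial 0ℤ 1ℤ (w′ ∘ suc) n))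
             (sym (ℕₚ.+-suc i n))
             (Reversal-binomial (suc i) (w ∘ suc) (w′ ∘ suc)
               (λ j → subst (λ r → Reversal r (w (suc j)) (w′ (suc j))) (ℕₚ.+-suc i j) (rv (suc j)))
               (λ j k l → dg (suc j) k (subst (_< k) (sym (ℕₚ.+-suc i j)) l)) n)

-- Ballot numbers and their truncation

-- (1 − t)(1 + t)^s
ballot : ℕ → Seq
ballot zero    = lin 1ℤ -1ℤ δ₀
ballot (suc s) = lin 1ℤ 1ℤ (ballot s)

ballot-degree : ∀ s k → suc s < k → ballot s k ≡ 0ℤ
ballot-degree zero    (suc (suc k)) _       = refl
ballot-degree zero    (suc zero)    (s≤s ())
ballot-degree (suc s) (suc k)       (s≤s l) =
  lin-vanish 1ℤ 1ℤ (ballot s) (suc k) (ballot-degree s (suc k) (ℕₚ.m≤n⇒m≤1+n l)) (ballot-degree s k l)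

-- Reversal changes the sign of `1 − t` and fixes `1 + t`, so it changes the sign of the product,
-- whose degree is `s + 1`.
ballot-antisym : ∀ s i j → i ℕ.+ j ≡ suc s → ballot s i ≡ - ballot s j
ballot-antisym zero    zero          .1       refl = refl
ballot-antisym zero    (suc zero)    zero     refl = refl
ballot-antisym (suc s) zero          .(suc (suc s)) refl = begin
  1ℤ * ballot s 0 + 1ℤ * 0ℤ
    ≡⟨ ends (ballot s 0) ⟩
  - (1ℤ * 0ℤ + 1ℤ * - ballot s 0)
    ≡⟨ cong₂ (λ x y → - (1ℤ * x + 1ℤ * y)) (sym (ballot-degree s (suc (suc s)) ℕₚ.≤-refl))
             (sym (ballot-antisym s (suc s) 0 (ℕₚ.+-identityʳ (suc s)))) ⟩
  - ballot (suc s) (suc (suc s)) ∎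
  where
  open ≡-Reasoning
  ends : ∀ x → 1ℤ * x + 1ℤ * 0ℤ ≡ - (1ℤ * 0ℤ + 1ℤ * - x)
  ends = solve-∀
ballot-antisym (suc s) (suc i) zero e = begin
  1ℤ * ballot s (suc i) + 1ℤ * ballot s i
    ≡⟨ cong₂ (λ x y → 1ℤ * x + 1ℤ * y)
         (ballot-degree s (suc i) (s≤s (ℕₚ.≤-reflexive (sym i≡))))
         (ballot-antisym s i 0 (trans (ℕₚ.+-identityʳ i) i≡)) ⟩
  1ℤ * 0ℤ + 1ℤ * - ballot s 0
    ≡⟨ ends (ballot s 0) ⟩
  - (1ℤ * ballot s 0 + 1ℤ * 0ℤ) ∎
  where
  open ≡-Reasoning
  i≡ : i ≡ suc s
  i≡ = trans (sym (ℕₚ.+-identityʳ i)) (ℕₚ.suc-injective e)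
  ends : ∀ x → 1ℤ * 0ℤ + 1ℤ * - x ≡ - (1ℤ * x + 1ℤ * 0ℤ)
  ends = solve-∀
ballot-antisym (suc s) (suc i) (suc j) e = begin
  1ℤ * ballot s (suc i) + 1ℤ * ballot s i
    ≡⟨ cong₂ (λ x y → 1ℤ * x + 1ℤ * y)
         (ballot-antisym s (suc i) j (trans (sym (ℕₚ.+-suc i j)) e′))
         (ballot-antisym s i (suc j) e′) ⟩
  1ℤ * - ballot s j + 1ℤ * - ballot s (suc j)
    ≡⟨ swap (ballot s j) (ballot s (suc j)) ⟩
  - (1ℤ * ballot s (suc j) + 1ℤ * ballot s j) ∎
  where
  open ≡-Reasoning
  e′ : i ℕ.+ suc j ≡ suc s
  e′ = ℕₚ.suc-injective e
  swap : ∀ x y → 1ℤ * - x + 1ℤ * - y ≡ - (1ℤ * y + 1ℤ * x)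
  swap = solve-∀

x≡-x⇒x≡0 : ∀ x → x ≡ - x → x ≡ 0ℤ
x≡-x⇒x≡0 (+ zero) _ = refl

-- The middle coefficient is its own negative. It would count tableaux of the non-shape
-- `(k, k + 1)`, and its vanishing closes the recurrence in Pieri's rule at two-row shapes with
-- equal rows.
ballot-middle : ∀ k → ballot (suc (k ℕ.+ k)) (suc k) ≡ 0ℤ
ballot-middle k = x≡-x⇒x≡0 _ (ballot-antisym (suc (k ℕ.+ k)) (suc k) (suc k) (cong suc (ℕₚ.+-suc k k)))

-- The polynomial `R_s` of the overview.
halfBallot : ℕ → Seq
halfBallot s k = if k ℕ.+ k ≤ᵇ s then ballot s k else 0ℤ

≤ᵇ-true : ∀ {m n} → m ≤ n → (m ≤ᵇ n) ≡ true
≤ᵇ-true {m} {n} l with m ≤ᵇ n | ℕₚ.≤⇒≤ᵇ l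
... | true | _ = refl

≤ᵇ-false : ∀ {m n} → n < m → (m ≤ᵇ n) ≡ false
≤ᵇ-false {m} {n} l with m ≤ᵇ n in eq
... | false = refl
... | true  = ⊥-elim (ℕₚ.<⇒≱ l (ℕₚ.≤ᵇ⇒≤ m n (subst Bool.T (sym eq) _)))

halfBallot-low : ∀ s k → k ℕ.+ k ≤ s → halfBallot s k ≡ ballot s k
halfBallot-low s k l rewrite ≤ᵇ-true l = refl

halfBallot-high : ∀ s k → s < k ℕ.+ k → halfBallot s k ≡ 0ℤ
halfBallot-high s k l rewrite ≤ᵇ-false l = refl

double-complement : ∀ s i j → i ℕ.+ j ≡ suc s → (i ℕ.+ i) ℕ.+ (j ℕ.+ j) ≡ suc (suc (s ℕ.+ s))
double-complement s i j e = begin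
  (i ℕ.+ i) ℕ.+ (j ℕ.+ j) ≡⟨ ℕₚ.+-assoc i i (j ℕ.+ j) ⟩
  i ℕ.+ (i ℕ.+ (j ℕ.+ j)) ≡⟨ cong (i ℕ.+_) (ℕₚ.+-assoc i j j) ⟨
  i ℕ.+ ((i ℕ.+ j) ℕ.+ j) ≡⟨ cong (i ℕ.+_) (ℕₚ.+-comm (i ℕ.+ j) j) ⟩
  i ℕ.+ (j ℕ.+ (i ℕ.+ j)) ≡⟨ ℕₚ.+-assoc i j (i ℕ.+ j) ⟨
  (i ℕ.+ j) ℕ.+ (i ℕ.+ j) ≡⟨ cong₂ ℕ._+_ e e ⟩
  suc s ℕ.+ suc s         ≡⟨ cong suc (ℕₚ.+-suc s s) ⟩
  suc (suc (s ℕ.+ s))     ∎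
  where open ≡-Reasoning

complement-high : ∀ s i j → i ℕ.+ j ≡ suc s → i ℕ.+ i ≤ s → s < j ℕ.+ j
complement-high s i j e l = ℕₚ.≰⇒> λ l′ → ℕₚ.<⇒≱ (ℕₚ.n<1+n _)
  (ℕₚ.≤-trans (ℕₚ.n≤1+n _) (ℕₚ.≤-trans (ℕₚ.≤-reflexive (sym (double-complement s i j e))) (ℕₚ.+-mono-≤ l l′)))

-- In the lower half, subtracting `ballot` leaves 0, which is the truncated upper half. In the upper
-- half it leaves `- ballot s i`, which antisymmetry identifies with the mirrored lower coefficient.
-- For odd `s` there remains the middle index `(s + 1)/2`, where the coefficient of `ballot` is 0.
halfBallot-reversal : ∀ s → Reversal (suc s) (halfBallot s) (halfBallot s ⊞ -1ℤ • ballot s)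
halfBallot-reversal s = refl-law , vanish
  where
  cancel : ∀ x → x + -1ℤ * x ≡ 0ℤ
  cancel = solve-∀
  neg : ∀ x → 0ℤ + -1ℤ * x ≡ - x
  neg = solve-∀
  refl-law : ∀ i j → i ℕ.+ j ≡ suc s → (halfBallot s ⊞ -1ℤ • ballot s) i ≡ halfBallot s j
  refl-law i j e with (i ℕ.+ i) ℕₚ.≤? s | (j ℕ.+ j) ℕₚ.≤? s
  ... | yes l | _
    rewrite halfBallot-low s i l | halfBallot-high s j (complement-high s i j e l) = cancel (ballot s i)
  ... | no ¬l | yes l′
    rewrite halfBallot-high s i (ℕₚ.≰⇒> ¬l) | halfBallot-low s j l′ =
      trans (neg (ballot s i)) (sym (ballot-antisym s j i (trans (ℕₚ.+-comm j i) e)))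
  ... | no ¬l | no ¬l′
    rewrite halfBallot-high s i (ℕₚ.≰⇒> ¬l) | halfBallot-high s j (ℕₚ.≰⇒> ¬l′) =
      trans (neg (ballot s i)) (cong -_ (x≡-x⇒x≡0 _ (trans (ballot-antisym s i j e) (cong (-_ ∘ ballot s) j≡i))))
    where
    -- Both 2i and 2j are at least s + 1, while they add up to 2(s + 1).
    2i≡ : i ℕ.+ i ≡ suc s
    2i≡ = ℕₚ.≤-antisym
      (ℕₚ.+-cancelʳ-≤ (suc s) (i ℕ.+ i) (suc s)
        (ℕₚ.≤-trans (ℕₚ.+-monoʳ-≤ (i ℕ.+ i) (ℕₚ.≰⇒> ¬l′))
          (ℕₚ.≤-reflexive (trans (double-complement s i j e) (cong suc (sym (ℕₚ.+-suc s s)))))))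
      (ℕₚ.≰⇒> ¬l)
    j≡i : j ≡ i
    j≡i = ℕₚ.+-cancelˡ-≡ i j i (trans e (sym 2i≡))
  vanish : ∀ k → suc s < k → (halfBallot s ⊞ -1ℤ • ballot s) k ≡ 0ℤ
  vanish k l = cong₂ (λ x y → x + -1ℤ * y)
    (halfBallot-high s k (ℕₚ.≤-trans (ℕₚ.<⇒≤ l) (ℕₚ.m≤m+n k k))) (ballot-degree s k l)

-- The candidate polynomials and their reversal

-- The inverse Kazhdan–Lusztig polynomials of the T_s, by coeff-T below.
𝒬 : ℕ → Seq
𝒬 = binomial 1ℤ 0ℤ halfBallot

𝒬-degree : ∀ s k → s < k ℕ.+ k → 𝒬 s k ≡ 0ℤ
𝒬-degree s k l = binomial₁-vanish halfBallot k s (λ j j≤s → halfBallot-high j k (ℕₚ.≤-<-trans j≤s l))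

-- Reversal replaces weight 1 by weight `t` and `halfBallot` by `halfBallot − ballot`. As
-- `t = (t − 1) + 1`, the first part is the transform of `𝒬` with weight `t − 1`. The second is
-- summed by the binomial theorem to `(1 − t)(1 + 2t)^s`, because `t + (1 + t) = 1 + 2t`.
𝒬-reversal : ∀ s → Reversal (suc s) (𝒬 s)
                     (binomial -1ℤ 1ℤ 𝒬 s ⊞ -1ℤ • lin 1ℤ -1ℤ (linPow 1ℤ (+ 2) s δ₀))
𝒬-reversal s = Reversal-cong (λ _ → refl) rhs
  (Reversal-binomial 1 halfBallot (λ j → halfBallot j ⊞ -1ℤ • ballot j) halfBallot-reversal
    (λ j k l → halfBallot-high j k (ℕₚ.≤-trans (ℕₚ.<⇒≤ l) (ℕₚ.m≤m+n k k))) s)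
  where
  open ≡-Reasoning
  as-lin : ∀ c u k → (c • u) k ≡ lin c 0ℤ u k
  as-lin c u k = distr c (u k) (sh u k)
    where
    distr : ∀ c x y → c * x ≡ c * x + 0ℤ * y
    distr = solve-∀
  rhs : binomial 0ℤ 1ℤ (λ j → halfBallot j ⊞ -1ℤ • ballot j) s
        ≗ binomial -1ℤ 1ℤ 𝒬 s ⊞ -1ℤ • lin 1ℤ -1ℤ (linPow 1ℤ (+ 2) s δ₀)
  rhs k = begin
    binomial 0ℤ 1ℤ (λ j → halfBallot j ⊞ -1ℤ • ballot j) s k
      ≡⟨ binomial-⊞ 0ℤ 1ℤ halfBallot (λ j → -1ℤ • ballot j) s k ⟩
    binomial 0ℤ 1ℤ halfBallot s k + binomial 0ℤ 1ℤ (λ j → -1ℤ • ballot j) s k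
      ≡⟨ cong₂ _+_ (sym (binomial-∘ -1ℤ 1ℤ 1ℤ 0ℤ halfBallot s k))
           (trans (binomial-cong 0ℤ 1ℤ (λ j → as-lin -1ℤ (ballot j)) s k)
             (trans (binomial-lin 0ℤ 1ℤ -1ℤ 0ℤ ballot s k)
               (sym (as-lin -1ℤ (binomial 0ℤ 1ℤ ballot s) k)))) ⟩
    binomial -1ℤ 1ℤ 𝒬 s k + -1ℤ * binomial 0ℤ 1ℤ ballot s k
      ≡⟨ cong (λ x → binomial -1ℤ 1ℤ 𝒬 s k + -1ℤ * x)
           (trans (binomial-geometric 0ℤ 1ℤ 1ℤ 1ℤ ballot (λ _ _ → refl) s k)
                  (linPow-lin 1ℤ (+ 2) 1ℤ -1ℤ s δ₀ k)) ⟩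
    binomial -1ℤ 1ℤ 𝒬 s k + -1ℤ * lin 1ℤ -1ℤ (linPow 1ℤ (+ 2) s δ₀) k ∎

-- Sums over all subsets

gate : Bool → Seq → Seq
gate true  u = u
gate false u = 𝟎

gate-cong : ∀ b {u v : Seq} → (b ≡ true → u ≗ v) → gate b u ≗ gate b v
gate-cong true  p = p refl
gate-cong false p = λ _ → refl

does-true : ∀ {a} {P : Set a} (P? : Dec P) → does P? ≡ true → P
does-true (yes p) _ = p

true-does : ∀ {a} {P : Set a} (P? : Dec P) → P → does P? ≡ true
true-does (yes _) _ = refl
true-does (no ¬p) p = contradiction p ¬p

Σs : ∀ m → (Subset m → Seq) → Seq
Σs zero    φ = φ []
Σs (suc m) φ = Σs m (φ ∘ (outside ∷_)) ⊞ Σs m (φ ∘ (inside ∷_))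

Σs-cong-at : ∀ {k} m {φ ψ : Subset m → Seq} → (∀ X → φ X k ≡ ψ X k) → Σs m φ k ≡ Σs m ψ k
Σs-cong-at zero    p = p []
Σs-cong-at (suc m) p = cong₂ _+_ (Σs-cong-at m (p ∘ (outside ∷_))) (Σs-cong-at m (p ∘ (inside ∷_)))

Σs-cong : ∀ m {φ ψ : Subset m → Seq} → (∀ X → φ X ≗ ψ X) → Σs m φ ≗ Σs m ψ
Σs-cong m p k = Σs-cong-at m (λ X → p X k)

Σs-𝟎 : ∀ m → Σs m (λ _ → 𝟎) ≗ 𝟎
Σs-𝟎 zero    k = refl
Σs-𝟎 (suc m) k = cong₂ _+_ (Σs-𝟎 m k) (Σs-𝟎 m k)

Σs-⊞ : ∀ m (φ ψ : Subset m → Seq) → Σs m (λ X → φ X ⊞ ψ X) ≗ Σs m φ ⊞ Σs m ψ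
Σs-⊞ zero    φ ψ k = refl
Σs-⊞ (suc m) φ ψ k =
  trans (cong₂ _+_ (Σs-⊞ m (φ ∘ (outside ∷_)) (ψ ∘ (outside ∷_)) k)
                   (Σs-⊞ m (φ ∘ (inside ∷_)) (ψ ∘ (inside ∷_)) k))
        (+-interchange (Σs m (φ ∘ (outside ∷_)) k) _ _ _)

-- Isolates one summand: the empty set when a flat is contracted onto itself, and the flat `F` in
-- its own recursion.
Σs-except : ∀ {m} (X₀ : Subset m) (φ ψ : Subset m → Seq) k →
            (∀ X → X ≢ X₀ → φ X k ≡ ψ X k) → Σs m φ k + ψ X₀ k ≡ Σs m ψ k + φ X₀ k
Σs-except []              φ ψ k p = ℤₚ.+-comm (φ [] k) (ψ [] k)
Σs-except {suc m} (outside ∷ X₀) φ ψ k p = begin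
  (Σs m (φ ∘ (outside ∷_)) k + Σs m (φ ∘ (inside ∷_)) k) + ψ (outside ∷ X₀) k
    ≡⟨ swap₂₃ (Σs m (φ ∘ (outside ∷_)) k) _ _ ⟩
  (Σs m (φ ∘ (outside ∷_)) k + ψ (outside ∷ X₀) k) + Σs m (φ ∘ (inside ∷_)) k
    ≡⟨ cong₂ _+_ (Σs-except X₀ (φ ∘ (outside ∷_)) (ψ ∘ (outside ∷_)) k
                   (λ X ne → p (outside ∷ X) (λ { refl → ne refl })))
                 (Σs-cong-at m (λ X → p (inside ∷ X) (λ ()))) ⟩
  (Σs m (ψ ∘ (outside ∷_)) k + φ (outside ∷ X₀) k) + Σs m (ψ ∘ (inside ∷_)) k
    ≡⟨ swap₂₃ (Σs m (ψ ∘ (outside ∷_)) k) _ _ ⟩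
  (Σs m (ψ ∘ (outside ∷_)) k + Σs m (ψ ∘ (inside ∷_)) k) + φ (outside ∷ X₀) k ∎
  where
  open ≡-Reasoning
  swap₂₃ : ∀ x y z → (x + y) + z ≡ (x + z) + y
  swap₂₃ = solve-∀
Σs-except {suc m} (inside ∷ X₀) φ ψ k p = begin
  (Σs m (φ ∘ (outside ∷_)) k + Σs m (φ ∘ (inside ∷_)) k) + ψ (inside ∷ X₀) k
    ≡⟨ ℤₚ.+-assoc (Σs m (φ ∘ (outside ∷_)) k) _ _ ⟩
  Σs m (φ ∘ (outside ∷_)) k + (Σs m (φ ∘ (inside ∷_)) k + ψ (inside ∷ X₀) k)
    ≡⟨ cong₂ _+_ (Σs-cong-at m (λ X → p (outside ∷ X) (λ ())))
                 (Σs-except X₀ (φ ∘ (inside ∷_)) (ψ ∘ (inside ∷_)) k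
                   (λ X ne → p (inside ∷ X) (λ { refl → ne refl }))) ⟩
  Σs m (ψ ∘ (outside ∷_)) k + (Σs m (ψ ∘ (inside ∷_)) k + φ (inside ∷ X₀) k)
    ≡⟨ ℤₚ.+-assoc (Σs m (ψ ∘ (outside ∷_)) k) _ _ ⟨
  (Σs m (ψ ∘ (outside ∷_)) k + Σs m (ψ ∘ (inside ∷_)) k) + φ (inside ∷ X₀) k ∎
  where
  open ≡-Reasoning

-- Coefficients of polynomials

coeff-⊕ : ∀ p p′ → coeff (p ⊕ p′) ≗ coeff p ⊞ coeff p′
coeff-⊕ []      p′       k       = sym (ℤₚ.+-identityˡ (coeff p′ k))
coeff-⊕ (a ∷ p) []       k       = sym (ℤₚ.+-identityʳ (coeff (a ∷ p) k))
coeff-⊕ (a ∷ p) (b ∷ p′) zero    = refl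
coeff-⊕ (a ∷ p) (b ∷ p′) (suc k) = coeff-⊕ p p′ k

coeff-scale : ∀ c p → coeff (scale c p) ≗ c • coeff p
coeff-scale c []      k       = sym (ℤₚ.*-zeroʳ c)
coeff-scale c (a ∷ p) zero    = refl
coeff-scale c (a ∷ p) (suc k) = coeff-scale c p k

coeff-0∷ : ∀ p → coeff (0ℤ ∷ p) ≗ sh (coeff p)
coeff-0∷ p zero    = refl
coeff-0∷ p (suc k) = refl

listSum : ∀ {A : Set} → (A → Seq) → List A → Seq
listSum φ []       = 𝟎
listSum φ (x ∷ xs) = φ x ⊞ listSum φ xs

listSum-++ : ∀ {A : Set} (φ : A → Seq) xs ys → listSum φ (xs List.++ ys) ≗ listSum φ xs ⊞ listSum φ ys
listSum-++ φ []       ys k = sym (ℤₚ.+-identityˡ (listSum φ ys k))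
listSum-++ φ (x ∷ xs) ys k =
  trans (cong (λ z → φ x k + z) (listSum-++ φ xs ys k)) (sym (ℤₚ.+-assoc (φ x k) _ _))

listSum-map : ∀ {A B : Set} (φ : A → Seq) (f : B → A) xs → listSum φ (List.map f xs) ≡ listSum (φ ∘ f) xs
listSum-map φ f []       = refl
listSum-map φ f (x ∷ xs) = cong (φ (f x) ⊞_) (listSum-map φ f xs)

coeff-polySum-filter : ∀ {A : Set} {P : Pred A 0ℓ} (P? : Decidable P) (f : A → Poly) xs →
  coeff (polySum (List.map f (filter P? xs))) ≗ listSum (λ x → gate (does (P? x)) (coeff (f x))) xs
coeff-polySum-filter P? f []       k = refl
coeff-polySum-filter P? f (x ∷ xs) k with does (P? x)
... | true  = trans (coeff-⊕ (f x) (polySum (List.map f (filter P? xs))) k)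
                    (cong (λ z → coeff (f x) k + z) (coeff-polySum-filter P? f xs k))
... | false = trans (coeff-polySum-filter P? f xs k) (sym (ℤₚ.+-identityˡ _))

listSum-allSubsets : ∀ m (φ : Subset m → Seq) → listSum φ (allSubsets m) ≗ Σs m φ
listSum-allSubsets zero    φ k = ℤₚ.+-identityʳ (φ [] k)
listSum-allSubsets (suc m) φ k =
  trans (listSum-++ φ (List.map (outside ∷_) (allSubsets m)) (List.map (inside ∷_) (allSubsets m)) k)
    (cong₂ _+_ (trans (cong (λ s → s k) (listSum-map φ (outside ∷_) (allSubsets m)))
                      (listSum-allSubsets m (φ ∘ (outside ∷_)) k))
               (trans (cong (λ s → s k) (listSum-map φ (inside ∷_) (allSubsets m)))
                      (listSum-allSubsets m (φ ∘ (inside ∷_)) k)))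

coeff-subsetSum : ∀ {m} {P : Pred (Subset m) 0ℓ} (P? : Decidable P) (f : Subset m → Poly) →
  coeff (polySum (List.map f (filter P? (allSubsets m)))) ≗ Σs m (λ X → gate (does (P? X)) (coeff (f X)))
coeff-subsetSum {m} P? f k = trans (coeff-polySum-filter P? f (allSubsets m) k) (listSum-allSubsets m _ k)

-- The product of a polynomial with an arbitrary sequence. Being linear in the sequence, it lets the
-- reversed characteristic polynomial be replaced by an equal sum of signed powers of `t`.
convolve : Poly → Seq → Seq
convolve []      u = 𝟎
convolve (a ∷ p) u = a • u ⊞ sh (convolve p u)

coeff-⊗ : ∀ p p′ → coeff (p ⊗ p′) ≗ convolve p (coeff p′)
coeff-⊗ []      p′ k = refl
coeff-⊗ (a ∷ p) p′ k =
  trans (coeff-⊕ (scale a p′) (0ℤ ∷ (p ⊗ p′)) k)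
    (cong₂ _+_ (coeff-scale a p′ k) (trans (coeff-0∷ (p ⊗ p′) k) (sh-cong (coeff-⊗ p p′) k)))

convolve-cong : ∀ p {u v} → u ≗ v → convolve p u ≗ convolve p v
convolve-cong []      e k = refl
convolve-cong (a ∷ p) e = ⊞-cong (•-cong a e) (sh-cong (convolve-cong p e))

convolve-⊞ : ∀ p u v → convolve p (u ⊞ v) ≗ convolve p u ⊞ convolve p v
convolve-⊞ []      u v k = refl
convolve-⊞ (a ∷ p) u v k =
  trans (cong (λ z → a * (u k + v k) + z)
              (trans (sh-cong (convolve-⊞ p u v) k) (sh-⊞ (convolve p u) (convolve p v) k)))
        (distr a (u k) (v k) _ _)
  where
  distr : ∀ a x y z t → a * (x + y) + (z + t) ≡ (a * x + z) + (a * y + t)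
  distr = solve-∀

convolve-• : ∀ p c u → convolve p (c • u) ≗ c • convolve p u
convolve-• []      c u k = sym (ℤₚ.*-zeroʳ c)
convolve-• (a ∷ p) c u k =
  trans (cong (λ z → a * (c * u k) + z) (trans (sh-cong (convolve-• p c u) k) (sh-• c (convolve p u) k)))
        (distr a c (u k) _)
  where
  distr : ∀ a c x z → a * (c * x) + c * z ≡ c * (a * x + z)
  distr = solve-∀

convolve-𝟎 : ∀ p → convolve p 𝟎 ≗ 𝟎
convolve-𝟎 []      k = refl
convolve-𝟎 (a ∷ p) k =
  trans (cong (λ z → a * 0ℤ + z) (trans (sh-cong (convolve-𝟎 p) k) (sh-𝟎 k)))
        (trans (ℤₚ.+-identityʳ (a * 0ℤ)) (ℤₚ.*-zeroʳ a))

convolve-gate : ∀ p b u → convolve p (gate b u) ≗ gate b (convolve p u)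
convolve-gate p true  u k = refl
convolve-gate p false u k = convolve-𝟎 p k

convolve-Σs : ∀ p m (φ : Subset m → Seq) → convolve p (Σs m φ) ≗ Σs m (λ X → convolve p (φ X))
convolve-Σs p zero    φ k = refl
convolve-Σs p (suc m) φ k =
  trans (convolve-⊞ p (Σs m (φ ∘ (outside ∷_))) (Σs m (φ ∘ (inside ∷_))) k)
        (cong₂ _+_ (convolve-Σs p m (φ ∘ (outside ∷_)) k) (convolve-Σs p m (φ ∘ (inside ∷_)) k))

shⁿ : ℕ → Seq → Seq
shⁿ zero    u = u
shⁿ (suc d) u = sh (shⁿ d u)

shⁿ-+ : ∀ d u j → shⁿ d u (d ℕ.+ j) ≡ u j
shⁿ-+ zero    u j = refl
shⁿ-+ (suc d) u j = shⁿ-+ d u j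

shⁿ-< : ∀ d u j → j < d → shⁿ d u j ≡ 0ℤ
shⁿ-< (suc d) u zero    _       = refl
shⁿ-< (suc d) u (suc j) (s≤s l) = shⁿ-< d u j l

coeff-monomial : ∀ d → coeff (monomial d) ≗ shⁿ d δ₀
coeff-monomial zero    zero    = refl
coeff-monomial zero    (suc k) = refl
coeff-monomial (suc d) k =
  trans (coeff-0∷ (monomial d) k) (sh-cong (coeff-monomial d) k)

convolve-sh : ∀ p u → convolve p (sh u) ≗ sh (convolve p u)
convolve-sh []      u zero    = refl
convolve-sh []      u (suc k) = refl
convolve-sh (a ∷ p) u k =
  trans (cong₂ _+_ (sym (sh-• a u k)) (sh-cong (convolve-sh p u) k))
        (sym (sh-⊞ (a • u) (sh (convolve p u)) k))

convolve-δ₀ : ∀ p → convolve p δ₀ ≗ coeff p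
convolve-δ₀ []      k       = refl
convolve-δ₀ (a ∷ p) zero    = trans (ℤₚ.+-identityʳ (a * 1ℤ)) (ℤₚ.*-identityʳ a)
convolve-δ₀ (a ∷ p) (suc k) =
  trans (cong₂ _+_ (ℤₚ.*-zeroʳ a) (convolve-δ₀ p k)) (ℤₚ.+-identityˡ (coeff p k))

convolve-shⁿδ₀ : ∀ p d → convolve p (shⁿ d δ₀) ≗ shⁿ d (coeff p)
convolve-shⁿδ₀ p zero    k = convolve-δ₀ p k
convolve-shⁿδ₀ p (suc d) k = trans (convolve-sh p (shⁿ d δ₀) k) (sh-cong (convolve-shⁿδ₀ p d) k)

Reversal-• : ∀ {r u v} c → Reversal r u v → Reversal r (c • u) (c • v)
Reversal-• c (p , z) =
  (λ i j e → cong (c *_) (p i j e)) , (λ k l → trans (cong (c *_) (z k l)) (ℤₚ.*-zeroʳ c))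

Reversal-gate : ∀ {r u v} b → (b ≡ true → Reversal r u v) → Reversal r (gate b u) (gate b v)
Reversal-gate true  p = p refl
Reversal-gate false p = (λ _ _ _ → refl) , (λ _ _ → refl)

Reversal-Σs : ∀ {r} m {φ ψ : Subset m → Seq} → (∀ X → Reversal r (φ X) (ψ X)) → Reversal r (Σs m φ) (Σs m ψ)
Reversal-Σs zero    p = p []
Reversal-Σs (suc m) p =
  Reversal-⊞ (Reversal-Σs m (p ∘ (outside ∷_))) (Reversal-Σs m (p ∘ (inside ∷_)))

Reversal-shⁿδ₀ : ∀ d d′ → Reversal (d′ ℕ.+ d) (shⁿ d δ₀) (shⁿ d′ δ₀)
Reversal-shⁿδ₀ d zero = p , z
  where
  p : ∀ i j → i ℕ.+ j ≡ d → δ₀ i ≡ shⁿ d δ₀ j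
  p zero    .d refl =
    sym (trans (cong (shⁿ d δ₀) (sym (ℕₚ.+-identityʳ d))) (shⁿ-+ d δ₀ 0))
  p (suc i) j  refl = sym (shⁿ-< (suc (i ℕ.+ j)) δ₀ j (s≤s (ℕₚ.m≤n+m j i)))
  z : ∀ k → d < k → δ₀ k ≡ 0ℤ
  z (suc k) _ = refl
Reversal-shⁿδ₀ d (suc d′) = Reversal-sh
  (trans (cong (shⁿ d δ₀) (trans (cong suc (ℕₚ.+-comm d′ d)) (sym (ℕₚ.+-suc d d′)))) (shⁿ-+ d δ₀ (suc d′)))
  (Reversal-shⁿδ₀ d d′)

Reversal-unique : ∀ {r u v u′ v′} → u ≗ u′ → Reversal r u v → Reversal r u′ v′ → v ≗ v′
Reversal-unique {r} e (p , z) (p′ , z′) k with k ℕₚ.≤? r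
... | yes l = trans (p k (r ∸ k) (ℕₚ.m+[n∸m]≡n l))
                (trans (e (r ∸ k)) (sym (p′ k (r ∸ k) (ℕₚ.m+[n∸m]≡n l))))
... | no ¬l = trans (z k (ℕₚ.≰⇒> ¬l)) (sym (z′ k (ℕₚ.≰⇒> ¬l)))

coeff-applyUpTo-< : ∀ f n k → k < n → coeff (applyUpTo f n) k ≡ f k
coeff-applyUpTo-< f (suc n) zero    _       = refl
coeff-applyUpTo-< f (suc n) (suc k) (s≤s l) = coeff-applyUpTo-< (f ∘ suc) n k l

coeff-applyUpTo-≥ : ∀ f n k → n ≤ k → coeff (applyUpTo f n) k ≡ 0ℤ
coeff-applyUpTo-≥ f zero    k       _       = refl
coeff-applyUpTo-≥ f (suc n) (suc k) (s≤s l) = coeff-applyUpTo-≥ (f ∘ suc) n k l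

rev-Reversal : ∀ r p → Reversal r (coeff p) (coeff (rev r p))
rev-Reversal r p = refl-law , (λ k l → coeff-applyUpTo-≥ (λ k → coeff p (r ∸ k)) (suc r) k l)
  where
  refl-law : ∀ i j → i ℕ.+ j ≡ r → coeff (rev r p) i ≡ coeff p j
  refl-law i j refl =
    trans (coeff-applyUpTo-< (λ k → coeff p (i ℕ.+ j ∸ k)) (suc r) i (s≤s (ℕₚ.m≤m+n i j))) (cong (coeff p) (ℕₚ.m+n∸m≡n i j))

-- Contractions as operators

-- Multiplication by t^{rk} χ_{M|E/G}(1/t).
contractOp : (M : RankData) (E G : Subset (m M)) → Seq → Seq
contractOp M E G u =
  Σs (m M) (λ Y → gate (does (Y ⊆? (E ─ G))) (sign ∣ Y ∣ • shⁿ (rk M (Y ∪ G) ∸ rk M G) u))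

restrict-matroid : ∀ {M} → IsMatroid M → ∀ {F} → F ⊆ E M → IsMatroid (restrict M F)
restrict-matroid isM F⊆ = record
  { rk-bound  = λ X p → rk-bound X (F⊆ ∘ p)
  ; rk-mono   = λ X Y p p′ → rk-mono X Y (F⊆ ∘ p) (F⊆ ∘ p′)
  ; rk-submod = λ X Y p p′ → rk-submod X Y (F⊆ ∘ p) (F⊆ ∘ p′)
  }
  where open IsMatroid isM

-- The characteristic polynomial of `N` is a signed sum of monomials `t^(rank N − ρ Y)`.
-- Monotonicity gives `ρ Y ≤ rank N`, so the truncated difference is a true one and reversal turns
-- the monomial into `t^(ρ Y)`.
coeff-⊗-charPoly : ∀ {M} → IsMatroid M → ∀ {F G} → F ⊆ E M → G ⊆ F → ∀ p →
  let N = contract (restrict M F) G in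
  coeff (p ⊗ rev (rank N) (charPoly N)) ≗ contractOp M F G (coeff p)
coeff-⊗-charPoly {M} isM {F} {G} F⊆ G⊆ p k = begin
  coeff (p ⊗ rev (rank N) (charPoly N)) k
    ≡⟨ coeff-⊗ p (rev (rank N) (charPoly N)) k ⟩
  convolve p (coeff (rev (rank N) (charPoly N))) k
    ≡⟨ convolve-cong p (Reversal-unique χ≗ (rev-Reversal (rank N) (charPoly N)) reversed) k ⟩
  convolve p (Σs (m M) (λ Y → gate (does (Y ⊆? (F ─ G))) (sign ∣ Y ∣ • shⁿ (ρ Y) δ₀))) k
    ≡⟨ convolve-Σs p (m M) _ k ⟩
  Σs (m M) (λ Y → convolve p (gate (does (Y ⊆? (F ─ G))) (sign ∣ Y ∣ • shⁿ (ρ Y) δ₀))) k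
    ≡⟨ Σs-cong (m M) (λ Y k → trans (convolve-gate p (does (Y ⊆? (F ─ G))) _ k)
         (gate-cong (does (Y ⊆? (F ─ G))) (λ _ k → trans (convolve-• p (sign ∣ Y ∣) _ k)
           (•-cong (sign ∣ Y ∣) (convolve-shⁿδ₀ p (ρ Y)) k)) k)) k ⟩
  contractOp M F G (coeff p) k ∎
  where
  open ≡-Reasoning
  open IsMatroid isM
  N = contract (restrict M F) G
  ρ : Subset (m M) → ℕ
  ρ Y = rk M (Y ∪ G) ∸ rk M G
  χ≗ : coeff (charPoly N) ≗
       Σs (m M) (λ Y → gate (does (Y ⊆? (F ─ G))) (sign ∣ Y ∣ • shⁿ (rank N ∸ ρ Y) δ₀))
  χ≗ k = trans (coeff-subsetSum (_⊆? (F ─ G)) _ k)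
    (Σs-cong (m M) (λ Y → gate-cong (does (Y ⊆? (F ─ G))) (λ _ k →
      trans (coeff-scale (sign ∣ Y ∣) (monomial (rank N ∸ ρ Y)) k)
            (•-cong (sign ∣ Y ∣) (coeff-monomial (rank N ∸ ρ Y)) k))) k)
  ∪G⊆ : ∀ {Y} → Y ⊆ F → Y ∪ G ⊆ E M
  ∪G⊆ {Y} Y⊆ x∈ = F⊆ ([ Y⊆ , G⊆ ] (x∈p∪q⁻ Y G x∈))
  ρ≤ : ∀ Y → Y ⊆ (F ─ G) → ρ Y ≤ rank N
  ρ≤ Y Y⊆ = ℕₚ.∸-monoˡ-≤ (rk M G) (rk-mono (Y ∪ G) ((F ─ G) ∪ G)
    (∪G⊆ (λ x∈ → p─q⊆p F G (Y⊆ x∈)))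
    (∪G⊆ (p─q⊆p F G))
    (λ x∈ → x∈p∪q⁺ ([ inj₁ ∘ Y⊆ , inj₂ ] (x∈p∪q⁻ Y G x∈))))
  reversed : Reversal (rank N)
    (Σs (m M) (λ Y → gate (does (Y ⊆? (F ─ G))) (sign ∣ Y ∣ • shⁿ (rank N ∸ ρ Y) δ₀)))
    (Σs (m M) (λ Y → gate (does (Y ⊆? (F ─ G))) (sign ∣ Y ∣ • shⁿ (ρ Y) δ₀)))
  reversed = Reversal-Σs (m M) (λ Y → Reversal-gate (does (Y ⊆? (F ─ G))) (λ e →
    Reversal-• (sign ∣ Y ∣)
      (subst (λ r → Reversal r (shⁿ (rank N ∸ ρ Y) δ₀) (shⁿ (ρ Y) δ₀))
             (ℕₚ.m+[n∸m]≡n (ρ≤ Y (does-true (Y ⊆? (F ─ G)) e)))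
             (Reversal-shⁿδ₀ (rank N ∸ ρ Y) (ρ Y)))))

contractOp-self : ∀ M F u → contractOp M F F u ≗ u
contractOp-self M F u k = begin
  contractOp M F F u k              ≡⟨ ℤₚ.+-identityʳ _ ⟨
  contractOp M F F u k + 0ℤ         ≡⟨ Σs-except ⊥ term (λ _ → 𝟎) k nonempty ⟩
  Σs (m M) (λ _ → 𝟎) k + term ⊥ k   ≡⟨ cong₂ _+_ (Σs-𝟎 (m M) k) empty ⟩
  0ℤ + u k                          ≡⟨ ℤₚ.+-identityˡ (u k) ⟩
  u k ∎
  where
  open ≡-Reasoning
  term : Subset (m M) → Seq
  term Y = gate (does (Y ⊆? (F ─ F))) (sign ∣ Y ∣ • shⁿ (rk M (Y ∪ F) ∸ rk M F) u)
  F─F≡⊥ : ∀ {n} (X : Subset n) → X ─ X ≡ ⊥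
  F─F≡⊥ []            = refl
  F─F≡⊥ (inside ∷ X)  = cong (outside ∷_) (F─F≡⊥ X)
  F─F≡⊥ (outside ∷ X) = cong (outside ∷_) (F─F≡⊥ X)
  nonempty : ∀ Y → Y ≢ ⊥ → term Y k ≡ 0ℤ
  nonempty Y ne with Y ⊆? (F ─ F)
  ... | yes Y⊆ = contradiction (⊆-antisym (λ {x} x∈ → subst (x ∈_) (F─F≡⊥ F) (Y⊆ x∈)) ⊥⊆) ne
  ... | no  _  = refl
  empty : term ⊥ k ≡ u k
  empty rewrite true-does (⊥ ⊆? (F ─ F)) ⊥⊆ | ∣⊥∣≡0 (m M) | ∪-identityˡ F | ℕₚ.n∸n≡0 (rk M F) =
    ℤₚ.*-identityˡ (u k)

-- Uniqueness on a family of sets closed under flats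

sign*sign : ∀ r x → sign r * (sign r * x) ≡ x
sign*sign zero    x = trans (ℤₚ.*-identityˡ (1ℤ * x)) (ℤₚ.*-identityˡ x)
sign*sign (suc r) x = trans (neg-neg (sign r) x) (sign*sign r x)
  where
  neg-neg : ∀ s x → - s * (- s * x) ≡ s * (s * x)
  neg-neg = solve-∀

sign-cancel : ∀ r {x y} → sign r * x ≡ sign r * y → x ≡ y
sign-cancel r {x} {y} e = trans (sym (sign*sign r x)) (trans (cong (sign r *_) e) (sign*sign r y))

-- The discrepancy between Q and τ is palindromic of degree rk and vanishes above half of it.
module Uniqueness
  (M : RankData) (isM : IsMatroid M) (loopless : Loopless M)
  (Good : Subset (m M) → Set) (τ : Subset (m M) → Seq)
  (good-⊆ : ∀ {F} → Good F → F ⊆ E M)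
  (good-flat : ∀ {F G} → Good F → IsFlat (restrict M F) G → Good G)
  (τ-rank-zero : ∀ {F} → Good F → rk M F ≡ 0 → τ F ≗ δ₀)
  (τ-degree : ∀ {F} → Good F → rk M F ≢ 0 → ∀ k → rk M F ≤ 2 ℕ.* k → τ F k ≡ 0ℤ)
  (τ-reversal : ∀ {F} → Good F → ∃ λ v → Reversal (rk M F) (τ F) v ×
    sign (rk M F) • v ≗
    Σs (m M) (λ G → gate (does (isFlat? (restrict M F) G)) (sign (rk M G) • contractOp M F G (τ G))))
  (Q : RankData → Poly) (isQ : IsInverseKL Q)
  where
  open IsInverseKL isQ

  Q∣ : Subset (m M) → Seq
  Q∣ F = coeff (Q (restrict M F))

  term : Subset (m M) → (Subset (m M) → Seq) → Subset (m M) → Seq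
  term F σ G = gate (does (isFlat? (restrict M F) G)) (sign (rk M G) • contractOp M F G (σ G))

  coeff-klRHS : ∀ {F} → Good F → coeff (klRHS Q (restrict M F)) ≗ Σs (m M) (term F Q∣)
  coeff-klRHS {F} gF k = trans (coeff-subsetSum (isFlat? (restrict M F)) _ k)
    (Σs-cong (m M) (λ G → gate-cong (does (isFlat? (restrict M F) G)) (λ e k →
      trans (coeff-scale (sign (rk M G))
               (Q (restrict M G) ⊗ rev (rank (contract (restrict M F) G)) (charPoly (contract (restrict M F) G))) k)
        (•-cong (sign (rk M G)) (coeff-⊗-charPoly isM (good-⊆ gF)
          (proj₁ (does-true (isFlat? (restrict M F) G) e)) (Q (restrict M G))) k))) k)

  self-flat : ∀ F → IsFlat (restrict M F) F
  self-flat F = (λ x∈ → x∈) , (λ e e∈ e∉ → contradiction e∈ e∉)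

  term-self : ∀ F σ → term F σ F ≗ sign (rk M F) • σ F
  term-self F σ k rewrite true-does (isFlat? (restrict M F) F) (self-flat F) =
    •-cong (sign (rk M F)) (contractOp-self M F (σ F)) k

  contractOp-cong : ∀ F G {u v} → u ≗ v → contractOp M F G u ≗ contractOp M F G v
  contractOp-cong F G {u} {v} e = Σs-cong (m M) (λ Y → gate-cong (does (Y ⊆? (F ─ G)))
    (λ _ → •-cong (sign ∣ Y ∣) (shⁿ-cong (rk M (Y ∪ G) ∸ rk M G))))
    where
    shⁿ-cong : ∀ d → shⁿ d u ≗ shⁿ d v
    shⁿ-cong zero    = e
    shⁿ-cong (suc d) = sh-cong (shⁿ-cong d)

  -- In the recursions of `Q` and `τ` at `F` the summands of all flats other than `F` agree, and
  -- that of `F` itself is the polynomial up to the sign of the left-hand side. Comparing the two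
  -- recursions leaves `Q − τ` equal to its own reversal.
  palindromic : ∀ {F} → Good F →
    (∀ G → G ≢ F → IsFlat (restrict M F) G → Q∣ G ≗ τ G) →
    ∀ i j → i ℕ.+ j ≡ rk M F → Q∣ F j + τ F i ≡ τ F j + Q∣ F i
  palindromic {F} gF ih i j e = sign-cancel (rk M F) (begin
    s * (Q∣ F j + τ F i)
      ≡⟨ ℤₚ.*-distribˡ-+ s (Q∣ F j) (τ F i) ⟩
    s * Q∣ F j + s * τ F i
      ≡⟨ cong (λ x → s * x + s * τ F i) (proj₁ (rev-Reversal (rk M F) (Q (restrict M F))) i j e) ⟨
    s * coeff (rev (rk M F) (Q (restrict M F))) i + s * τ F i
      ≡⟨ cong₂ _+_ (trans (identity (restrict M F) (restrict-matroid isM (good-⊆ gF))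
                             (λ x x∈ → loopless x (good-⊆ gF x∈)) i)
                          (coeff-klRHS gF i))
                   (sym (term-self F τ i)) ⟩
    Σs (m M) (term F Q∣) i + term F τ F i
      ≡⟨ Σs-except F (term F Q∣) (term F τ) i (λ G ne → gate-cong (does (isFlat? (restrict M F) G))
           (λ e → •-cong (sign (rk M G)) (contractOp-cong F G
             (ih G ne (does-true (isFlat? (restrict M F) G) e)))) i) ⟩
    Σs (m M) (term F τ) i + term F Q∣ F i
      ≡⟨ cong₂ _+_ (sym (proj₂ (proj₂ (τ-reversal gF)) i)) (term-self F Q∣ i) ⟩
    s * proj₁ (τ-reversal gF) i + s * Q∣ F i
      ≡⟨ cong (λ x → s * x + s * Q∣ F i) (proj₁ (proj₁ (proj₂ (τ-reversal gF))) i j e) ⟩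
    s * τ F j + s * Q∣ F i
      ≡⟨ ℤₚ.*-distribˡ-+ s (τ F j) (Q∣ F i) ⟨
    s * (τ F j + Q∣ F i) ∎)
    where
    open ≡-Reasoning
    s = sign (rk M F)

  -- Strong induction on the size of `F`, with `c` as a bound: every flat of `F` other than `F` is
  -- smaller and is again `Good`.
  unique-below : ∀ c {F} → ∣ F ∣ < c → Good F → Q∣ F ≗ τ F
  unique-below (suc c) {F} (s≤s l) gF k with rk M F ℕₚ.≟ 0
  ... | yes r≡0 = trans (rank-zero (restrict M F) isM′ loopless′ r≡0 k)
                        (trans (coeff-monomial 0 k) (sym (τ-rank-zero gF r≡0 k)))
    where
    isM′ = restrict-matroid isM (good-⊆ gF)
    loopless′ : Loopless (restrict M F)
    loopless′ x x∈ = loopless x (good-⊆ gF x∈)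
  ... | no r≢0 = by-degree k
    where
    isM′ = restrict-matroid isM (good-⊆ gF)
    loopless′ : Loopless (restrict M F)
    loopless′ x x∈ = loopless x (good-⊆ gF x∈)
    ih : ∀ G → G ≢ F → IsFlat (restrict M F) G → Q∣ G ≗ τ G
    ih G ne fl = unique-below c (ℕₚ.≤-trans (smaller G F ne (proj₁ fl)) l) (good-flat gF fl)
      where
      smaller : ∀ {n} (G F : Subset n) → G ≢ F → G ⊆ F → ∣ G ∣ < ∣ F ∣
      smaller []            []            ne G⊆ = contradiction refl ne
      smaller (outside ∷ G) (outside ∷ F) ne G⊆ = smaller G F (ne ∘ cong (outside ∷_)) (drop-∷-⊆ G⊆)
      smaller (outside ∷ G) (inside ∷ F)  ne G⊆ = s≤s (p⊆q⇒∣p∣≤∣q∣ (drop-∷-⊆ G⊆))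
      smaller (inside ∷ G)  (outside ∷ F) ne G⊆ with () ← G⊆ here
      smaller (inside ∷ G)  (inside ∷ F)  ne G⊆ =
        s≤s (smaller G F (ne ∘ cong (inside ∷_)) (drop-∷-⊆ G⊆))
    high : ∀ k → rk M F ≤ 2 ℕ.* k → Q∣ F k ≡ 0ℤ
    high = degree (restrict M F) isM′ loopless′ r≢0
    by-degree : Q∣ F ≗ τ F
    by-degree k with rk M F ℕₚ.≤? (2 ℕ.* k)
    ... | yes h = trans (high k h) (sym (τ-degree gF r≢0 k h))
    -- The mirror index `j = r − k` lies in the upper half, where both polynomials vanish by their
    -- degree bounds.
    ... | no ¬h = sym (begin
      τ F k                ≡⟨ ℤₚ.+-identityˡ (τ F k) ⟨
      0ℤ + τ F k           ≡⟨ cong (_+ τ F k) (high j j-high) ⟨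
      Q∣ F j + τ F k       ≡⟨ palindromic gF ih k j k+j≡r ⟩
      τ F j + Q∣ F k       ≡⟨ cong (_+ Q∣ F k) (τ-degree gF r≢0 j j-high) ⟩
      0ℤ + Q∣ F k          ≡⟨ ℤₚ.+-identityˡ (Q∣ F k) ⟩
      Q∣ F k               ∎)
      where
      open ≡-Reasoning
      r = rk M F
      2k<r : 2 ℕ.* k < r
      2k<r = ℕₚ.≰⇒> ¬h
      j = r ∸ k
      k+j≡r : k ℕ.+ j ≡ r
      k+j≡r = ℕₚ.m+[n∸m]≡n (ℕₚ.≤-trans (ℕₚ.m≤m+n k (k ℕ.+ 0)) (ℕₚ.<⇒≤ 2k<r))
      k≤j : k ≤ j
      k≤j = ℕₚ.+-cancelˡ-≤ k k j (ℕₚ.≤-trans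
        (ℕₚ.≤-reflexive (cong (k ℕ.+_) (sym (ℕₚ.+-identityʳ k))))
        (ℕₚ.≤-trans (ℕₚ.<⇒≤ 2k<r) (ℕₚ.≤-reflexive (sym k+j≡r))))
      j-high : r ≤ 2 ℕ.* j
      j-high = ℕₚ.≤-trans (ℕₚ.≤-reflexive (sym k+j≡r))
        (ℕₚ.+-mono-≤ k≤j (ℕₚ.m≤m+n j 0))

  unique : ∀ {F} → Good F → Q∣ F ≗ τ F
  unique {F} = unique-below (suc ∣ F ∣) ℕₚ.≤-refl

-- The rank function of T_n

infixr 5 _⋈_
_⋈_ : ∀ {n} → Subset n → Subset n → Subset (n ℕ.+ n)
as ⋈ bs = as ++ᵛ bs

b2n : Bool → ℕ
b2n true  = 1
b2n false = 0

meets : ∀ {n} → Subset n → Subset n → Bool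
meets []       []       = false
meets (a ∷ as) (b ∷ bs) = (a ∧ b) ∨ meets as bs

-- e: is AB chosen; as, bs: the j such that Aj, respectively Bj, is chosen.
ρ : ∀ {n} → Bool → Subset n → Subset n → ℕ
ρ e as bs = ∣ as ∪ bs ∣ ℕ.+ b2n (e ∨ meets as bs)

∣∷∣ : ∀ {n} x (p : Subset n) → ∣ x ∷ p ∣ ≡ b2n x ℕ.+ ∣ p ∣
∣∷∣ true  p = refl
∣∷∣ false p = refl

module _ {v : ℕ} where

  relabel-hit : ∀ (lab : Fin v → Fin v) old new x → lab x ≡ old → relabel lab old new x ≡ new
  relabel-hit lab old new x e with lab x ≟ old
  ... | yes _ = refl
  ... | no ne = contradiction e ne

  relabel-miss : ∀ (lab : Fin v → Fin v) old new x → lab x ≢ old → relabel lab old new x ≡ lab x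
  relabel-miss lab old new x ne with lab x ≟ old
  ... | yes e = contradiction e ne
  ... | no _  = refl

  forestRank-new : ∀ {m} a b (es : Vec (Fin v × Fin v) m) X lab → lab a ≢ lab b →
    forestRank ((a , b) ∷ es) (inside ∷ X) lab ≡ suc (forestRank es X (relabel lab (lab b) (lab a)))
  forestRank-new a b es X lab ne with lab a ≟ lab b
  ... | yes e = contradiction e ne
  ... | no _  = refl

  forestRank-old : ∀ {m} a b (es : Vec (Fin v × Fin v) m) X lab → lab a ≡ lab b →
    forestRank ((a , b) ∷ es) (inside ∷ X) lab ≡ forestRank es X lab
  forestRank-old a b es X lab e with lab a ≟ lab b
  ... | yes _ = refl
  ... | no ne = contradiction e ne

  -- As long as the leaves are isolated, every chosen edge of the star joins a new vertex and counts
  -- one. `relabel` keeps the label of the first endpoint, so the label of `a` survives. The clauses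
  -- about `lab′` record just what the star at the other centre has to know: which leaves were
  -- absorbed, and that all other labels are unchanged.
  forestRank-fresh-star : ∀ {k p} (emb : Fin k → Fin v) → (∀ {i j} → emb i ≡ emb j → i ≡ j) →
    ∀ a (es : Vec (Fin v × Fin v) p) as Y lab →
    (∀ j → lab (emb j) ≡ emb j) → (∀ j → lab a ≢ emb j) →
    ∃ λ lab′ →
      forestRank (tabulate (λ j → a , emb j) ++ᵛ es) (as ++ᵛ Y) lab ≡ ∣ as ∣ ℕ.+ forestRank es Y lab′ ×
      (∀ x → (∀ j → lab x ≢ emb j) → lab′ x ≡ lab x) ×
      (∀ j → lab′ (emb j) ≡ (if lookup as j then lab a else emb j))
  forestRank-fresh-star emb inj a es [] Y lab fix ne = lab , refl , (λ _ _ → refl) , λ ()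
  forestRank-fresh-star emb inj a es (outside ∷ as) Y lab fix ne
    with lab′ , eq , unch , val ← forestRank-fresh-star (emb ∘ suc) (Finₚ.suc-injective ∘ inj) a es as Y lab
                                    (fix ∘ suc) (ne ∘ suc) =
    lab′ , eq , (λ x x≢ → unch x (x≢ ∘ suc)) ,
    λ { zero → trans (unch (emb zero) (λ j e → Finₚ.0≢1+n (inj (trans (sym (fix zero)) e)))) (fix zero)
      ; (suc j) → val j }
  forestRank-fresh-star emb inj a es (inside ∷ as) Y lab fix ne
    with lab′ , eq , unch , val ← forestRank-fresh-star (emb ∘ suc) (Finₚ.suc-injective ∘ inj) a es as Y
                                    (relabel lab (lab (emb zero)) (lab a))
                                    (λ j → trans (relabel-miss lab _ _ (emb (suc j))
                                       (λ e → Finₚ.0≢1+n (inj (sym (trans (sym (fix (suc j))) (trans e (fix zero)))))))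
                                       (fix (suc j)))
                                    (λ j e → ne (suc j) (trans (sym (relabel-miss lab _ _ a
                                       (λ e → ne zero (trans e (fix zero))))) e)) =
    lab′ ,
    trans (forestRank-new a (emb zero) _ _ lab (λ e → ne zero (trans e (fix zero)))) (cong suc eq) ,
    (λ x x≢ → let same = relabel-miss lab _ _ x (λ e → x≢ zero (trans e (fix zero))) in
              trans (unch x (λ j e → x≢ (suc j) (trans (sym same) e))) same) ,
    λ { zero → let hit = relabel-hit lab (lab (emb zero)) (lab a) (emb zero) refl in
               trans (unch (emb zero) (λ j e → ne (suc j) (trans (sym hit) e))) hit
      ; (suc j) → trans (val j) (cong (λ c → if lookup as j then c else emb (suc j))
                    (relabel-miss lab _ _ a (λ e → ne zero (trans e (fix zero))))) }

  -- The star at b, when b has already been joined to the vertices in as.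
  forestRank-joined-star : ∀ {k} (emb : Fin k → Fin v) → (∀ {i j} → emb i ≡ emb j → i ≡ j) →
    ∀ b as bs lab → (∀ j → lab b ≢ emb j) →
    (∀ j → lab (emb j) ≡ (if lookup as j then lab b else emb j)) →
    forestRank (tabulate (λ j → b , emb j)) bs lab ≡ ∣ bs ─ as ∣
  forestRank-joined-star emb inj b [] [] lab ne val = refl
  forestRank-joined-star emb inj b (x ∷ as) (outside ∷ bs) lab ne val =
    trans (forestRank-joined-star (emb ∘ suc) (Finₚ.suc-injective ∘ inj) b as bs lab (ne ∘ suc) (val ∘ suc))
          (out x)
    where
    out : ∀ x → ∣ bs ─ as ∣ ≡ ∣ (outside ∷ bs) ─ (x ∷ as) ∣
    out true  = refl
    out false = refl
  forestRank-joined-star emb inj b (inside ∷ as) (inside ∷ bs) lab ne val =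
    trans (forestRank-old b (emb zero) _ bs lab (sym (val zero)))
          (forestRank-joined-star (emb ∘ suc) (Finₚ.suc-injective ∘ inj) b as bs lab (ne ∘ suc) (val ∘ suc))
  forestRank-joined-star emb inj b (outside ∷ as) (inside ∷ bs) lab ne val =
    trans (forestRank-new b (emb zero) _ bs lab b-new)
      (cong suc (forestRank-joined-star (emb ∘ suc) (Finₚ.suc-injective ∘ inj) b as bs lab₁
        (λ j e → ne (suc j) (trans (sym b-same) e)) val₁))
    where
    lab₁ = relabel lab (lab (emb zero)) (lab b)
    b-new : lab b ≢ lab (emb zero)
    b-new e = ne zero (trans e (val zero))
    b-same : lab₁ b ≡ lab b
    b-same = relabel-miss lab _ _ b b-new
    not-emb₀ : ∀ j → lab (emb (suc j)) ≢ lab (emb zero)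
    not-emb₀ j e with lookup as j | val (suc j)
    ... | true  | p = ne zero (trans (sym p) (trans e (val zero)))
    ... | false | p = Finₚ.0≢1+n (inj (sym (trans (sym p) (trans e (val zero)))))
    val₁ : ∀ j → lab₁ (emb (suc j)) ≡ (if lookup as j then lab₁ b else emb (suc j))
    val₁ j = trans (relabel-miss lab _ _ (emb (suc j)) (not-emb₀ j))
      (trans (val (suc j)) (cong (λ c → if lookup as j then c else emb (suc j)) (sym b-same)))

  -- The star at b, when the vertices in as have been joined to each other (with label d), but not to b.
  forestRank-apart-star : ∀ {k} (emb : Fin k → Fin v) → (∀ {i j} → emb i ≡ emb j → i ≡ j) →
    ∀ b d as bs lab → (∀ j → lab b ≢ emb j) → (∀ j → d ≢ emb j) → lab b ≢ d →
    (∀ j → lab (emb j) ≡ (if lookup as j then d else emb j)) →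
    forestRank (tabulate (λ j → b , emb j)) bs lab ≡ ∣ bs ─ as ∣ ℕ.+ b2n (meets as bs)
  forestRank-apart-star emb inj b d [] [] lab ne ned b≢d val = refl
  forestRank-apart-star emb inj b d (x ∷ as) (outside ∷ bs) lab ne ned b≢d val =
    trans (forestRank-apart-star (emb ∘ suc) (Finₚ.suc-injective ∘ inj) b d as bs lab (ne ∘ suc) (ned ∘ suc)
             b≢d (val ∘ suc))
          (out x)
    where
    out : ∀ x → ∣ bs ─ as ∣ ℕ.+ b2n (meets as bs) ≡ ∣ (outside ∷ bs) ─ (x ∷ as) ∣ ℕ.+ b2n ((x ∧ false) ∨ meets as bs)
    out true  = refl
    out false = refl
  -- The first vertex adjacent to both centres merges their components. This edge is the one counted
  -- by `b2n (meets as bs)`; afterwards the vertices in `as` carry the label of `b`, and the star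
  -- counts as a joined one.
  forestRank-apart-star emb inj b d (inside ∷ as) (inside ∷ bs) lab ne ned b≢d val =
    trans (forestRank-new b (emb zero) _ bs lab b-new)
      (trans (cong suc (forestRank-joined-star (emb ∘ suc) (Finₚ.suc-injective ∘ inj) b as bs lab₁
                (λ j e → ne (suc j) (trans (sym b-same) e)) val₁))
             (sym (ℕₚ.+-comm ∣ bs ─ as ∣ 1)))
    where
    lab₁ = relabel lab (lab (emb zero)) (lab b)
    b-new : lab b ≢ lab (emb zero)
    b-new e = b≢d (trans e (val zero))
    b-same : lab₁ b ≡ lab b
    b-same = relabel-miss lab _ _ b b-new
    val₁ : ∀ j → lab₁ (emb (suc j)) ≡ (if lookup as j then lab₁ b else emb (suc j))
    val₁ j with lookup as j | val (suc j)
    ... | true  | p = trans (relabel-hit lab _ _ (emb (suc j)) (trans p (sym (val zero)))) (sym b-same)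
    ... | false | p = trans (relabel-miss lab _ _ (emb (suc j))
                        (λ e → ned (suc j) (trans (sym (val zero)) (trans (sym e) p)))) p
  forestRank-apart-star emb inj b d (outside ∷ as) (inside ∷ bs) lab ne ned b≢d val =
    trans (forestRank-new b (emb zero) _ bs lab b-new)
      (cong suc (forestRank-apart-star (emb ∘ suc) (Finₚ.suc-injective ∘ inj) b d as bs lab₁
        (λ j e → ne (suc j) (trans (sym b-same) e)) (ned ∘ suc) (λ e → b≢d (trans (sym b-same) e)) val₁))
    where
    lab₁ = relabel lab (lab (emb zero)) (lab b)
    b-new : lab b ≢ lab (emb zero)
    b-new e = ne zero (trans e (val zero))
    b-same : lab₁ b ≡ lab b
    b-same = relabel-miss lab _ _ b b-new
    not-emb₀ : ∀ j → lab (emb (suc j)) ≢ lab (emb zero)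
    not-emb₀ j e with lookup as j | val (suc j)
    ... | true  | p = ned zero (trans (sym p) (trans e (val zero)))
    ... | false | p = Finₚ.0≢1+n (inj (sym (trans (sym p) (trans e (val zero)))))
    val₁ : ∀ j → lab₁ (emb (suc j)) ≡ (if lookup as j then d else emb (suc j))
    val₁ j = trans (relabel-miss lab _ _ (emb (suc j)) (not-emb₀ j)) (val (suc j))

∣p∣+∣q─p∣ : ∀ {n} (p q : Subset n) → ∣ p ∣ ℕ.+ ∣ q ─ p ∣ ≡ ∣ p ∪ q ∣
∣p∣+∣q─p∣ []            []            = refl
∣p∣+∣q─p∣ (inside ∷ p)  (x ∷ q)       = cong suc (∣p∣+∣q─p∣ p q)
∣p∣+∣q─p∣ (outside ∷ p) (outside ∷ q) = ∣p∣+∣q─p∣ p q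
∣p∣+∣q─p∣ (outside ∷ p) (inside ∷ q)  = trans (ℕₚ.+-suc ∣ p ∣ _) (cong suc (∣p∣+∣q─p∣ p q))

-- Each touched vertex `j` costs one edge of a spanning forest, and one more is needed exactly if
-- `A` and `B` are connected, by `AB` or through some `j`. In the order of the edges the star at `A`
-- is always fresh, while the star at `B` is joined or apart according to whether `AB` was chosen.
rk-T : ∀ n e (as bs : Subset n) → rk (T n) (e ∷ as ⋈ bs) ≡ ρ e as bs
rk-T n outside as bs
  with lab , eq , unch , val ← forestRank-fresh-star {suc (suc n)} (λ j → suc (suc j))
         (Finₚ.suc-injective ∘ Finₚ.suc-injective) zero (tabulate (λ j → suc zero , suc (suc j)))
         as bs id (λ _ → refl) (λ _ ()) = begin
  rk (T n) (outside ∷ as ⋈ bs)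
    ≡⟨ eq ⟩
  ∣ as ∣ ℕ.+ forestRank (tabulate (λ j → suc zero , suc (suc j))) bs lab
    ≡⟨ cong (∣ as ∣ ℕ.+_) (forestRank-apart-star (λ j → suc (suc j))
         (Finₚ.suc-injective ∘ Finₚ.suc-injective) (suc zero) zero as bs lab
         (λ j e → case-≢ (trans (sym lab1) e)) (λ _ ()) (λ e → case-≢₀ (trans (sym lab1) e)) val) ⟩
  ∣ as ∣ ℕ.+ (∣ bs ─ as ∣ ℕ.+ b2n (meets as bs))
    ≡⟨ ℕₚ.+-assoc ∣ as ∣ _ _ ⟨
  ∣ as ∣ ℕ.+ ∣ bs ─ as ∣ ℕ.+ b2n (meets as bs)
    ≡⟨ cong (ℕ._+ b2n (meets as bs)) (∣p∣+∣q─p∣ as bs) ⟩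
  ρ outside as bs ∎
  where
  open ≡-Reasoning
  lab1 = unch (suc zero) (λ _ ())
  case-≢ : ∀ {j : Fin n} → Fin.suc zero ≢ suc (suc j)
  case-≢ ()
  case-≢₀ : Fin.suc {suc n} zero ≢ zero
  case-≢₀ ()
rk-T n inside as bs
  with lab , eq , unch , val ← forestRank-fresh-star {suc (suc n)} (λ j → suc (suc j))
         (Finₚ.suc-injective ∘ Finₚ.suc-injective) zero (tabulate (λ j → suc zero , suc (suc j)))
         as bs (relabel id (suc zero) zero) (λ _ → refl) (λ _ ()) = begin
  rk (T n) (inside ∷ as ⋈ bs)
    ≡⟨ cong suc eq ⟩
  suc (∣ as ∣ ℕ.+ forestRank (tabulate (λ j → suc zero , suc (suc j))) bs lab)
    ≡⟨ cong (λ x → suc (∣ as ∣ ℕ.+ x)) (forestRank-joined-star (λ j → suc (suc j))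
         (Finₚ.suc-injective ∘ Finₚ.suc-injective) (suc zero) as bs lab
         (λ j e → case-≢ (trans (sym lab1) e))
         (λ j → trans (val j) (cong (λ c → if lookup as j then c else suc (suc j)) (sym lab1)))) ⟩
  suc (∣ as ∣ ℕ.+ ∣ bs ─ as ∣)
    ≡⟨ cong suc (∣p∣+∣q─p∣ as bs) ⟩
  suc ∣ as ∪ bs ∣
    ≡⟨ ℕₚ.+-comm ∣ as ∪ bs ∣ 1 ⟨
  ρ inside as bs ∎
  where
  open ≡-Reasoning
  lab1 = unch (suc zero) (λ _ ())
  case-≢ : ∀ {j : Fin n} → Fin.zero ≢ suc (suc j)
  case-≢ ()

-- The matroid axioms for T_n

by-halves : ∀ {n} (P : Subset (suc (n ℕ.+ n)) → Set) → (∀ e (as bs : Subset n) → P (e ∷ as ⋈ bs)) → ∀ X → P X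
by-halves {n} P p (e ∷ X) with as , bs , refl ← Vec.splitAt n X = p e as bs

by-edges : ∀ {n} (P : Fin (suc (n ℕ.+ n)) → Set) → P zero →
           (∀ i → P (suc (i ↑ˡ n))) → (∀ i → P (suc (n ↑ʳ i))) → ∀ x → P x
by-edges P p₀ pₐ p_b zero = p₀
by-edges {n} P p₀ pₐ p_b (suc x) = subst (P ∘ suc) (Finₚ.join-splitAt n n x) (go (splitAt n x))
  where
  go : ∀ s → P (suc (join n n s))
  go (inj₁ i) = pₐ i
  go (inj₂ i) = p_b i

∣++∣ : ∀ {m n} (p : Subset m) (p′ : Subset n) → ∣ p ++ᵛ p′ ∣ ≡ ∣ p ∣ ℕ.+ ∣ p′ ∣
∣++∣ []            p′ = refl
∣++∣ (inside ∷ p)  p′ = cong suc (∣++∣ p p′)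
∣++∣ (outside ∷ p) p′ = ∣++∣ p p′

∪-⋈ : ∀ {n} (as bs as′ bs′ : Subset n) → (as ⋈ bs) ∪ (as′ ⋈ bs′) ≡ (as ∪ as′) ⋈ (bs ∪ bs′)
∪-⋈ as bs as′ bs′ = Vecₚ.zipWith-++ _∨_ as bs as′ bs′

∩-⋈ : ∀ {n} (as bs as′ bs′ : Subset n) → (as ⋈ bs) ∩ (as′ ⋈ bs′) ≡ (as ∩ as′) ⋈ (bs ∩ bs′)
∩-⋈ as bs as′ bs′ = Vecₚ.zipWith-++ _∧_ as bs as′ bs′

++-⊆ˡ : ∀ {m n} (p p′ : Subset m) {r r′ : Subset n} → p ++ᵛ r ⊆ p′ ++ᵛ r′ → p ⊆ p′
++-⊆ˡ []      []        s ()
++-⊆ˡ (x ∷ p) (x′ ∷ p′) s here with s here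
... | here = here
++-⊆ˡ (x ∷ p) (x′ ∷ p′) s (there i) = there (++-⊆ˡ p p′ (drop-∷-⊆ s) i)

++-⊆ʳ : ∀ {m n} (p p′ : Subset m) {r r′ : Subset n} → p ++ᵛ r ⊆ p′ ++ᵛ r′ → r ⊆ r′
++-⊆ʳ []      []        s = s
++-⊆ʳ (x ∷ p) (x′ ∷ p′) s = ++-⊆ʳ p p′ (drop-∷-⊆ s)

head-⊆ : ∀ {n x} {p p′ : Subset n} → (inside ∷ p) ⊆ (x ∷ p′) → x ≡ inside
head-⊆ s with s here
... | here = refl

meets-mono : ∀ {n} {as bs as′ bs′ : Subset n} → as ⊆ as′ → bs ⊆ bs′ →
             meets as bs ≡ true → meets as′ bs′ ≡ true
meets-mono {as = []} {[]} {[]} {[]} s s′ ()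
meets-mono {as = inside ∷ as} {inside ∷ bs} {a′ ∷ as′} {b′ ∷ bs′} s s′ e
  rewrite head-⊆ s | head-⊆ s′ = refl
meets-mono {as = outside ∷ as} {b ∷ bs} {a′ ∷ as′} {b′ ∷ bs′} s s′ e =
  trans (cong ((a′ ∧ b′) ∨_) (meets-mono (drop-∷-⊆ s) (drop-∷-⊆ s′) e)) (Boolₚ.∨-zeroʳ (a′ ∧ b′))
meets-mono {as = inside ∷ as} {outside ∷ bs} {a′ ∷ as′} {b′ ∷ bs′} s s′ e =
  trans (cong ((a′ ∧ b′) ∨_) (meets-mono (drop-∷-⊆ s) (drop-∷-⊆ s′) e)) (Boolₚ.∨-zeroʳ (a′ ∧ b′))

b2n-mono : ∀ x y → (x ≡ true → y ≡ true) → b2n x ≤ b2n y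
b2n-mono false y     _ = z≤n
b2n-mono true  true  _ = ℕₚ.≤-refl
b2n-mono true  false f with () ← f refl

∨-true-map : ∀ {x y x′ y′} → (x ≡ true → x′ ≡ true) → (y ≡ true → y′ ≡ true) → x ∨ y ≡ true → x′ ∨ y′ ≡ true
∨-true-map {true}               f g e rewrite f refl = refl
∨-true-map {false} {x′ = x′}    f g e rewrite g e = Boolₚ.∨-zeroʳ x′

ρ-mono : ∀ {n} e e′ (as bs as′ bs′ : Subset n) → (e ≡ true → e′ ≡ true) → as ⊆ as′ → bs ⊆ bs′ →
         ρ e as bs ≤ ρ e′ as′ bs′
ρ-mono e e′ as bs as′ bs′ ee s s′ = ℕₚ.+-mono-≤
  (p⊆q⇒∣p∣≤∣q∣ {p = as ∪ bs} {as′ ∪ bs′} (λ x∈ → x∈p∪q⁺ ([ inj₁ ∘ s , inj₂ ∘ s′ ] (x∈p∪q⁻ as bs x∈))))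
  (b2n-mono _ _ (∨-true-map ee (meets-mono s s′)))

ρ-bound : ∀ {n} e (as bs : Subset n) → ρ e as bs ≤ ∣ e ∷ as ⋈ bs ∣
ρ-bound e as bs = begin
  ∣ as ∪ bs ∣ ℕ.+ b2n (e ∨ meets as bs)          ≤⟨ ℕₚ.+-monoʳ-≤ ∣ as ∪ bs ∣ (b2n-∨ e (meets as bs)) ⟩
  ∣ as ∪ bs ∣ ℕ.+ (b2n e ℕ.+ b2n (meets as bs))    ≡⟨ rotate ∣ as ∪ bs ∣ (b2n e) (b2n (meets as bs)) ⟩
  b2n e ℕ.+ (∣ as ∪ bs ∣ ℕ.+ b2n (meets as bs))    ≤⟨ ℕₚ.+-monoʳ-≤ (b2n e) (union-bound as bs) ⟩
  b2n e ℕ.+ (∣ as ∣ ℕ.+ ∣ bs ∣)                    ≡⟨ cong (b2n e ℕ.+_) (∣++∣ as bs) ⟨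
  b2n e ℕ.+ ∣ as ⋈ bs ∣                          ≡⟨ ∣∷∣ e (as ⋈ bs) ⟨
  ∣ e ∷ as ⋈ bs ∣                              ∎
  where
  open ℕₚ.≤-Reasoning
  rotate : ∀ x y z → x ℕ.+ (y ℕ.+ z) ≡ y ℕ.+ (x ℕ.+ z)
  rotate = ℕSolver.solve-∀
  b2n-∨ : ∀ x y → b2n (x ∨ y) ≤ b2n x ℕ.+ b2n y
  b2n-∨ true  y = s≤s z≤n
  b2n-∨ false y = ℕₚ.≤-refl
  union-bound : ∀ {n} (as bs : Subset n) → ∣ as ∪ bs ∣ ℕ.+ b2n (meets as bs) ≤ ∣ as ∣ ℕ.+ ∣ bs ∣
  union-bound []            []            = z≤n
  union-bound (inside ∷ as) (inside ∷ bs) = s≤s (begin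
    ∣ as ∪ bs ∣ ℕ.+ 1                        ≡⟨ ℕₚ.+-comm ∣ as ∪ bs ∣ 1 ⟩
    suc ∣ as ∪ bs ∣                        ≤⟨ s≤s (ℕₚ.≤-trans (ℕₚ.m≤m+n _ _) (union-bound as bs)) ⟩
    suc (∣ as ∣ ℕ.+ ∣ bs ∣)                  ≡⟨ ℕₚ.+-suc ∣ as ∣ ∣ bs ∣ ⟨
    ∣ as ∣ ℕ.+ suc ∣ bs ∣                    ∎)
  union-bound (inside ∷ as)  (outside ∷ bs) = s≤s (union-bound as bs)
  union-bound (outside ∷ as) (inside ∷ bs)  =
    ℕₚ.≤-trans (s≤s (union-bound as bs)) (ℕₚ.≤-reflexive (sym (ℕₚ.+-suc ∣ as ∣ ∣ bs ∣)))
  union-bound (outside ∷ as) (outside ∷ bs) = union-bound as bs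

support-head : ∀ a b a′ b′ →
  b2n ((a ∨ a′) ∨ (b ∨ b′)) ℕ.+ b2n ((a ∧ a′) ∨ (b ∧ b′)) ≤ b2n (a ∨ b) ℕ.+ b2n (a′ ∨ b′)
support-head true  b     true  b′ = ℕₚ.≤-refl
support-head true  true  false b′ = ℕₚ.≤-refl
support-head true  false false b′ = s≤s z≤n
support-head false false a′    b′ = ℕₚ.≤-reflexive (ℕₚ.+-identityʳ (b2n (a′ ∨ b′)))
support-head false true  true  true  = ℕₚ.≤-refl
support-head false true  true  false = s≤s z≤n
support-head false true  false b′ = ℕₚ.≤-refl

+-mono-interchange : ∀ a b c d a′ b′ c′ d′ → a ℕ.+ b ≤ c ℕ.+ d → a′ ℕ.+ b′ ≤ c′ ℕ.+ d′ →
                     (a ℕ.+ a′) ℕ.+ (b ℕ.+ b′) ≤ (c ℕ.+ c′) ℕ.+ (d ℕ.+ d′)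
+-mono-interchange a b c d a′ b′ c′ d′ p p′ = begin
  (a ℕ.+ a′) ℕ.+ (b ℕ.+ b′) ≡⟨ interchange a a′ b b′ ⟩
  (a ℕ.+ b) ℕ.+ (a′ ℕ.+ b′) ≤⟨ ℕₚ.+-mono-≤ p p′ ⟩
  (c ℕ.+ d) ℕ.+ (c′ ℕ.+ d′) ≡⟨ interchange c d c′ d′ ⟩
  (c ℕ.+ c′) ℕ.+ (d ℕ.+ d′) ∎
  where
  open ℕₚ.≤-Reasoning
  interchange : ∀ x y z t → (x ℕ.+ y) ℕ.+ (z ℕ.+ t) ≡ (x ℕ.+ z) ℕ.+ (y ℕ.+ t)
  interchange = ℕSolver.solve-∀

support-submod : ∀ {n} (as bs as′ bs′ : Subset n) →
  ∣ (as ∪ as′) ∪ (bs ∪ bs′) ∣ ℕ.+ ∣ (as ∩ as′) ∪ (bs ∩ bs′) ∣ ≤ ∣ as ∪ bs ∣ ℕ.+ ∣ as′ ∪ bs′ ∣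
support-submod [] [] [] [] = z≤n
support-submod (a ∷ as) (b ∷ bs) (a′ ∷ as′) (b′ ∷ bs′)
  rewrite ∣∷∣ ((a ∨ a′) ∨ (b ∨ b′)) ((as ∪ as′) ∪ (bs ∪ bs′))
        | ∣∷∣ ((a ∧ a′) ∨ (b ∧ b′)) ((as ∩ as′) ∪ (bs ∩ bs′))
        | ∣∷∣ (a ∨ b) (as ∪ bs) | ∣∷∣ (a′ ∨ b′) (as′ ∪ bs′) =
  +-mono-interchange (b2n ((a ∨ a′) ∨ (b ∨ b′))) (b2n ((a ∧ a′) ∨ (b ∧ b′))) (b2n (a ∨ b)) (b2n (a′ ∨ b′))
    _ _ (∣ as ∪ bs ∣) (∣ as′ ∪ bs′ ∣) (support-head a b a′ b′) (support-submod as bs as′ bs′)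

-- If A and B become connected only in the union, then some j is joined to A by one set and to B by
-- the other one, and this j makes the inequality strict.
support-submod-strict : ∀ {n} (as bs as′ bs′ : Subset n) →
  meets as bs ≡ false → meets as′ bs′ ≡ false → meets (as ∪ as′) (bs ∪ bs′) ≡ true →
  suc (∣ (as ∪ as′) ∪ (bs ∪ bs′) ∣ ℕ.+ ∣ (as ∩ as′) ∪ (bs ∩ bs′) ∣) ≤ ∣ as ∪ bs ∣ ℕ.+ ∣ as′ ∪ bs′ ∣
support-submod-strict [] [] [] [] p p′ ()
support-submod-strict (true ∷ as) (true ∷ bs) (a′ ∷ as′) (b′ ∷ bs′) () p′ m
support-submod-strict (true ∷ as) (false ∷ bs) (true ∷ as′) (true ∷ bs′) p () m
support-submod-strict (false ∷ as) (b ∷ bs) (true ∷ as′) (true ∷ bs′) p () m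
support-submod-strict (true ∷ as) (false ∷ bs) (false ∷ as′) (true ∷ bs′) p p′ m =
  s≤s (ℕₚ.≤-trans (s≤s (support-submod as bs as′ bs′)) (ℕₚ.≤-reflexive (sym (ℕₚ.+-suc _ _))))
support-submod-strict (false ∷ as) (true ∷ bs) (true ∷ as′) (false ∷ bs′) p p′ m =
  s≤s (ℕₚ.≤-trans (s≤s (support-submod as bs as′ bs′)) (ℕₚ.≤-reflexive (sym (ℕₚ.+-suc _ _))))
support-submod-strict (true ∷ as) (false ∷ bs) (true ∷ as′) (false ∷ bs′) p p′ m =
  s≤s (ℕₚ.≤-trans (ℕₚ.≤-reflexive (cong suc (ℕₚ.+-suc _ _)))
    (ℕₚ.≤-trans (s≤s (support-submod-strict as bs as′ bs′ p p′ m)) (ℕₚ.≤-reflexive (sym (ℕₚ.+-suc _ _)))))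
support-submod-strict (true ∷ as) (false ∷ bs) (false ∷ as′) (false ∷ bs′) p p′ m =
  s≤s (support-submod-strict as bs as′ bs′ p p′ m)
support-submod-strict (false ∷ as) (true ∷ bs) (false ∷ as′) (true ∷ bs′) p p′ m =
  s≤s (ℕₚ.≤-trans (ℕₚ.≤-reflexive (cong suc (ℕₚ.+-suc _ _)))
    (ℕₚ.≤-trans (s≤s (support-submod-strict as bs as′ bs′ p p′ m)) (ℕₚ.≤-reflexive (sym (ℕₚ.+-suc _ _)))))
support-submod-strict (false ∷ as) (true ∷ bs) (false ∷ as′) (false ∷ bs′) p p′ m =
  s≤s (support-submod-strict as bs as′ bs′ p p′ m)
support-submod-strict (false ∷ as) (false ∷ bs) (true ∷ as′) (false ∷ bs′) p p′ m =
  ℕₚ.≤-trans (s≤s (support-submod-strict as bs as′ bs′ p p′ m)) (ℕₚ.≤-reflexive (sym (ℕₚ.+-suc _ _)))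
support-submod-strict (false ∷ as) (false ∷ bs) (false ∷ as′) (true ∷ bs′) p p′ m =
  ℕₚ.≤-trans (s≤s (support-submod-strict as bs as′ bs′ p p′ m)) (ℕₚ.≤-reflexive (sym (ℕₚ.+-suc _ _)))
support-submod-strict (false ∷ as) (false ∷ bs) (false ∷ as′) (false ∷ bs′) p p′ m =
  support-submod-strict as bs as′ bs′ p p′ m

add-connected : ∀ {n} (as bs as′ bs′ : Subset n) z t {x y} → x ℕ.+ y ≤ b2n z ℕ.+ b2n t →
  (∣ (as ∪ as′) ∪ (bs ∪ bs′) ∣ ℕ.+ x) ℕ.+ (∣ (as ∩ as′) ∪ (bs ∩ bs′) ∣ ℕ.+ y)
  ≤ (∣ as ∪ bs ∣ ℕ.+ b2n z) ℕ.+ (∣ as′ ∪ bs′ ∣ ℕ.+ b2n t)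
add-connected as bs as′ bs′ z t {x} {y} p = +-mono-interchange
  (∣ (as ∪ as′) ∪ (bs ∪ bs′) ∣) (∣ (as ∩ as′) ∪ (bs ∩ bs′) ∣) (∣ as ∪ bs ∣) (∣ as′ ∪ bs′ ∣) x y (b2n z) (b2n t)
  (support-submod as bs as′ bs′) p

not-true : ∀ {x} → x ≢ true → x ≡ false
not-true {true}  ne = contradiction refl ne
not-true {false} ne = refl

-- The number of touched vertices is submodular, and the indicator of `A` and `B` being connected is
-- so too, unless the union connects them and neither set does. In that case the strict inequality
-- for the touched vertices pays for the extra one.
ρ-submod : ∀ {n} e e′ (as bs as′ bs′ : Subset n) →
  ρ (e ∨ e′) (as ∪ as′) (bs ∪ bs′) ℕ.+ ρ (e ∧ e′) (as ∩ as′) (bs ∩ bs′) ≤ ρ e as bs ℕ.+ ρ e′ as′ bs′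
ρ-submod e e′ as bs as′ bs′
  with e ∨ meets as bs in c | e′ ∨ meets as′ bs′ in c′
... | true | true = add-connected as bs as′ bs′ true true
  (ℕₚ.+-mono-≤ (b2n≤1 ((e ∨ e′) ∨ meets (as ∪ as′) (bs ∪ bs′)))
               (b2n≤1 ((e ∧ e′) ∨ meets (as ∩ as′) (bs ∩ bs′))))
  where
  b2n≤1 : ∀ x → b2n x ≤ 1
  b2n≤1 true  = ℕₚ.≤-refl
  b2n≤1 false = z≤n
... | true | false = add-connected as bs as′ bs′ true false
  (ℕₚ.+-mono-≤ (b2n-mono _ true (λ _ → refl))
    (ℕₚ.≤-reflexive (cong b2n (not-true λ t → contradiction (trans (sym c′) (right t)) λ ()))))
  where
  right : (e ∧ e′) ∨ meets (as ∩ as′) (bs ∩ bs′) ≡ true → e′ ∨ meets as′ bs′ ≡ true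
  right = ∨-true-map (λ t → trans (sym (cong (_∧ e′) (Boolₚ.∧-conicalˡ e e′ t))) t)
                     (meets-mono (p∩q⊆q as as′) (p∩q⊆q bs bs′))
... | false | true = add-connected as bs as′ bs′ false true
  (ℕₚ.+-mono-≤ (b2n-mono _ true (λ _ → refl))
    (ℕₚ.≤-reflexive (cong b2n (not-true λ t → contradiction (trans (sym c) (left t)) λ ()))))
  where
  left : (e ∧ e′) ∨ meets (as ∩ as′) (bs ∩ bs′) ≡ true → e ∨ meets as bs ≡ true
  left = ∨-true-map (λ t → Boolₚ.∧-conicalˡ e e′ t)
                    (meets-mono (p∩q⊆p as as′) (p∩q⊆p bs bs′))
ρ-submod false false as bs as′ bs′ | false | false
  rewrite not-true {meets (as ∩ as′) (bs ∩ bs′)}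
            (λ t → contradiction (trans (sym c) (meets-mono (p∩q⊆p as as′) (p∩q⊆p bs bs′) t)) λ ())
  with meets (as ∪ as′) (bs ∪ bs′) in m
... | true = begin
  (∣ (as ∪ as′) ∪ (bs ∪ bs′) ∣ ℕ.+ 1) ℕ.+ (∣ (as ∩ as′) ∪ (bs ∩ bs′) ∣ ℕ.+ 0)
    ≡⟨ regroup ∣ (as ∪ as′) ∪ (bs ∪ bs′) ∣ ∣ (as ∩ as′) ∪ (bs ∩ bs′) ∣ ⟩
  suc (∣ (as ∪ as′) ∪ (bs ∪ bs′) ∣ ℕ.+ ∣ (as ∩ as′) ∪ (bs ∩ bs′) ∣)
    ≤⟨ support-submod-strict as bs as′ bs′ c c′ m ⟩
  ∣ as ∪ bs ∣ ℕ.+ ∣ as′ ∪ bs′ ∣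
    ≡⟨ cong₂ ℕ._+_ (sym (ℕₚ.+-identityʳ ∣ as ∪ bs ∣)) (sym (ℕₚ.+-identityʳ ∣ as′ ∪ bs′ ∣)) ⟩
  (∣ as ∪ bs ∣ ℕ.+ 0) ℕ.+ (∣ as′ ∪ bs′ ∣ ℕ.+ 0) ∎
  where
  open ℕₚ.≤-Reasoning
  regroup : ∀ x y → (x ℕ.+ 1) ℕ.+ (y ℕ.+ 0) ≡ suc (x ℕ.+ y)
  regroup = ℕSolver.solve-∀
... | false = add-connected as bs as′ bs′ false false z≤n

isMatroid-T : ∀ n → IsMatroid (T n)
isMatroid-T n = record
  { rk-bound = λ X _ → by-halves (λ X → rk (T n) X ≤ ∣ X ∣)
      (λ e as bs → subst (_≤ ∣ e ∷ as ⋈ bs ∣) (sym (rk-T n e as bs)) (ρ-bound e as bs)) X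
  ; rk-mono = λ X Y _ _ → by-halves (λ X → ∀ Y → X ⊆ Y → rk (T n) X ≤ rk (T n) Y)
      (λ e as bs → by-halves (λ Y → (e ∷ as ⋈ bs) ⊆ Y → rk (T n) (e ∷ as ⋈ bs) ≤ rk (T n) Y) (mono e as bs)) X Y
  ; rk-submod = λ X Y _ _ → by-halves (λ X → ∀ Y → rk (T n) (X ∪ Y) ℕ.+ rk (T n) (X ∩ Y) ≤ rk (T n) X ℕ.+ rk (T n) Y)
      (λ e as bs → by-halves (λ Y → let X = e ∷ as ⋈ bs in rk (T n) (X ∪ Y) ℕ.+ rk (T n) (X ∩ Y) ≤ rk (T n) X ℕ.+ rk (T n) Y)
        (submod e as bs)) X Y
  }
  where
  mono : ∀ e (as bs : Subset n) e′ (as′ bs′ : Subset n) → (e ∷ as ⋈ bs) ⊆ (e′ ∷ as′ ⋈ bs′) →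
         rk (T n) (e ∷ as ⋈ bs) ≤ rk (T n) (e′ ∷ as′ ⋈ bs′)
  mono e as bs e′ as′ bs′ s rewrite rk-T n e as bs | rk-T n e′ as′ bs′ =
    ρ-mono e e′ as bs as′ bs′ (λ { refl → head-⊆ s })
      (++-⊆ˡ as as′ (drop-∷-⊆ s)) (++-⊆ʳ as as′ (drop-∷-⊆ s))
  submod : ∀ e (as bs : Subset n) e′ (as′ bs′ : Subset n) →
    rk (T n) ((e ∷ as ⋈ bs) ∪ (e′ ∷ as′ ⋈ bs′)) ℕ.+ rk (T n) ((e ∷ as ⋈ bs) ∩ (e′ ∷ as′ ⋈ bs′))
    ≤ rk (T n) (e ∷ as ⋈ bs) ℕ.+ rk (T n) (e′ ∷ as′ ⋈ bs′)
  submod e as bs e′ as′ bs′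
    rewrite ∪-⋈ as bs as′ bs′ | ∩-⋈ as bs as′ bs′
          | rk-T n (e ∨ e′) (as ∪ as′) (bs ∪ bs′) | rk-T n (e ∧ e′) (as ∩ as′) (bs ∩ bs′)
          | rk-T n e as bs | rk-T n e′ as′ bs′ = ρ-submod e e′ as bs as′ bs′

⊥-++ : ∀ m n → ⊥ {m ℕ.+ n} ≡ ⊥ {m} ++ᵛ ⊥ {n}
⊥-++ zero    n = refl
⊥-++ (suc m) n = cong (outside ∷_) (⊥-++ m n)

⁅↑ˡ⁆ : ∀ {n} (i : Fin n) → ⁅ i ↑ˡ n ⁆ ≡ ⁅ i ⁆ ⋈ ⊥
⁅↑ˡ⁆ {n} i = go i n
  where
  go : ∀ {m} (i : Fin m) n → ⁅ i ↑ˡ n ⁆ ≡ ⁅ i ⁆ ++ᵛ ⊥ {n}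
  go {suc m} zero n = cong (inside ∷_) (⊥-++ m n)
  go (suc i) n = cong (outside ∷_) (go i n)

⁅↑ʳ⁆ : ∀ {n} (i : Fin n) → ⁅ n ↑ʳ i ⁆ ≡ ⊥ ⋈ ⁅ i ⁆
⁅↑ʳ⁆ {n} i = go n i
  where
  go : ∀ m {n} (i : Fin n) → ⁅ m ↑ʳ i ⁆ ≡ ⊥ {m} ++ᵛ ⁅ i ⁆
  go zero    i = refl
  go (suc m) i = cong (outside ∷_) (go m i)

meets-comm : ∀ {n} (as bs : Subset n) → meets as bs ≡ meets bs as
meets-comm []       []       = refl
meets-comm (a ∷ as) (b ∷ bs) = cong₂ _∨_ (Boolₚ.∧-comm a b) (meets-comm as bs)

ρ-comm : ∀ {n} e (as bs : Subset n) → ρ e as bs ≡ ρ e bs as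
ρ-comm e as bs = cong₂ (λ p x → ∣ p ∣ ℕ.+ b2n (e ∨ x)) (∪-comm as bs) (meets-comm as bs)

meets-⊥ : ∀ {n} (as : Subset n) → meets as ⊥ ≡ false
meets-⊥ []       = refl
meets-⊥ (a ∷ as) = cong₂ _∨_ (Boolₚ.∧-zeroʳ a) (meets-⊥ as)

loopless-T : ∀ n → Loopless (T n)
loopless-T n x _ = by-edges (λ x → rk (T n) ⁅ x ⁆ ≡ 1) edge₀ edgeₐ edge_b x
  where
  edge₀ : rk (T n) ⁅ zero ⁆ ≡ 1
  edge₀ rewrite ⊥-++ n n | rk-T n inside ⊥ ⊥ | ∪-identityˡ (⊥ {n}) | ∣⊥∣≡0 n = refl
  single : ∀ i → ρ outside ⁅ i ⁆ (⊥ {n}) ≡ 1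
  single i rewrite ∪-identityʳ ⁅ i ⁆ | ∣⁅x⁆∣≡1 i | meets-⊥ ⁅ i ⁆ = refl
  edgeₐ : ∀ i → rk (T n) ⁅ suc (i ↑ˡ n) ⁆ ≡ 1
  edgeₐ i rewrite ⁅↑ˡ⁆ i | rk-T n outside ⁅ i ⁆ ⊥ = single i
  edge_b : ∀ i → rk (T n) ⁅ suc (n ↑ʳ i) ⁆ ≡ 1
  edge_b i rewrite ⁅↑ʳ⁆ i | rk-T n outside ⊥ ⁅ i ⁆ | ρ-comm outside ⊥ ⁅ i ⁆ = single i

-- The flats of T_n, and of its restrictions to flats

data Good n : Subset (suc (n ℕ.+ n)) → Set where
  spanning : (σ : Subset n) → Good n (inside ∷ σ ⋈ σ)
  split    : (as bs : Subset n) → meets as bs ≡ false → Good n (outside ∷ as ⋈ bs)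

∈-⋈ˡ : ∀ {n} {as bs : Subset n} {i} → i ∈ as → i ↑ˡ n ∈ as ⋈ bs
∈-⋈ˡ {n} {as} {bs} {i} p =
  Vecₚ.lookup⇒[]= (i ↑ˡ n) (as ⋈ bs) (trans (Vecₚ.lookup-++ˡ as bs i) (Vecₚ.[]=⇒lookup p))

∈-⋈ˡ⁻ : ∀ {n} {as bs : Subset n} {i} → i ↑ˡ n ∈ as ⋈ bs → i ∈ as
∈-⋈ˡ⁻ {n} {as} {bs} {i} p =
  Vecₚ.lookup⇒[]= i as (trans (sym (Vecₚ.lookup-++ˡ as bs i)) (Vecₚ.[]=⇒lookup p))

∈-⋈ʳ : ∀ {n} {as bs : Subset n} {i} → i ∈ bs → n ↑ʳ i ∈ as ⋈ bs
∈-⋈ʳ {n} {as} {bs} {i} p =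
  Vecₚ.lookup⇒[]= (n ↑ʳ i) (as ⋈ bs) (trans (Vecₚ.lookup-++ʳ as bs i) (Vecₚ.[]=⇒lookup p))

∈-⋈ʳ⁻ : ∀ {n} {as bs : Subset n} {i} → n ↑ʳ i ∈ as ⋈ bs → i ∈ bs
∈-⋈ʳ⁻ {n} {as} {bs} {i} p =
  Vecₚ.lookup⇒[]= i bs (trans (sym (Vecₚ.lookup-++ʳ as bs i)) (Vecₚ.[]=⇒lookup p))

module _ {n : ℕ} where

  rk-add₀ : ∀ g (γ δ : Subset n) → rk (T n) ((g ∷ γ ⋈ δ) ∪ ⁅ zero ⁆) ≡ ρ inside γ δ
  rk-add₀ g γ δ rewrite ∪-identityʳ (γ ⋈ δ) | Boolₚ.∨-zeroʳ g = rk-T n inside γ δ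

  rk-addₐ : ∀ g (γ δ : Subset n) i → rk (T n) ((g ∷ γ ⋈ δ) ∪ ⁅ suc (i ↑ˡ n) ⁆) ≡ ρ g (γ ∪ ⁅ i ⁆) δ
  rk-addₐ g γ δ i rewrite ⁅↑ˡ⁆ i | ∪-⋈ γ δ ⁅ i ⁆ ⊥ | Boolₚ.∨-identityʳ g | ∪-identityʳ δ =
    rk-T n g (γ ∪ ⁅ i ⁆) δ

  rk-add_b : ∀ g (γ δ : Subset n) i → rk (T n) ((g ∷ γ ⋈ δ) ∪ ⁅ suc (n ↑ʳ i) ⁆) ≡ ρ g γ (δ ∪ ⁅ i ⁆)
  rk-add_b g γ δ i rewrite ⁅↑ʳ⁆ i | ∪-⋈ γ δ ⊥ ⁅ i ⁆ | Boolₚ.∨-identityʳ g | ∪-identityʳ γ =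
    rk-T n g γ (δ ∪ ⁅ i ⁆)

  ∪⁅⁆-absorb : ∀ {p : Subset n} {i} → i ∈ p → p ∪ ⁅ i ⁆ ≡ p
  ∪⁅⁆-absorb {p} {i} i∈ = ⊆-antisym
    (λ {x} x∈ → [ id , (λ x∈i → subst (_∈ p) (sym (x∈⁅y⁆⇒x≡y i x∈i)) i∈) ] (x∈p∪q⁻ p ⁅ i ⁆ x∈))
    (p⊆p∪q ⁅ i ⁆)

  ρ-absorb : ∀ {γ δ : Subset n} {i} → i ∈ γ → ρ inside γ (δ ∪ ⁅ i ⁆) ≡ ρ inside γ δ
  ρ-absorb {γ} {δ} {i} i∈ = cong (λ p → ∣ p ∣ ℕ.+ 1)
    (trans (sym (∪-assoc γ δ ⁅ i ⁆)) (∪⁅⁆-absorb (x∈p∪q⁺ (inj₁ i∈))))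

  -- Once `A` and `B` are connected, `AB` is in the closure; once `AB` is present, `Ai` and `Bi` lie
  -- in the closure of each other. Below a `split` set no closure is involved, as every subset still
  -- keeps `A` and `B` apart.
  good-flat-T : ∀ {F G} → Good n F → IsFlat (restrict (T n) F) G → Good n G
  good-flat-T {G = G} (split as bs dis) fl = by-halves
    (λ G → G ⊆ (outside ∷ as ⋈ bs) → Good n G) below G (proj₁ fl)
    where
    below : ∀ g (γ δ : Subset n) → (g ∷ γ ⋈ δ) ⊆ (outside ∷ as ⋈ bs) → Good n (g ∷ γ ⋈ δ)
    below inside  γ δ s with () ← head-⊆ s
    below outside γ δ s = split γ δ (not-true λ m → contradiction
      (trans (sym dis) (meets-mono (++-⊆ˡ γ as (drop-∷-⊆ s)) (++-⊆ʳ γ as (drop-∷-⊆ s)) m)) λ ())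
  good-flat-T {G = G} (spanning σ) fl = by-halves
    (λ G → IsFlat (restrict (T n) (inside ∷ σ ⋈ σ)) G → Good n G) closed G fl
    where
    closed : ∀ g (γ δ : Subset n) → IsFlat (restrict (T n) (inside ∷ σ ⋈ σ)) (g ∷ γ ⋈ δ) → Good n (g ∷ γ ⋈ δ)
    closed outside γ δ (G⊆ , fl) = split γ δ (not-true λ m → fl zero here (λ ())
      (trans (rk-add₀ outside γ δ) (trans (cong (λ x → ∣ γ ∪ δ ∣ ℕ.+ b2n x) (sym m)) (sym (rk-T n outside γ δ)))))
    closed inside γ δ (G⊆ , fl) = subst (λ δ → Good n (inside ∷ γ ⋈ δ)) (⊆-antisym γ⊆δ δ⊆γ) (spanning γ)
      where
      γ⊆δ : γ ⊆ δ
      γ⊆δ {i} i∈γ with i ∈? δ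
      ... | yes i∈δ = i∈δ
      ... | no  i∉δ = ⊥-elim (fl (suc (n ↑ʳ i)) (there (∈-⋈ʳ (++-⊆ˡ γ σ (drop-∷-⊆ G⊆) i∈γ)))
        (λ { (there p) → i∉δ (∈-⋈ʳ⁻ p) })
        (trans (rk-add_b inside γ δ i) (trans (ρ-absorb i∈γ) (sym (rk-T n inside γ δ)))))
      δ⊆γ : δ ⊆ γ
      δ⊆γ {i} i∈δ with i ∈? γ
      ... | yes i∈γ = i∈γ
      ... | no  i∉γ = ⊥-elim (fl (suc (i ↑ˡ n)) (there (∈-⋈ˡ (++-⊆ʳ γ σ (drop-∷-⊆ G⊆) i∈δ)))
        (λ { (there p) → i∉γ (∈-⋈ˡ⁻ p) })
        (trans (rk-addₐ inside γ δ i) (trans (ρ-comm inside (γ ∪ ⁅ i ⁆) δ)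
          (trans (ρ-absorb i∈δ) (trans (ρ-comm inside δ γ) (sym (rk-T n inside γ δ)))))))

  meets-∈ : ∀ {m} {p r : Subset m} {i} → i ∈ p → i ∈ r → meets p r ≡ true
  meets-∈ here here = refl
  meets-∈ {p = a ∷ _} {b ∷ _} (there i) (there j) =
    trans (cong ((a ∧ b) ∨_) (meets-∈ i j)) (Boolₚ.∨-zeroʳ (a ∧ b))

  ∪-growˡ : ∀ (γ δ : Subset n) i → γ ∪ δ ⊆ (γ ∪ ⁅ i ⁆) ∪ δ
  ∪-growˡ γ δ i x∈ = x∈p∪q⁺ (Sum.map₁ (p⊆p∪q ⁅ i ⁆) (x∈p∪q⁻ γ δ x∈))

  -- A new edge `Ai` either touches a new vertex or, if `Bi` is present, connects `A` with `B`;
  -- `joins` says that in the latter case they were not yet connected.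
  ρ-grow : ∀ g (γ δ : Subset n) i → i ∉ γ → (i ∈ δ → g ≡ outside × meets γ δ ≡ false) →
           ρ g γ δ < ρ g (γ ∪ ⁅ i ⁆) δ
  ρ-grow g γ δ i i∉γ joins with i ∈? δ
  ... | yes i∈δ with refl , dis ← joins i∈δ
    rewrite dis | meets-∈ {p = γ ∪ ⁅ i ⁆} (x∈p∪q⁺ (inj₂ (x∈⁅x⁆ i))) i∈δ =
      ℕₚ.+-mono-≤-< (p⊆q⇒∣p∣≤∣q∣ (∪-growˡ γ δ i)) (s≤s z≤n)
  ... | no i∉δ = ℕₚ.+-mono-<-≤
    (p⊂q⇒∣p∣<∣q∣ {p = γ ∪ δ} {(γ ∪ ⁅ i ⁆) ∪ δ}
      (∪-growˡ γ δ i ,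
      i , x∈p∪q⁺ {p = γ ∪ ⁅ i ⁆} (inj₁ (x∈p∪q⁺ {p = γ} (inj₂ (x∈⁅x⁆ i)))) ,
      (λ i∈ → [ i∉γ , i∉δ ] (x∈p∪q⁻ γ δ i∈))))
    (b2n-mono _ _ (∨-true-map {g} id (meets-mono {as = γ} {δ} (p⊆p∪q ⁅ i ⁆) id)))

  -- Every missing edge raises the rank: `AB` connects `A` with `B`, and the other edges are covered
  -- by `ρ-grow`, those at `B` after exchanging the two centres.
  flat-good-T : ∀ {F} g (γ δ : Subset n) → (g ∷ γ ⋈ δ) ⊆ F →
    (g ≡ inside → γ ≡ δ) → (g ≡ outside → meets γ δ ≡ false) → IsFlat (restrict (T n) F) (g ∷ γ ⋈ δ)
  flat-good-T {F} g γ δ G⊆ spans splits = G⊆ , λ e _ → by-edges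
    (λ e → e ∉ (g ∷ γ ⋈ δ) → rk (T n) ((g ∷ γ ⋈ δ) ∪ ⁅ e ⁆) ≢ rk (T n) (g ∷ γ ⋈ δ)) edge₀ edgeₐ edge_b e
    where
    g-outside : zero ∉ (g ∷ γ ⋈ δ) → g ≡ outside
    g-outside e∉ = not-true λ { refl → e∉ here }
    edge₀ : zero ∉ (g ∷ γ ⋈ δ) → rk (T n) ((g ∷ γ ⋈ δ) ∪ ⁅ zero ⁆) ≢ rk (T n) (g ∷ γ ⋈ δ)
    edge₀ e∉ eq = ℕₚ.1+n≢0 (ℕₚ.+-cancelˡ-≡ (∣ γ ∪ δ ∣) 1 0
      (trans (sym (rk-add₀ g γ δ)) (trans eq (trans (rk-T n g γ δ)
        (cong₂ (λ x y → ∣ γ ∪ δ ∣ ℕ.+ b2n (x ∨ y)) (g-outside e∉) (splits (g-outside e∉)))))))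
    cases : ∀ {p r i} → (g ≡ inside → p ≡ r) → (g ≡ outside → meets p r ≡ false) → i ∉ p →
            i ∈ r → g ≡ outside × meets p r ≡ false
    cases {i = i} sp st i∉ i∈ = outside! , st outside!
      where
      outside! : g ≡ outside
      outside! = not-true λ g≡ → i∉ (subst (i ∈_) (sym (sp g≡)) i∈)
    edgeₐ : ∀ i → suc (i ↑ˡ n) ∉ (g ∷ γ ⋈ δ) →
            rk (T n) ((g ∷ γ ⋈ δ) ∪ ⁅ suc (i ↑ˡ n) ⁆) ≢ rk (T n) (g ∷ γ ⋈ δ)
    edgeₐ i e∉ rewrite rk-addₐ g γ δ i | rk-T n g γ δ =
      ≢-sym (ℕₚ.<⇒≢ (ρ-grow g γ δ i i∉ (cases {γ} {δ} spans splits i∉)))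
      where
      i∉ : i ∉ γ
      i∉ = e∉ ∘ there ∘ ∈-⋈ˡ
    edge_b : ∀ i → suc (n ↑ʳ i) ∉ (g ∷ γ ⋈ δ) →
             rk (T n) ((g ∷ γ ⋈ δ) ∪ ⁅ suc (n ↑ʳ i) ⁆) ≢ rk (T n) (g ∷ γ ⋈ δ)
    edge_b i e∉ rewrite rk-add_b g γ δ i | rk-T n g γ δ | ρ-comm g γ (δ ∪ ⁅ i ⁆) | ρ-comm g γ δ =
      ≢-sym (ℕₚ.<⇒≢ (ρ-grow g δ γ i i∉
        (cases {δ} {γ} (sym ∘ spans) (λ e → trans (meets-comm δ γ) (splits e)) i∉)))
      where
      i∉ : i ∉ δ
      i∉ = e∉ ∘ there ∘ ∈-⋈ʳ

-- Sums over pairs of subsets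

Σs-++ : ∀ m n (φ : Subset (m ℕ.+ n) → Seq) → Σs (m ℕ.+ n) φ ≗ Σs m (λ X → Σs n (λ Y → φ (X ++ᵛ Y)))
Σs-++ zero    n φ k = refl
Σs-++ (suc m) n φ k = cong₂ _+_ (Σs-++ m n (φ ∘ (outside ∷_)) k) (Σs-++ m n (φ ∘ (inside ∷_)) k)

Σs-lin : ∀ m a b (φ : Subset m → Seq) → Σs m (λ X → lin a b (φ X)) ≗ lin a b (Σs m φ)
Σs-lin zero    a b φ k = refl
Σs-lin (suc m) a b φ k =
  trans (cong₂ _+_ (Σs-lin m a b (φ ∘ (outside ∷_)) k) (Σs-lin m a b (φ ∘ (inside ∷_)) k))
        (sym (lin-⊞ a b (Σs m (φ ∘ (outside ∷_))) (Σs m (φ ∘ (inside ∷_))) k))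

ΣΣ : ∀ n → (Subset n → Subset n → Seq) → Seq
ΣΣ n φ = Σs n (λ X → Σs n (φ X))

ΣΣ-cong : ∀ n {φ ψ : Subset n → Subset n → Seq} → (∀ X Y → φ X Y ≗ ψ X Y) → ΣΣ n φ ≗ ΣΣ n ψ
ΣΣ-cong n p = Σs-cong n (λ X → Σs-cong n (p X))

ΣΣ-lin : ∀ n a b (φ : Subset n → Subset n → Seq) → ΣΣ n (λ X Y → lin a b (φ X Y)) ≗ lin a b (ΣΣ n φ)
ΣΣ-lin n a b φ k = trans (Σs-cong n (λ X → Σs-lin n a b (φ X)) k) (Σs-lin n a b (λ X → Σs n (φ X)) k)

ΣΣ-⊞ : ∀ n (φ ψ : Subset n → Subset n → Seq) → ΣΣ n (λ X Y → φ X Y ⊞ ψ X Y) ≗ ΣΣ n φ ⊞ ΣΣ n ψ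
ΣΣ-⊞ n φ ψ k = trans (Σs-cong n (λ X → Σs-⊞ n (φ X) (ψ X)) k) (Σs-⊞ n (λ X → Σs n (φ X)) (λ X → Σs n (ψ X)) k)

ΣΣ-𝟎 : ∀ n → ΣΣ n (λ _ _ → 𝟎) ≗ 𝟎
ΣΣ-𝟎 n k = trans (Σs-cong n (λ _ → Σs-𝟎 n) k) (Σs-𝟎 n k)

ΣΣ-suc : ∀ n (φ : Subset (suc n) → Subset (suc n) → Seq) → ΣΣ (suc n) φ ≗
  (ΣΣ n (λ X Y → φ (false ∷ X) (false ∷ Y)) ⊞ ΣΣ n (λ X Y → φ (false ∷ X) (true ∷ Y))) ⊞
  (ΣΣ n (λ X Y → φ (true ∷ X) (false ∷ Y)) ⊞ ΣΣ n (λ X Y → φ (true ∷ X) (true ∷ Y)))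
ΣΣ-suc n φ k = cong₂ _+_
  (Σs-⊞ n (λ X → Σs n (φ (false ∷ X) ∘ (false ∷_))) (λ X → Σs n (φ (false ∷ X) ∘ (true ∷_))) k)
  (Σs-⊞ n (λ X → Σs n (φ (true ∷ X) ∘ (false ∷_))) (λ X → Σs n (φ (true ∷ X) ∘ (true ∷_))) k)

-- Sums over pairs of subsets whose summand is a product of local contributions s·(p + q t), restricted
-- by a local condition ok, factorise over the vertices.
module Factorise {Ctx : Set} (ok : Ctx → Bool → Bool → Bool) (s p q : Ctx → Bool → Bool → ℤ) where

  okᵛ : ∀ {n} → Vec Ctx n → Subset n → Subset n → Bool
  okᵛ []       []       []       = true
  okᵛ (c ∷ cs) (x ∷ xs) (y ∷ ys) = ok c x y ∧ okᵛ cs xs ys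

  sᵛ : ∀ {n} → Vec Ctx n → Subset n → Subset n → ℤ
  sᵛ []       []       []       = 1ℤ
  sᵛ (c ∷ cs) (x ∷ xs) (y ∷ ys) = s c x y * sᵛ cs xs ys

  linᵛ : ∀ {n} → Vec Ctx n → Subset n → Subset n → Seq → Seq
  linᵛ []       []       []       u = u
  linᵛ (c ∷ cs) (x ∷ xs) (y ∷ ys) u = lin (p c x y) (q c x y) (linᵛ cs xs ys u)

  term : ∀ {n} → Vec Ctx n → Seq → Subset n → Subset n → Seq
  term cs u xs ys = gate (okᵛ cs xs ys) (sᵛ cs xs ys • linᵛ cs xs ys u)

  gated : (Ctx → Bool → Bool → ℤ) → Ctx → Bool → Bool → ℤ
  gated a c x y = if ok c x y then s c x y * a c x y else 0ℤ

  total : (Ctx → Bool → Bool → ℤ) → Ctx → ℤ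
  total a c = (gated a c false false + gated a c false true) + (gated a c true false + gated a c true true)

  totalᵛ : ∀ {n} → Vec Ctx n → Seq → Seq
  totalᵛ []       u = u
  totalᵛ (c ∷ cs) u = lin (total p c) (total q c) (totalᵛ cs u)

  gated-lin : ∀ c x y b r u →
    gate (ok c x y ∧ b) ((s c x y * r) • lin (p c x y) (q c x y) u) ≗
    lin (gated p c x y) (gated q c x y) (gate b (r • u))
  gated-lin c x y b r u k with ok c x y
  ... | false = zeros (gate b (r • u) k) (sh (gate b (r • u)) k)
    where
    zeros : ∀ x y → 0ℤ ≡ 0ℤ * x + 0ℤ * y
    zeros = solve-∀
  ... | true with b
  ...   | false = sym (lin-vanish (s c x y * p c x y) (s c x y * q c x y) 𝟎 k refl (sh-𝟎 k))
  ...   | true =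
    trans (assoc (s c x y) r (p c x y) (q c x y) (u k) (sh u k))
          (cong (λ z → (s c x y * p c x y) * (r * u k) + (s c x y * q c x y) * z) (sym (sh-• r u k)))
    where
    assoc : ∀ s r p q x y → (s * r) * (p * x + q * y) ≡ (s * p) * (r * x) + (s * q) * (r * y)
    assoc = solve-∀

  -- The four choices at the first vertex all leave the same sum over the remaining vertices, so the
  -- four linear factors in front of it add up.
  factorise : ∀ {n} (cs : Vec Ctx n) u →
    ΣΣ n (term cs u) ≗ totalᵛ cs u
  factorise []       u k = ℤₚ.*-identityˡ (u k)
  factorise {suc n} (c ∷ cs) u k = begin
    ΣΣ (suc n) (term (c ∷ cs) u) k
      ≡⟨ ΣΣ-suc n (term (c ∷ cs) u) k ⟩
    _ ≡⟨ cong₂ _+_ (cong₂ _+_ (part false false) (part false true)) (cong₂ _+_ (part true false) (part true true)) ⟩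
    (lin (gated p c false false) (gated q c false false) v k + lin (gated p c false true) (gated q c false true) v k)
      + (lin (gated p c true false) (gated q c true false) v k + lin (gated p c true true) (gated q c true true) v k)
      ≡⟨ cong₂ _+_ (lin-sum (gated p c false false) (gated q c false false) (gated p c false true) (gated q c false true) v k)
                   (lin-sum (gated p c true false) (gated q c true false) (gated p c true true) (gated q c true true) v k) ⟩
    _ ≡⟨ lin-sum (gated p c false false + gated p c false true) (gated q c false false + gated q c false true)
                 (gated p c true false + gated p c true true) (gated q c true false + gated q c true true) v k ⟩
    lin (total p c) (total q c) v k ∎
    where
    open ≡-Reasoning
    v = totalᵛ cs u
    part : ∀ x y →
      ΣΣ n (λ xs ys → term (c ∷ cs) u (x ∷ xs) (y ∷ ys)) k ≡
      lin (gated p c x y) (gated q c x y) v k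
    part x y =
      trans (ΣΣ-cong n (λ xs ys → gated-lin c x y (okᵛ cs xs ys) (sᵛ cs xs ys) (linᵛ cs xs ys u)) k)
        (trans (ΣΣ-lin n (gated p c x y) (gated q c x y) (term cs u) k)
               (lin-cong (gated p c x y) (gated q c x y) (factorise cs u) k))

does-≡ : ∀ {a} {P : Set a} (P? : Dec P) b → (P → b ≡ true) → (b ≡ true → P) → does P? ≡ b
does-≡ (yes p) b     f g = sym (f p)
does-≡ (no ¬p) false f g = refl
does-≡ (no ¬p) true  f g = contradiction (g refl) ¬p

-- Inclusion and equality as conjunctions over the vertices, the form in which conditions enter a
-- factorised sum.
_⊆ᵇ_ : ∀ {n} → Subset n → Subset n → Bool
[]      ⊆ᵇ []      = true
(x ∷ p) ⊆ᵇ (y ∷ r) = (not x ∨ y) ∧ (p ⊆ᵇ r)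

_≡ᵇ_ : ∀ {n} → Subset n → Subset n → Bool
[]      ≡ᵇ []      = true
(x ∷ p) ≡ᵇ (y ∷ r) = ((not x ∨ y) ∧ (not y ∨ x)) ∧ (p ≡ᵇ r)

∧-true : ∀ {x y} → x ≡ true → y ≡ true → x ∧ y ≡ true
∧-true refl refl = refl

∧-trueˡ : ∀ {x y} → x ∧ y ≡ true → x ≡ true
∧-trueˡ {x} {y} = Boolₚ.∧-conicalˡ x y

∧-trueʳ : ∀ {x y} → x ∧ y ≡ true → y ≡ true
∧-trueʳ {x} {y} = Boolₚ.∧-conicalʳ x y

⊆⇒⊆ᵇ : ∀ {n} {p r : Subset n} → p ⊆ r → p ⊆ᵇ r ≡ true
⊆⇒⊆ᵇ {p = []}          {[]}    s = refl
⊆⇒⊆ᵇ {p = outside ∷ p} {y ∷ r} s = ⊆⇒⊆ᵇ (drop-∷-⊆ s)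
⊆⇒⊆ᵇ {p = inside ∷ p}  {y ∷ r} s rewrite head-⊆ s = ⊆⇒⊆ᵇ (drop-∷-⊆ s)

⊆ᵇ⇒⊆ : ∀ {n} {p r : Subset n} → p ⊆ᵇ r ≡ true → p ⊆ r
⊆ᵇ⇒⊆ {p = inside ∷ p} {inside ∷ r} e here      = here
⊆ᵇ⇒⊆ {p = x ∷ p}      {y ∷ r}      e (there i) = there (⊆ᵇ⇒⊆ (∧-trueʳ {not x ∨ y} e) i)

≡ᵇ⇒≡ : ∀ {n} {p r : Subset n} → p ≡ᵇ r ≡ true → p ≡ r
≡ᵇ⇒≡ {p = []}          {[]}          e = refl
≡ᵇ⇒≡ {p = inside ∷ p}  {inside ∷ r}  e = cong (inside ∷_) (≡ᵇ⇒≡ e)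
≡ᵇ⇒≡ {p = outside ∷ p} {outside ∷ r} e = cong (outside ∷_) (≡ᵇ⇒≡ e)

≡ᵇ-refl : ∀ {n} (p : Subset n) → p ≡ᵇ p ≡ true
≡ᵇ-refl []            = refl
≡ᵇ-refl (inside ∷ p)  = ≡ᵇ-refl p
≡ᵇ-refl (outside ∷ p) = ≡ᵇ-refl p

does-⊆? : ∀ {n} (p r : Subset n) → does (p ⊆? r) ≡ p ⊆ᵇ r
does-⊆? p r = does-≡ (p ⊆? r) (p ⊆ᵇ r) ⊆⇒⊆ᵇ ⊆ᵇ⇒⊆

⊆ᵇ-++ : ∀ {m n} (p p′ : Subset m) (r r′ : Subset n) → (p ++ᵛ r) ⊆ᵇ (p′ ++ᵛ r′) ≡ (p ⊆ᵇ p′) ∧ (r ⊆ᵇ r′)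
⊆ᵇ-++ []      []        r r′ = refl
⊆ᵇ-++ (x ∷ p) (x′ ∷ p′) r r′ =
  trans (cong ((not x ∨ x′) ∧_) (⊆ᵇ-++ p p′ r r′)) (sym (Boolₚ.∧-assoc (not x ∨ x′) (p ⊆ᵇ p′) (r ⊆ᵇ r′)))

∧-interchange₃ : ∀ a b c A B D → (a ∧ (b ∧ c)) ∧ (A ∧ (B ∧ D)) ≡ (a ∧ A) ∧ ((b ∧ B) ∧ (c ∧ D))
∧-interchange₃ false b     c     A     B D = refl
∧-interchange₃ true  false c     A     B D = sym (Boolₚ.∧-zeroʳ A)
∧-interchange₃ true  true  true  A     B D = refl
∧-interchange₃ true  true  false A     B D =
  sym (trans (cong (A ∧_) (Boolₚ.∧-zeroʳ B)) (Boolₚ.∧-zeroʳ A))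

-- The contraction operators

sg : Bool → ℤ
sg true  = -1ℤ
sg false = 1ℤ

sign-∷ : ∀ {n} x (p : Subset n) → sign ∣ x ∷ p ∣ ≡ sg x * sign ∣ p ∣
sign-∷ true  p = neg (sign ∣ p ∣)
  where
  neg : ∀ x → - x ≡ -1ℤ * x
  neg = solve-∀
sign-∷ false p = sym (ℤₚ.*-identityˡ (sign ∣ p ∣))

sign-+ : ∀ a b → sign (a ℕ.+ b) ≡ sign a * sign b
sign-+ zero    b = sym (ℤₚ.*-identityˡ (sign b))
sign-+ (suc a) b = trans (cong -_ (sign-+ a b)) (ℤₚ.neg-distribˡ-* (sign a) (sign b))

Edges : Set
Edges = (Bool × Bool) × (Bool × Bool)

edges : ∀ {n} → Subset n → Subset n → Subset n → Subset n → Vec Edges n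
edges α β γ δ = zip (zip α β) (zip γ δ)

-- (α, β) and (γ, δ) record the edges Aj, Bj in F and in G; (x, y) those in a subset Y of F ∖ G.
-- With separate = true, Y ∪ G must not contain both Aj and Bj.
module Quotient (separate : Bool) where
  ok : Edges → Bool → Bool → Bool
  ok ((α , β) , (γ , δ)) x y =
    (not x ∨ (not γ ∧ α)) ∧ ((not y ∨ (not δ ∧ β)) ∧ not (separate ∧ ((x ∨ γ) ∧ (y ∨ δ))))

  s : Edges → Bool → Bool → ℤ
  s _ x y = sg x * sg y

  -- Whether the vertex is touched by `Y ∪ G` but not by `G`. These vertices raise the rank by one
  -- each, so they carry the factor `t` and all others the factor 1, encoded as `p + q t`.
  new : Edges → Bool → Bool → Bool
  new (_ , (γ , δ)) x y = not (γ ∨ δ) ∧ (x ∨ y)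

  p q : Edges → Bool → Bool → ℤ
  p c x y = if new c x y then 0ℤ else 1ℤ
  q c x y = if new c x y then 1ℤ else 0ℤ

  open Factorise ok s p q public

  okᵛ-edges : ∀ {n} (α β γ δ ya yb : Subset n) →
    okᵛ (edges α β γ δ) ya yb ≡ (ya ⊆ᵇ (α ─ γ)) ∧ ((yb ⊆ᵇ (β ─ δ)) ∧ not (separate ∧ meets (ya ∪ γ) (yb ∪ δ)))
  okᵛ-edges [] [] [] [] [] [] = sym (cong not (Boolₚ.∧-zeroʳ separate))
  okᵛ-edges (a ∷ α) (b ∷ β) (c ∷ γ) (d ∷ δ) (x ∷ ya) (y ∷ yb) = begin
    (X ∧ (Y ∧ not (separate ∧ z))) ∧ okᵛ (edges α β γ δ) ya yb
      ≡⟨ cong ((X ∧ (Y ∧ not (separate ∧ z))) ∧_) (okᵛ-edges α β γ δ ya yb) ⟩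
    (X ∧ (Y ∧ not (separate ∧ z))) ∧ ((ya ⊆ᵇ (α ─ γ)) ∧ ((yb ⊆ᵇ (β ─ δ)) ∧ not (separate ∧ μ)))
      ≡⟨ ∧-interchange₃ X Y (not (separate ∧ z)) (ya ⊆ᵇ (α ─ γ)) (yb ⊆ᵇ (β ─ δ)) (not (separate ∧ μ)) ⟩
    (X ∧ (ya ⊆ᵇ (α ─ γ))) ∧ ((Y ∧ (yb ⊆ᵇ (β ─ δ))) ∧ (not (separate ∧ z) ∧ not (separate ∧ μ)))
      ≡⟨ cong₂ _∧_ (head x a c ya α γ) (cong₂ _∧_ (head y b d yb β δ) (either separate z μ)) ⟩
    ((x ∷ ya) ⊆ᵇ ((a ∷ α) ─ (c ∷ γ))) ∧ (((y ∷ yb) ⊆ᵇ ((b ∷ β) ─ (d ∷ δ))) ∧ not (separate ∧ (z ∨ μ))) ∎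
    where
    open ≡-Reasoning
    X = not x ∨ (not c ∧ a)
    Y = not y ∨ (not d ∧ b)
    z = (x ∨ c) ∧ (y ∨ d)
    μ = meets (ya ∪ γ) (yb ∪ δ)
    head : ∀ {n} x a c (ya α γ : Subset n) →
           (not x ∨ (not c ∧ a)) ∧ (ya ⊆ᵇ (α ─ γ)) ≡ (x ∷ ya) ⊆ᵇ ((a ∷ α) ─ (c ∷ γ))
    head x a true  ya α γ = refl
    head x a false ya α γ = refl
    either : ∀ s z m → not (s ∧ z) ∧ not (s ∧ m) ≡ not (s ∧ (z ∨ m))
    either true  true  m = refl
    either true  false m = refl
    either false z m = refl

  sᵛ-edges : ∀ {n} (cs : Vec Edges n) ya yb → sᵛ cs ya yb ≡ sign ∣ ya ∣ * sign ∣ yb ∣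
  sᵛ-edges []       []       []       = refl
  sᵛ-edges (c ∷ cs) (x ∷ ya) (y ∷ yb) = begin
    (sg x * sg y) * sᵛ cs ya yb                    ≡⟨ cong ((sg x * sg y) *_) (sᵛ-edges cs ya yb) ⟩
    (sg x * sg y) * (sign ∣ ya ∣ * sign ∣ yb ∣)     ≡⟨ interchange (sg x) (sg y) (sign ∣ ya ∣) (sign ∣ yb ∣) ⟩
    (sg x * sign ∣ ya ∣) * (sg y * sign ∣ yb ∣)     ≡⟨ cong₂ _*_ (sym (sign-∷ x ya)) (sym (sign-∷ y yb)) ⟩
    sign ∣ x ∷ ya ∣ * sign ∣ y ∷ yb ∣               ∎
    where
    open ≡-Reasoning
    interchange : ∀ x y z t → (x * y) * (z * t) ≡ (x * z) * (y * t)
    interchange = solve-∀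

  newᵛ : ∀ {n} → Vec Edges n → Subset n → Subset n → ℕ
  newᵛ []       []       []       = 0
  newᵛ (c ∷ cs) (x ∷ xs) (y ∷ ys) = b2n (new c x y) ℕ.+ newᵛ cs xs ys

  linᵛ-edges : ∀ {n} (cs : Vec Edges n) ya yb u → linᵛ cs ya yb u ≗ shⁿ (newᵛ cs ya yb) u
  linᵛ-edges []       []       []       u k = refl
  linᵛ-edges (c ∷ cs) (x ∷ ya) (y ∷ yb) u k with new c x y
  ... | true  = trans (lin-cong 0ℤ 1ℤ (linᵛ-edges cs ya yb u) k) (lin-t (shⁿ (newᵛ cs ya yb) u) k)
  ... | false = trans (lin-cong 1ℤ 0ℤ (linᵛ-edges cs ya yb u) k) (lin-id (shⁿ (newᵛ cs ya yb) u) k)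

  ∣∪∣-newᵛ : ∀ {n} (α β γ δ ya yb : Subset n) →
    ∣ (ya ∪ γ) ∪ (yb ∪ δ) ∣ ≡ ∣ γ ∪ δ ∣ ℕ.+ newᵛ (edges α β γ δ) ya yb
  ∣∪∣-newᵛ [] [] [] [] [] [] = refl
  ∣∪∣-newᵛ (a ∷ α) (b ∷ β) (c ∷ γ) (d ∷ δ) (x ∷ ya) (y ∷ yb) = begin
    ∣ ((x ∨ c) ∨ (y ∨ d)) ∷ ((ya ∪ γ) ∪ (yb ∪ δ)) ∣
      ≡⟨ ∣∷∣ ((x ∨ c) ∨ (y ∨ d)) ((ya ∪ γ) ∪ (yb ∪ δ)) ⟩
    b2n ((x ∨ c) ∨ (y ∨ d)) ℕ.+ ∣ (ya ∪ γ) ∪ (yb ∪ δ) ∣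
      ≡⟨ cong₂ ℕ._+_ (head x c y d) (∣∪∣-newᵛ α β γ δ ya yb) ⟩
    (b2n (c ∨ d) ℕ.+ b2n (not (c ∨ d) ∧ (x ∨ y))) ℕ.+ (∣ γ ∪ δ ∣ ℕ.+ newᵛ (edges α β γ δ) ya yb)
      ≡⟨ ℕₚ.+-assoc (b2n (c ∨ d)) (b2n (not (c ∨ d) ∧ (x ∨ y))) _ ⟩
    b2n (c ∨ d) ℕ.+ (b2n (not (c ∨ d) ∧ (x ∨ y)) ℕ.+ (∣ γ ∪ δ ∣ ℕ.+ newᵛ (edges α β γ δ) ya yb))
      ≡⟨ cong (b2n (c ∨ d) ℕ.+_) (rotate (b2n (not (c ∨ d) ∧ (x ∨ y))) (∣ γ ∪ δ ∣) _) ⟩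
    b2n (c ∨ d) ℕ.+ (∣ γ ∪ δ ∣ ℕ.+ (b2n (not (c ∨ d) ∧ (x ∨ y)) ℕ.+ newᵛ (edges α β γ δ) ya yb))
      ≡⟨ ℕₚ.+-assoc (b2n (c ∨ d)) (∣ γ ∪ δ ∣) _ ⟨
    (b2n (c ∨ d) ℕ.+ ∣ γ ∪ δ ∣) ℕ.+ (b2n (not (c ∨ d) ∧ (x ∨ y)) ℕ.+ newᵛ (edges α β γ δ) ya yb)
      ≡⟨ cong (ℕ._+ newᵛ (edges (a ∷ α) (b ∷ β) (c ∷ γ) (d ∷ δ)) (x ∷ ya) (y ∷ yb)) (∣∷∣ (c ∨ d) (γ ∪ δ)) ⟨
    ∣ (c ∷ γ) ∪ (d ∷ δ) ∣ ℕ.+ newᵛ (edges (a ∷ α) (b ∷ β) (c ∷ γ) (d ∷ δ)) (x ∷ ya) (y ∷ yb) ∎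
    where
    open ≡-Reasoning
    rotate : ∀ x y z → x ℕ.+ (y ℕ.+ z) ≡ y ℕ.+ (x ℕ.+ z)
    rotate x y z = trans (sym (ℕₚ.+-assoc x y z)) (trans (cong (ℕ._+ z) (ℕₚ.+-comm x y)) (ℕₚ.+-assoc y x z))
    head : ∀ x c y d → b2n ((x ∨ c) ∨ (y ∨ d)) ≡ b2n (c ∨ d) ℕ.+ b2n (not (c ∨ d) ∧ (x ∨ y))
    head true  true  y     d     = refl
    head false true  y     d     = refl
    head true  false true  true  = refl
    head true  false true  false = refl
    head true  false false true  = refl
    head true  false false false = refl
    head false false true  true  = refl
    head false false true  false = refl
    head false false false true  = refl
    head false false false false = refl

-- For `AB ∈ G` the centres are connected whatever `Y` is, and `Y` is unrestricted. For `AB ∉ G` the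
-- sums reduce to those `Y` that leave the centres apart.
module Spanning  = Quotient false
module Separated = Quotient true

take-++ : ∀ {A : Set} m {n} (xs : Vec A m) (ys : Vec A n) → Vec.take m (xs ++ᵛ ys) ≡ xs
take-++ zero    []       ys = refl
take-++ (suc m) (x ∷ xs) ys = cong (x ∷_) (take-++ m xs ys)

shⁿ-∘ : ∀ a b u → shⁿ (a ℕ.+ b) u ≡ shⁿ a (shⁿ b u)
shⁿ-∘ zero    b u = refl
shⁿ-∘ (suc a) b u = cong sh (shⁿ-∘ a b u)

shⁿ-1-t : ∀ d u → shⁿ d (lin 1ℤ -1ℤ u) ≗ lin 1ℤ -1ℤ (shⁿ d u)
shⁿ-1-t zero    u k = refl
shⁿ-1-t (suc d) u k = trans (sh-cong (shⁿ-1-t d u) k) (sh-lin 1ℤ -1ℤ (shⁿ d u) k)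

sh-shⁿ : ∀ d u → shⁿ d (sh u) ≡ sh (shⁿ d u)
sh-shⁿ zero    u = refl
sh-shⁿ (suc d) u = cong sh (sh-shⁿ d u)

module _ {n : ℕ} where

  contractTerm : Bool → Bool → (α β γ δ : Subset n) → Seq → Bool → Subset n → Subset n → Seq
  contractTerm f g α β γ δ u y ya yb =
    gate ((not y ∨ (not g ∧ f)) ∧ ((ya ⊆ᵇ (α ─ γ)) ∧ (yb ⊆ᵇ (β ─ δ))))
         ((sg y * (sign ∣ ya ∣ * sign ∣ yb ∣)) • shⁿ (ρ (y ∨ g) (ya ∪ γ) (yb ∪ δ) ∸ ρ g γ δ) u)

  contractOp-T : ∀ f g (α β γ δ : Subset n) u →
    contractOp (T n) (f ∷ α ⋈ β) (g ∷ γ ⋈ δ) u ≗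
    ΣΣ n (contractTerm f g α β γ δ u false) ⊞ ΣΣ n (contractTerm f g α β γ δ u true)
  contractOp-T f g α β γ δ u k = cong₂ _+_ (half false) (half true)
    where
    φ : Subset (suc (n ℕ.+ n)) → Seq
    φ Y = gate (does (Y ⊆? ((f ∷ α ⋈ β) ─ (g ∷ γ ⋈ δ))))
               (sign ∣ Y ∣ • shⁿ (rk (T n) (Y ∪ (g ∷ γ ⋈ δ)) ∸ rk (T n) (g ∷ γ ⋈ δ)) u)
    ─-⋈ : (α ⋈ β) ─ (γ ⋈ δ) ≡ (α ─ γ) ⋈ (β ─ δ)
    ─-⋈ = Vecₚ.zipWith-++ _ α β γ δ
    head : ∀ y f g (p r s : Subset (n ℕ.+ n)) →
           (y ∷ p) ⊆ᵇ ((f ∷ r) ─ (g ∷ s)) ≡ (not y ∨ (not g ∧ f)) ∧ (p ⊆ᵇ (r ─ s))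
    head y f true  p r s = refl
    head y f false p r s = refl
    allowed : ∀ y ya yb → does ((y ∷ ya ⋈ yb) ⊆? ((f ∷ α ⋈ β) ─ (g ∷ γ ⋈ δ))) ≡
              (not y ∨ (not g ∧ f)) ∧ ((ya ⊆ᵇ (α ─ γ)) ∧ (yb ⊆ᵇ (β ─ δ)))
    allowed y ya yb = trans (does-⊆? (y ∷ ya ⋈ yb) ((f ∷ α ⋈ β) ─ (g ∷ γ ⋈ δ)))
      (trans (head y f g (ya ⋈ yb) (α ⋈ β) (γ ⋈ δ))
        (cong ((not y ∨ (not g ∧ f)) ∧_)
          (trans (cong ((ya ⋈ yb) ⊆ᵇ_) ─-⋈) (⊆ᵇ-++ ya (α ─ γ) yb (β ─ δ)))))
    signs : ∀ y ya yb → sign ∣ y ∷ ya ⋈ yb ∣ ≡ sg y * (sign ∣ ya ∣ * sign ∣ yb ∣)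
    signs y ya yb = trans (sign-∷ y (ya ⋈ yb))
      (cong (sg y *_) (trans (cong sign (∣++∣ ya yb)) (sign-+ ∣ ya ∣ ∣ yb ∣)))
    ranks : ∀ y ya yb → rk (T n) ((y ∷ ya ⋈ yb) ∪ (g ∷ γ ⋈ δ)) ∸ rk (T n) (g ∷ γ ⋈ δ) ≡
            ρ (y ∨ g) (ya ∪ γ) (yb ∪ δ) ∸ ρ g γ δ
    ranks y ya yb = cong₂ _∸_
      (trans (cong (λ X → rk (T n) ((y ∨ g) ∷ X)) (∪-⋈ ya yb γ δ)) (rk-T n (y ∨ g) (ya ∪ γ) (yb ∪ δ)))
      (rk-T n g γ δ)
    pointwise : ∀ y ya yb → φ (y ∷ ya ⋈ yb) ≡ contractTerm f g α β γ δ u y ya yb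
    pointwise y ya yb rewrite allowed y ya yb | signs y ya yb | ranks y ya yb = refl
    half : ∀ y → Σs (n ℕ.+ n) (φ ∘ (y ∷_)) k ≡ ΣΣ n (contractTerm f g α β γ δ u y) k
    half y = trans (Σs-++ n n (φ ∘ (y ∷_)) k)
                   (ΣΣ-cong n (λ ya yb k → cong (λ v → v k) (pointwise y ya yb)) k)

  contract-spanning : ∀ f (α β γ δ : Subset n) u →
    contractOp (T n) (f ∷ α ⋈ β) (inside ∷ γ ⋈ δ) u ≗ Spanning.totalᵛ (edges α β γ δ) u
  contract-spanning f α β γ δ u k = begin
    contractOp (T n) (f ∷ α ⋈ β) (inside ∷ γ ⋈ δ) u k
      ≡⟨ contractOp-T f inside α β γ δ u k ⟩
    -- `AB ∈ G` excludes `AB ∈ Y`, so the second half of the sum is zero by computation.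
    ΣΣ n (contractTerm f inside α β γ δ u false) k + ΣΣ n (λ _ _ → 𝟎) k
      ≡⟨ cong₂ _+_ (ΣΣ-cong n pointwise k) (ΣΣ-𝟎 n k) ⟩
    ΣΣ n (Spanning.term (edges α β γ δ) u) k + 0ℤ
      ≡⟨ ℤₚ.+-identityʳ _ ⟩
    ΣΣ n (Spanning.term (edges α β γ δ) u) k
      ≡⟨ Spanning.factorise (edges α β γ δ) u k ⟩
    Spanning.totalᵛ (edges α β γ δ) u k ∎
    where
    open ≡-Reasoning
    exponent : ∀ ya yb → ρ inside (ya ∪ γ) (yb ∪ δ) ∸ ρ inside γ δ ≡ Spanning.newᵛ (edges α β γ δ) ya yb
    exponent ya yb rewrite Spanning.∣∪∣-newᵛ α β γ δ ya yb =
      trans (cong (_∸ (∣ γ ∪ δ ∣ ℕ.+ 1)) (shuffle ∣ γ ∪ δ ∣ N)) (ℕₚ.m+n∸m≡n (∣ γ ∪ δ ∣ ℕ.+ 1) N)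
      where
      N = Spanning.newᵛ (edges α β γ δ) ya yb
      shuffle : ∀ x y → (x ℕ.+ y) ℕ.+ 1 ≡ (x ℕ.+ 1) ℕ.+ y
      shuffle x y = trans (ℕₚ.+-assoc x y 1) (trans (cong (x ℕ.+_) (ℕₚ.+-comm y 1)) (sym (ℕₚ.+-assoc x 1 y)))
    pointwise : ∀ ya yb → contractTerm f inside α β γ δ u false ya yb ≗ Spanning.term (edges α β γ δ) u ya yb
    pointwise ya yb k
      rewrite Spanning.okᵛ-edges α β γ δ ya yb | Boolₚ.∧-identityʳ (yb ⊆ᵇ (β ─ δ))
            | Spanning.sᵛ-edges (edges α β γ δ) ya yb | exponent ya yb
            | ℤₚ.*-identityˡ (sign ∣ ya ∣ * sign ∣ yb ∣) =
      gate-cong ((ya ⊆ᵇ (α ─ γ)) ∧ (yb ⊆ᵇ (β ─ δ))) (λ _ → •-cong (sign ∣ ya ∣ * sign ∣ yb ∣)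
        (λ k → sym (Spanning.linᵛ-edges (edges α β γ δ) ya yb u k))) k

  separated-exponent : ∀ y (α β γ δ ya yb : Subset n) → meets γ δ ≡ false →
    ρ (y ∨ outside) (ya ∪ γ) (yb ∪ δ) ∸ ρ outside γ δ ≡
    Separated.newᵛ (edges α β γ δ) ya yb ℕ.+ b2n ((y ∨ false) ∨ meets (ya ∪ γ) (yb ∪ δ))
  separated-exponent y α β γ δ ya yb dis
    rewrite dis | Separated.∣∪∣-newᵛ α β γ δ ya yb | ℕₚ.+-identityʳ ∣ γ ∪ δ ∣ =
    trans (cong (_∸ ∣ γ ∪ δ ∣) (ℕₚ.+-assoc ∣ γ ∪ δ ∣ _ _)) (ℕₚ.m+n∸m≡n ∣ γ ∪ δ ∣ _)

  -- Summing over AB ∉ Y and AB ∈ Y, the terms in which A and B are connected by Y ∪ G cancel.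
  contract-separated : ∀ (α β γ δ : Subset n) u → meets γ δ ≡ false →
    contractOp (T n) (inside ∷ α ⋈ β) (outside ∷ γ ⋈ δ) u ≗
    Separated.totalᵛ (edges α β γ δ) (lin 1ℤ -1ℤ u)
  contract-separated α β γ δ u dis k = begin
    contractOp (T n) (inside ∷ α ⋈ β) (outside ∷ γ ⋈ δ) u k
      ≡⟨ contractOp-T inside outside α β γ δ u k ⟩
    ΣΣ n (contractTerm inside outside α β γ δ u false) k + ΣΣ n (contractTerm inside outside α β γ δ u true) k
      ≡⟨ ΣΣ-⊞ n (contractTerm inside outside α β γ δ u false) (contractTerm inside outside α β γ δ u true) k ⟨
    ΣΣ n (λ ya yb → contractTerm inside outside α β γ δ u false ya yb ⊞ contractTerm inside outside α β γ δ u true ya yb) k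
      ≡⟨ ΣΣ-cong n pointwise k ⟩
    ΣΣ n (Separated.term (edges α β γ δ) (lin 1ℤ -1ℤ u)) k
      ≡⟨ Separated.factorise (edges α β γ δ) (lin 1ℤ -1ℤ u) k ⟩
    Separated.totalᵛ (edges α β γ δ) (lin 1ℤ -1ℤ u) k ∎
    where
    open ≡-Reasoning
    -- If `m` holds, adding `AB` to `Y` changes the sign but not the exponent `N + 1`. Otherwise the
    -- two terms are `t^N` and `− t^(N + 1)`, which gives the factor `1 − t`.
    combine : ∀ a b m s N k →
      gate (a ∧ b) ((1ℤ * s) • shⁿ (N ℕ.+ b2n m) u) k + gate (a ∧ b) ((-1ℤ * s) • shⁿ (N ℕ.+ 1) u) k
      ≡ gate (a ∧ (b ∧ not m)) (s • shⁿ N (lin 1ℤ -1ℤ u)) k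
    combine false b     m     s N k = refl
    combine true  false m     s N k = refl
    combine true  true  true  s N k = cancel s (shⁿ (N ℕ.+ 1) u k)
      where
      cancel : ∀ s x → (1ℤ * s) * x + (-1ℤ * s) * x ≡ 0ℤ
      cancel = solve-∀
    combine true  true  false s N k
      rewrite ℕₚ.+-identityʳ N | shⁿ-∘ N 1 u | sh-shⁿ N u | shⁿ-1-t N u k =
      collect s (shⁿ N u k) (sh (shⁿ N u) k)
      where
      collect : ∀ s x y → (1ℤ * s) * x + (-1ℤ * s) * y ≡ s * (1ℤ * x + -1ℤ * y)
      collect = solve-∀
    pointwise : ∀ ya yb →
      contractTerm inside outside α β γ δ u false ya yb ⊞ contractTerm inside outside α β γ δ u true ya yb ≗
      Separated.term (edges α β γ δ) (lin 1ℤ -1ℤ u) ya yb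
    pointwise ya yb k
      rewrite separated-exponent false α β γ δ ya yb dis | separated-exponent true α β γ δ ya yb dis
            | Separated.okᵛ-edges α β γ δ ya yb | Separated.sᵛ-edges (edges α β γ δ) ya yb =
      trans (combine (ya ⊆ᵇ (α ─ γ)) (yb ⊆ᵇ (β ─ δ)) μ (sign ∣ ya ∣ * sign ∣ yb ∣) N k)
        (gate-cong ((ya ⊆ᵇ (α ─ γ)) ∧ ((yb ⊆ᵇ (β ─ δ)) ∧ not μ)) (λ _ → •-cong (sign ∣ ya ∣ * sign ∣ yb ∣)
          (λ k → sym (Separated.linᵛ-edges (edges α β γ δ) ya yb (lin 1ℤ -1ℤ u) k))) k)
      where
      μ = meets (ya ∪ γ) (yb ∪ δ)
      N = Separated.newᵛ (edges α β γ δ) ya yb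

  -- All subsets of such an `F` keep `A` and `B` apart, so the condition of `Separated` holds
  -- automatically. Inserting it makes the same local factors serve for both kinds of `F`.
  contract-boolean : ∀ (α β γ δ : Subset n) u → meets α β ≡ false → γ ⊆ α → δ ⊆ β →
    contractOp (T n) (outside ∷ α ⋈ β) (outside ∷ γ ⋈ δ) u ≗ Separated.totalᵛ (edges α β γ δ) u
  contract-boolean α β γ δ u dis γ⊆α δ⊆β k = begin
    contractOp (T n) (outside ∷ α ⋈ β) (outside ∷ γ ⋈ δ) u k
      ≡⟨ contractOp-T outside outside α β γ δ u k ⟩
    ΣΣ n (contractTerm outside outside α β γ δ u false) k + ΣΣ n (λ _ _ → 𝟎) k
      ≡⟨ cong₂ _+_ (ΣΣ-cong n pointwise k) (ΣΣ-𝟎 n k) ⟩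
    ΣΣ n (Separated.term (edges α β γ δ) u) k + 0ℤ
      ≡⟨ ℤₚ.+-identityʳ _ ⟩
    ΣΣ n (Separated.term (edges α β γ δ) u) k
      ≡⟨ Separated.factorise (edges α β γ δ) u k ⟩
    Separated.totalᵛ (edges α β γ δ) u k ∎
    where
    open ≡-Reasoning
    apart : ∀ {p r} → p ⊆ α → r ⊆ β → meets p r ≡ false
    apart p⊆ r⊆ = not-true λ m → contradiction (trans (sym dis) (meets-mono p⊆ r⊆ m)) λ ()
    within : ∀ {p r s : Subset n} → r ⊆ s → p ⊆ᵇ (s ─ r) ≡ true → p ∪ r ⊆ s
    within {p} {r} {s} r⊆s e x∈ = [ (λ x∈p → p─q⊆p s r (⊆ᵇ⇒⊆ {p = p} e x∈p)) , r⊆s ] (x∈p∪q⁻ p r x∈)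
    allowed : ∀ ya yb → (ya ⊆ᵇ (α ─ γ)) ∧ (yb ⊆ᵇ (β ─ δ)) ≡
              (ya ⊆ᵇ (α ─ γ)) ∧ ((yb ⊆ᵇ (β ─ δ)) ∧ not (meets (ya ∪ γ) (yb ∪ δ)))
    allowed ya yb with ya ⊆ᵇ (α ─ γ) in p | yb ⊆ᵇ (β ─ δ) in r
    ... | false | _     = refl
    ... | true  | false = refl
    ... | true  | true  = cong not (sym (apart (within {ya} γ⊆α p) (within {yb} δ⊆β r)))
    pointwise : ∀ ya yb → contractTerm outside outside α β γ δ u false ya yb ≗ Separated.term (edges α β γ δ) u ya yb
    pointwise ya yb k
      rewrite separated-exponent false α β γ δ ya yb (apart γ⊆α δ⊆β)
            | Separated.okᵛ-edges α β γ δ ya yb | Separated.sᵛ-edges (edges α β γ δ) ya yb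
            | ℤₚ.*-identityˡ (sign ∣ ya ∣ * sign ∣ yb ∣) | allowed ya yb =
      gate-cong ((ya ⊆ᵇ (α ─ γ)) ∧ ((yb ⊆ᵇ (β ─ δ)) ∧ not μ)) (λ e → •-cong (sign ∣ ya ∣ * sign ∣ yb ∣)
        (λ k → trans (cong (λ d → shⁿ d u k) (drop-μ e)) (sym (Separated.linᵛ-edges (edges α β γ δ) ya yb u k)))) k
      where
      μ = meets (ya ∪ γ) (yb ∪ δ)
      N = Separated.newᵛ (edges α β γ δ) ya yb
      drop-μ : (ya ⊆ᵇ (α ─ γ)) ∧ ((yb ⊆ᵇ (β ─ δ)) ∧ not μ) ≡ true → N ℕ.+ b2n μ ≡ N
      drop-μ e with μ | ∧-trueʳ {yb ⊆ᵇ (β ─ δ)} (∧-trueʳ {ya ⊆ᵇ (α ─ γ)} e)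
      ... | false | _ = ℕₚ.+-identityʳ N

-- Sums over the flats of a flat

gate-lin : ∀ b a c u → gate b (lin a c u) ≗ lin a c (gate b u)
gate-lin true  a c u k = refl
gate-lin false a c u k = sym (lin-vanish a c 𝟎 k refl (sh-𝟎 k))

-- The sum over the flats G ∌ AB of the restriction of T_n to a flat F ∋ AB.
module SplitFlats where
  ok : Bool → Bool → Bool → Bool
  ok σ x y = (not x ∨ σ) ∧ ((not y ∨ σ) ∧ not (x ∧ y))

  s p q : Bool → Bool → Bool → ℤ
  s σ x y = sg (x ∨ y)
  p σ x y = Separated.total Separated.p ((σ , σ) , (x , y))
  q σ x y = Separated.total Separated.q ((σ , σ) , (x , y))

  open Factorise ok s p q public

  okᵛ-flat : ∀ {n} (σ γ δ : Subset n) → okᵛ σ γ δ ≡ (γ ⊆ᵇ σ) ∧ ((δ ⊆ᵇ σ) ∧ not (meets γ δ))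
  okᵛ-flat []      []      []      = refl
  okᵛ-flat (c ∷ σ) (x ∷ γ) (y ∷ δ) =
    trans (cong (ok c x y ∧_) (okᵛ-flat σ γ δ))
      (trans (∧-interchange₃ (not x ∨ c) (not y ∨ c) (not (x ∧ y)) (γ ⊆ᵇ σ) (δ ⊆ᵇ σ) (not (meets γ δ)))
        (cong (λ b → ((not x ∨ c) ∧ (γ ⊆ᵇ σ)) ∧ (((not y ∨ c) ∧ (δ ⊆ᵇ σ)) ∧ b)) (not-∨ (x ∧ y) (meets γ δ))))
    where
    not-∨ : ∀ z m → not z ∧ not m ≡ not (z ∨ m)
    not-∨ true  m = refl
    not-∨ false m = refl

  sᵛ-sign : ∀ {n} (σ γ δ : Subset n) → sᵛ σ γ δ ≡ sign ∣ γ ∪ δ ∣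
  sᵛ-sign []      []      []      = refl
  sᵛ-sign (c ∷ σ) (x ∷ γ) (y ∷ δ) =
    trans (cong (sg (x ∨ y) *_) (sᵛ-sign σ γ δ)) (sym (sign-∷ (x ∨ y) (γ ∪ δ)))

  linᵛ-total : ∀ {n} (σ γ δ : Subset n) u → linᵛ σ γ δ u ≡ Separated.totalᵛ (edges σ σ γ δ) u
  linᵛ-total []      []      []      u = refl
  linᵛ-total (c ∷ σ) (x ∷ γ) (y ∷ δ) u = cong (lin (p c x y) (q c x y)) (linᵛ-total σ γ δ u)

  -- At a vertex of `σ` untouched by `G`, the set `Y` may contain no edge, `Aj` or `Bj`, which gives
  -- `1 − 2t`. If `G` contains `Aj` or `Bj`, then `Y` can add nothing there, and either case gives
  -- `−1` from the sign of the rank. The total is `(1 − 2t) − 1 − 1 = −1 − 2t`.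
  total-power : ∀ {n} (σ : Subset n) u → totalᵛ σ u ≗ linPow -1ℤ (- (+ 2)) ∣ σ ∣ u
  total-power []            u k = refl
  total-power (outside ∷ σ) u k = trans (lin-id (totalᵛ σ u) k) (total-power σ u k)
  total-power (inside ∷ σ)  u k = lin-cong -1ℤ (- (+ 2)) (total-power σ u) k

-- The sum over the flats of the restriction of T_n to a flat F ∌ AB.
module BooleanFlats where
  ok : Bool × Bool → Bool → Bool → Bool
  ok (α , β) x y = (not x ∨ α) ∧ ((not y ∨ β) ∧ true)

  s p q : Bool × Bool → Bool → Bool → ℤ
  s _ x y = sg (x ∨ y)
  p c x y = Separated.total Separated.p (c , (x , y))
  q c x y = Separated.total Separated.q (c , (x , y))

  open Factorise ok s p q public

  okᵛ-flat : ∀ {n} (α β γ δ : Subset n) → okᵛ (zip α β) γ δ ≡ (γ ⊆ᵇ α) ∧ ((δ ⊆ᵇ β) ∧ true)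
  okᵛ-flat []      []      []      []      = refl
  okᵛ-flat (a ∷ α) (b ∷ β) (x ∷ γ) (y ∷ δ) =
    trans (cong (ok (a , b) x y ∧_) (okᵛ-flat α β γ δ))
      (∧-interchange₃ (not x ∨ a) (not y ∨ b) true (γ ⊆ᵇ α) (δ ⊆ᵇ β) true)

  sᵛ-sign : ∀ {n} (cs : Vec (Bool × Bool) n) γ δ → sᵛ cs γ δ ≡ sign ∣ γ ∪ δ ∣
  sᵛ-sign []       []      []      = refl
  sᵛ-sign (c ∷ cs) (x ∷ γ) (y ∷ δ) =
    trans (cong (sg (x ∨ y) *_) (sᵛ-sign cs γ δ)) (sym (sign-∷ (x ∨ y) (γ ∪ δ)))

  linᵛ-total : ∀ {n} (α β γ δ : Subset n) u → linᵛ (zip α β) γ δ u ≡ Separated.totalᵛ (edges α β γ δ) u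
  linᵛ-total []      []      []      []      u = refl
  linᵛ-total (a ∷ α) (b ∷ β) (x ∷ γ) (y ∷ δ) u =
    cong (lin (p (a , b) x y) (q (a , b) x y)) (linᵛ-total α β γ δ u)

  -- A vertex with its single edge in `F` contributes `1 − t` if the edge is not in `G` and `−1` if
  -- it is, together `−t`.
  total-power : ∀ {n} (α β : Subset n) u → meets α β ≡ false →
                totalᵛ (zip α β) u ≗ linPow 0ℤ -1ℤ ∣ α ∪ β ∣ u
  total-power []            []            u dis k = refl
  total-power (outside ∷ α) (outside ∷ β) u dis k =
    trans (lin-id (totalᵛ (zip α β) u) k) (total-power α β u dis k)
  total-power (outside ∷ α) (inside ∷ β)  u dis k = lin-cong 0ℤ -1ℤ (total-power α β u dis) k
  total-power (inside ∷ α)  (outside ∷ β) u dis k = lin-cong 0ℤ -1ℤ (total-power α β u dis) k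

okSpan : ∀ {n} → Subset n → Subset n → Subset n → Bool
okSpan []      []      []      = true
okSpan (c ∷ σ) (x ∷ γ) (y ∷ δ) =
  ((not x ∨ c) ∧ ((not y ∨ c) ∧ ((not x ∨ y) ∧ (not y ∨ x)))) ∧ okSpan σ γ δ

okSpan-flat : ∀ {n} (σ γ δ : Subset n) → okSpan σ γ δ ≡ (γ ⊆ᵇ σ) ∧ ((δ ⊆ᵇ σ) ∧ (γ ≡ᵇ δ))
okSpan-flat []      []      []      = refl
okSpan-flat (c ∷ σ) (x ∷ γ) (y ∷ δ) =
  trans (cong (((not x ∨ c) ∧ ((not y ∨ c) ∧ ((not x ∨ y) ∧ (not y ∨ x)))) ∧_) (okSpan-flat σ γ δ))
    (∧-interchange₃ (not x ∨ c) (not y ∨ c) ((not x ∨ y) ∧ (not y ∨ x)) (γ ⊆ᵇ σ) (δ ⊆ᵇ σ) (γ ≡ᵇ δ))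

-- The dependence on `w ∣ γ ∣` is not a product over vertices, so the sum of these terms is computed
-- by an induction of its own. The weights `w` stay arbitrary because a vertex in `γ` replaces them
-- by `w ∘ suc`.
spanTerm : ∀ {n} → Subset n → (ℕ → Seq) → Subset n → Subset n → Seq
spanTerm σ w γ δ = gate (okSpan σ γ δ) (sign ∣ γ ∣ • Spanning.totalᵛ (edges σ σ γ δ) (w ∣ γ ∣))

-- At a vertex of `σ` outside `γ` the four choices for `Y` give `1 − t − t + t = 1 − t`, since
-- adding both edges raises the rank only once. A vertex of `γ` gives `−1`. Extracting `−1` for
-- every vertex of `σ` leaves the weight `t − 1`.
spanning-sum : ∀ {n} (σ : Subset n) w → ΣΣ n (spanTerm σ w) ≗ sign ∣ σ ∣ • binomial -1ℤ 1ℤ w ∣ σ ∣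
spanning-sum []      w k = refl
spanning-sum {suc n} (outside ∷ σ) w k = begin
  ΣΣ (suc n) (spanTerm (outside ∷ σ) w) k
    ≡⟨ ΣΣ-suc n (spanTerm (outside ∷ σ) w) k ⟩
  (ΣΣ n (λ γ δ → spanTerm (outside ∷ σ) w (outside ∷ γ) (outside ∷ δ)) k + ΣΣ n (λ _ _ → 𝟎) k)
    + (ΣΣ n (λ _ _ → 𝟎) k + ΣΣ n (λ _ _ → 𝟎) k)
    ≡⟨ cong₂ _+_ (cong₂ _+_ (ΣΣ-cong n (λ γ δ → gate-cong (okSpan σ γ δ) (λ _ → •-cong (sign ∣ γ ∣)
                               (lin-id (Spanning.totalᵛ (edges σ σ γ δ) (w ∣ γ ∣))))) k) (ΣΣ-𝟎 n k))
                 (cong₂ _+_ (ΣΣ-𝟎 n k) (ΣΣ-𝟎 n k)) ⟩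
  (ΣΣ n (spanTerm σ w) k + 0ℤ) + 0ℤ
    ≡⟨ trans (ℤₚ.+-identityʳ _) (ℤₚ.+-identityʳ _) ⟩
  ΣΣ n (spanTerm σ w) k
    ≡⟨ spanning-sum σ w k ⟩
  sign ∣ σ ∣ * binomial -1ℤ 1ℤ w ∣ σ ∣ k ∎
  where open ≡-Reasoning
spanning-sum {suc n} (inside ∷ σ) w k = begin
  ΣΣ (suc n) (spanTerm (inside ∷ σ) w) k
    ≡⟨ ΣΣ-suc n (spanTerm (inside ∷ σ) w) k ⟩
  (ΣΣ n (λ γ δ → spanTerm (inside ∷ σ) w (outside ∷ γ) (outside ∷ δ)) k + ΣΣ n (λ _ _ → 𝟎) k)
    + (ΣΣ n (λ _ _ → 𝟎) k + ΣΣ n (λ γ δ → spanTerm (inside ∷ σ) w (inside ∷ γ) (inside ∷ δ)) k)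
    ≡⟨ cong₂ _+_ (cong₂ _+_ without (ΣΣ-𝟎 n k)) (cong₂ _+_ (ΣΣ-𝟎 n k) with-vertex) ⟩
  (lin 1ℤ -1ℤ (sign ∣ σ ∣ • B) k + 0ℤ) + (0ℤ + lin -1ℤ 0ℤ (sign ∣ σ ∣ • B′) k)
    ≡⟨ cong₂ (λ x y → (x + 0ℤ) + (0ℤ + y)) (lin-• 1ℤ -1ℤ (sign ∣ σ ∣) B k) (lin-• -1ℤ 0ℤ (sign ∣ σ ∣) B′ k) ⟩
  (sign ∣ σ ∣ * lin 1ℤ -1ℤ B k + 0ℤ) + (0ℤ + sign ∣ σ ∣ * lin -1ℤ 0ℤ B′ k)
    ≡⟨ collect (sign ∣ σ ∣) (B k) (sh B k) (B′ k) (sh B′ k) ⟩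
  - sign ∣ σ ∣ * (lin -1ℤ 1ℤ B k + B′ k) ∎
  where
  open ≡-Reasoning
  B  = binomial -1ℤ 1ℤ w ∣ σ ∣
  B′ = binomial -1ℤ 1ℤ (w ∘ suc) ∣ σ ∣
  collect : ∀ s x y z t → (s * (1ℤ * x + -1ℤ * y) + 0ℤ) + (0ℤ + s * (-1ℤ * z + 0ℤ * t))
                          ≡ - s * ((-1ℤ * x + 1ℤ * y) + z)
  collect = solve-∀
  without : ΣΣ n (λ γ δ → spanTerm (inside ∷ σ) w (outside ∷ γ) (outside ∷ δ)) k ≡ lin 1ℤ -1ℤ (sign ∣ σ ∣ • B) k
  without = trans (ΣΣ-cong n (λ γ δ k → trans
      (gate-cong (okSpan σ γ δ) (λ _ k → sym (lin-• 1ℤ -1ℤ (sign ∣ γ ∣) (Spanning.totalᵛ (edges σ σ γ δ) (w ∣ γ ∣)) k)) k)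
      (gate-lin (okSpan σ γ δ) 1ℤ -1ℤ (sign ∣ γ ∣ • Spanning.totalᵛ (edges σ σ γ δ) (w ∣ γ ∣)) k)) k)
    (trans (ΣΣ-lin n 1ℤ -1ℤ (spanTerm σ w) k) (lin-cong 1ℤ -1ℤ (spanning-sum σ w) k))
  negate : ∀ s v → (- s) • lin 1ℤ 0ℤ v ≗ lin -1ℤ 0ℤ (s • v)
  negate s v k = trans (neg s (v k) (sh v k)) (sym (lin-• -1ℤ 0ℤ s v k))
    where
    neg : ∀ s x y → - s * (1ℤ * x + 0ℤ * y) ≡ s * (-1ℤ * x + 0ℤ * y)
    neg = solve-∀
  with-vertex : ΣΣ n (λ γ δ → spanTerm (inside ∷ σ) w (inside ∷ γ) (inside ∷ δ)) k ≡ lin -1ℤ 0ℤ (sign ∣ σ ∣ • B′) k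
  with-vertex = trans (ΣΣ-cong n (λ γ δ k → trans
      (gate-cong (okSpan σ γ δ) (λ _ → negate (sign ∣ γ ∣) (Spanning.totalᵛ (edges σ σ γ δ) (w (suc ∣ γ ∣)))) k)
      (gate-lin (okSpan σ γ δ) -1ℤ 0ℤ (sign ∣ γ ∣ • Spanning.totalᵛ (edges σ σ γ δ) (w (suc ∣ γ ∣))) k)) k)
    (trans (ΣΣ-lin n -1ℤ 0ℤ (spanTerm σ (w ∘ suc)) k) (lin-cong -1ℤ 0ℤ (spanning-sum σ (w ∘ suc)) k))

-- The recursion for the flats of T_n

module _ {n : ℕ} where

  -- A flat without `AB` is independent and has polynomial 1. In a flat with `AB` the two halves
  -- coincide, so the first one gives the index `s`.
  τ : Subset (suc (n ℕ.+ n)) → Seq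
  τ (outside ∷ X) = δ₀
  τ (inside ∷ X)  = 𝒬 ∣ Vec.take n X ∣

  Good-split : ∀ {X} → Good n X → ∀ (γ δ : Subset n) → X ≡ outside ∷ γ ⋈ δ → meets γ δ ≡ false
  Good-split (split as bs dis) γ δ e = trans (cong₂ meets as≡γ bs≡δ) dis
    where
    as≡γ : γ ≡ as
    as≡γ = sym (Vecₚ.++-injectiveˡ as γ (Vecₚ.∷-injectiveʳ e))
    bs≡δ : δ ≡ bs
    bs≡δ = sym (Vecₚ.++-injectiveʳ as γ (Vecₚ.∷-injectiveʳ e))

  Good-spanning : ∀ {X} → Good n X → ∀ (γ δ : Subset n) → X ≡ inside ∷ γ ⋈ δ → γ ≡ δ
  Good-spanning (spanning σ) γ δ e =
    trans (sym (Vecₚ.++-injectiveˡ σ γ (Vecₚ.∷-injectiveʳ e))) (Vecₚ.++-injectiveʳ σ γ (Vecₚ.∷-injectiveʳ e))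

  ⋈-⊆ : ∀ {g f} {γ δ α β : Subset n} → (g ≡ inside → f ≡ inside) → γ ⊆ α → δ ⊆ β → (g ∷ γ ⋈ δ) ⊆ (f ∷ α ⋈ β)
  ⋈-⊆ {g} {f} {γ} {δ} {α} {β} h γ⊆ δ⊆ = ⊆ᵇ⇒⊆ {p = g ∷ γ ⋈ δ} (∧-true (head g h)
    (trans (⊆ᵇ-++ γ α δ β) (∧-true (⊆⇒⊆ᵇ {p = γ} γ⊆) (⊆⇒⊆ᵇ {p = δ} δ⊆))))
    where
    head : ∀ g → (g ≡ inside → f ≡ inside) → not g ∨ f ≡ true
    head true  h = h refl
    head false h = refl

  isFlat-split : ∀ (σ γ δ : Subset n) →
    does (isFlat? (restrict (T n) (inside ∷ σ ⋈ σ)) (outside ∷ γ ⋈ δ)) ≡ (γ ⊆ᵇ σ) ∧ ((δ ⊆ᵇ σ) ∧ not (meets γ δ))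
  isFlat-split σ γ δ = does-≡ (isFlat? (restrict (T n) (inside ∷ σ ⋈ σ)) (outside ∷ γ ⋈ δ)) _
    (λ fl → ∧-true (⊆⇒⊆ᵇ {p = γ} (++-⊆ˡ γ σ (drop-∷-⊆ (proj₁ fl))))
      (∧-true (⊆⇒⊆ᵇ {p = δ} (++-⊆ʳ γ σ (drop-∷-⊆ (proj₁ fl))))
        (cong not (Good-split (good-flat-T (spanning σ) fl) γ δ refl))))
    (λ e → flat-good-T outside γ δ
      (⋈-⊆ (λ ()) (⊆ᵇ⇒⊆ {p = γ} (∧-trueˡ e)) (⊆ᵇ⇒⊆ {p = δ} (∧-trueˡ (∧-trueʳ {γ ⊆ᵇ σ} e))))
      (λ ())
      (λ _ → not-true λ m → contradiction (trans (sym (∧-trueʳ {δ ⊆ᵇ σ} (∧-trueʳ {γ ⊆ᵇ σ} e))) (cong not m)) λ ()))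

  isFlat-spanning : ∀ (σ γ δ : Subset n) →
    does (isFlat? (restrict (T n) (inside ∷ σ ⋈ σ)) (inside ∷ γ ⋈ δ)) ≡ (γ ⊆ᵇ σ) ∧ ((δ ⊆ᵇ σ) ∧ (γ ≡ᵇ δ))
  isFlat-spanning σ γ δ = does-≡ (isFlat? (restrict (T n) (inside ∷ σ ⋈ σ)) (inside ∷ γ ⋈ δ)) _
    (λ fl → ∧-true (⊆⇒⊆ᵇ {p = γ} (++-⊆ˡ γ σ (drop-∷-⊆ (proj₁ fl))))
      (∧-true (⊆⇒⊆ᵇ {p = δ} (++-⊆ʳ γ σ (drop-∷-⊆ (proj₁ fl))))
        (subst (λ δ → γ ≡ᵇ δ ≡ true) (Good-spanning (good-flat-T (spanning σ) fl) γ δ refl) (≡ᵇ-refl γ))))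
    (λ e → flat-good-T inside γ δ
      (⋈-⊆ (λ _ → refl) (⊆ᵇ⇒⊆ {p = γ} (∧-trueˡ e)) (⊆ᵇ⇒⊆ {p = δ} (∧-trueˡ (∧-trueʳ {γ ⊆ᵇ σ} e))))
      (λ _ → ≡ᵇ⇒≡ (∧-trueʳ {δ ⊆ᵇ σ} (∧-trueʳ {γ ⊆ᵇ σ} e)))
      (λ ()))

  isFlat-boolean : ∀ (α β γ δ : Subset n) → meets α β ≡ false →
    does (isFlat? (restrict (T n) (outside ∷ α ⋈ β)) (outside ∷ γ ⋈ δ)) ≡ (γ ⊆ᵇ α) ∧ ((δ ⊆ᵇ β) ∧ true)
  isFlat-boolean α β γ δ dis = does-≡ (isFlat? (restrict (T n) (outside ∷ α ⋈ β)) (outside ∷ γ ⋈ δ)) _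
    (λ fl → ∧-true (⊆⇒⊆ᵇ {p = γ} (++-⊆ˡ γ α (drop-∷-⊆ (proj₁ fl))))
      (∧-true (⊆⇒⊆ᵇ {p = δ} (++-⊆ʳ γ α (drop-∷-⊆ (proj₁ fl)))) refl))
    (λ e → let γ⊆ = ⊆ᵇ⇒⊆ {p = γ} (∧-trueˡ e)
               δ⊆ = ⊆ᵇ⇒⊆ {p = δ} (∧-trueˡ (∧-trueʳ {γ ⊆ᵇ α} e)) in
      flat-good-T outside γ δ (⋈-⊆ (λ ()) γ⊆ δ⊆) (λ ())
        (λ _ → not-true λ m → contradiction (trans (sym dis) (meets-mono γ⊆ δ⊆ m)) λ ()))

  flatTerm : Subset (suc (n ℕ.+ n)) → Subset (suc (n ℕ.+ n)) → Seq
  flatTerm F G = gate (does (isFlat? (restrict (T n) F) G)) (sign (rk (T n) G) • contractOp (T n) F G (τ G))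

  rk-spanning : ∀ (σ : Subset n) → rk (T n) (inside ∷ σ ⋈ σ) ≡ suc ∣ σ ∣
  rk-spanning σ = trans (rk-T n inside σ σ) (trans (cong (λ p → ∣ p ∣ ℕ.+ 1) (∪-idem σ)) (ℕₚ.+-comm ∣ σ ∣ 1))

  rk-split : ∀ (γ δ : Subset n) → meets γ δ ≡ false → rk (T n) (outside ∷ γ ⋈ δ) ≡ ∣ γ ∪ δ ∣
  rk-split γ δ dis =
    trans (rk-T n outside γ δ) (trans (cong (λ b → ∣ γ ∪ δ ∣ ℕ.+ b2n b) dis) (ℕₚ.+-identityʳ ∣ γ ∪ δ ∣))

  flatTerm-split : ∀ (σ γ δ : Subset n) → flatTerm (inside ∷ σ ⋈ σ) (outside ∷ γ ⋈ δ) ≗ SplitFlats.term σ (lin 1ℤ -1ℤ δ₀) γ δ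
  flatTerm-split σ γ δ k
    rewrite isFlat-split σ γ δ | SplitFlats.okᵛ-flat σ γ δ | SplitFlats.sᵛ-sign σ γ δ
          | SplitFlats.linᵛ-total σ γ δ (lin 1ℤ -1ℤ δ₀) =
    gate-cong ((γ ⊆ᵇ σ) ∧ ((δ ⊆ᵇ σ) ∧ not (meets γ δ))) (λ e → let d = dis e in λ k →
      trans (cong (λ r → sign r * contractOp (T n) (inside ∷ σ ⋈ σ) (outside ∷ γ ⋈ δ) δ₀ k) (rk-split γ δ d))
            (•-cong (sign ∣ γ ∪ δ ∣) (contract-separated σ σ γ δ δ₀ d) k)) k
    where
    dis : (γ ⊆ᵇ σ) ∧ ((δ ⊆ᵇ σ) ∧ not (meets γ δ)) ≡ true → meets γ δ ≡ false
    dis e = not-true λ m → contradiction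
      (trans (sym (∧-trueʳ {δ ⊆ᵇ σ} (∧-trueʳ {γ ⊆ᵇ σ} e))) (cong not m)) λ ()

  -- The rank of such a flat is `∣ γ ∣ + 1`, the extra one being due to `AB`. The resulting sign is
  -- written as a linear factor so that it can be moved out of the double sum.
  flatTerm-spanning : ∀ (σ γ δ : Subset n) → flatTerm (inside ∷ σ ⋈ σ) (inside ∷ γ ⋈ δ) ≗ lin -1ℤ 0ℤ (spanTerm σ 𝒬 γ δ)
  flatTerm-spanning σ γ δ k
    rewrite isFlat-spanning σ γ δ | okSpan-flat σ γ δ | take-++ n γ δ =
    trans (gate-cong ((γ ⊆ᵇ σ) ∧ ((δ ⊆ᵇ σ) ∧ (γ ≡ᵇ δ))) (λ e k →
      trans (cong₂ (λ r x → sign r * x) (rk-γδ e) (contract-spanning inside σ σ γ δ (𝒬 ∣ γ ∣) k))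
            (negate (sign ∣ γ ∣) (Spanning.totalᵛ (edges σ σ γ δ) (𝒬 ∣ γ ∣)) k)) k)
      (gate-lin ((γ ⊆ᵇ σ) ∧ ((δ ⊆ᵇ σ) ∧ (γ ≡ᵇ δ))) -1ℤ 0ℤ _ k)
    where
    rk-γδ : (γ ⊆ᵇ σ) ∧ ((δ ⊆ᵇ σ) ∧ (γ ≡ᵇ δ)) ≡ true → rk (T n) (inside ∷ γ ⋈ δ) ≡ suc ∣ γ ∣
    rk-γδ e = subst (λ δ → rk (T n) (inside ∷ γ ⋈ δ) ≡ suc ∣ γ ∣)
      (≡ᵇ⇒≡ (∧-trueʳ {δ ⊆ᵇ σ} (∧-trueʳ {γ ⊆ᵇ σ} e))) (rk-spanning γ)
    negate : ∀ s v → (- s) • v ≗ lin -1ℤ 0ℤ (s • v)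
    negate s v k = trans (neg s (v k) (sh v k)) (sym (lin-• -1ℤ 0ℤ s v k))
      where
      neg : ∀ s x y → - s * x ≡ s * (-1ℤ * x + 0ℤ * y)
      neg = solve-∀

  flatTerm-boolean : ∀ (α β γ δ : Subset n) → meets α β ≡ false →
    flatTerm (outside ∷ α ⋈ β) (outside ∷ γ ⋈ δ) ≗ BooleanFlats.term (zip α β) δ₀ γ δ
  flatTerm-boolean α β γ δ dis k
    rewrite isFlat-boolean α β γ δ dis | BooleanFlats.okᵛ-flat α β γ δ | BooleanFlats.sᵛ-sign (zip α β) γ δ
          | BooleanFlats.linᵛ-total α β γ δ δ₀ =
    gate-cong ((γ ⊆ᵇ α) ∧ ((δ ⊆ᵇ β) ∧ true)) (λ e →
      let γ⊆ = ⊆ᵇ⇒⊆ {p = γ} (∧-trueˡ e)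
          δ⊆ = ⊆ᵇ⇒⊆ {p = δ} (∧-trueˡ (∧-trueʳ {γ ⊆ᵇ α} e))
          d  = not-true λ m → contradiction (trans (sym dis) (meets-mono γ⊆ δ⊆ m)) λ () in λ k →
      trans (cong (λ r → sign r * contractOp (T n) (outside ∷ α ⋈ β) (outside ∷ γ ⋈ δ) δ₀ k) (rk-split γ δ d))
            (•-cong (sign ∣ γ ∪ δ ∣) (contract-boolean α β γ δ δ₀ dis γ⊆ δ⊆) k)) k

  flatTerm-boolean-inside : ∀ (α β γ δ : Subset n) → flatTerm (outside ∷ α ⋈ β) (inside ∷ γ ⋈ δ) ≗ 𝟎
  flatTerm-boolean-inside α β γ δ k with isFlat? (restrict (T n) (outside ∷ α ⋈ β)) (inside ∷ γ ⋈ δ)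
  ... | yes fl with () ← head-⊆ (proj₁ fl)
  ... | no  _  = refl

  Σs-halves : ∀ (φ : Subset (suc (n ℕ.+ n)) → Seq) → Σs (suc (n ℕ.+ n)) φ ≗
    ΣΣ n (λ γ δ → φ (outside ∷ γ ⋈ δ)) ⊞ ΣΣ n (λ γ δ → φ (inside ∷ γ ⋈ δ))
  Σs-halves φ k = cong₂ _+_ (Σs-++ n n (φ ∘ (outside ∷_)) k) (Σs-++ n n (φ ∘ (inside ∷_)) k)

  shⁿ-linPow : ∀ r u → linPow 0ℤ 1ℤ r u ≗ shⁿ r u
  shⁿ-linPow zero    u k = refl
  shⁿ-linPow (suc r) u k = trans (lin-t (linPow 0ℤ 1ℤ r u) k) (sh-cong (shⁿ-linPow r u) k)

  -- For an independent `F` of rank `r` the flats add up to `(−t)^r`, the signed reversal of 1. For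
  -- `F` with `AB`, the flats without `AB` add up to `(−1)^s L` and those with `AB` to
  -- `(−1)^(s+1) B`. Hence `v = B − L`, which is the reversal of `𝒬 s`.
  τ-reversal : ∀ {F} → Good n F → ∃ λ v → Reversal (rk (T n) F) (τ F) v ×
    sign (rk (T n) F) • v ≗ Σs (suc (n ℕ.+ n)) (flatTerm F)
  τ-reversal (split α β dis) = shⁿ r δ₀ ,
    subst (λ r′ → Reversal r′ δ₀ (shⁿ r δ₀)) (trans (ℕₚ.+-identityʳ r) (sym (rk-split α β dis))) (Reversal-shⁿδ₀ 0 r) ,
    λ k → sym (begin
      Σs (suc (n ℕ.+ n)) (flatTerm F) k
        ≡⟨ Σs-halves (flatTerm F) k ⟩
      ΣΣ n (λ γ δ → flatTerm F (outside ∷ γ ⋈ δ)) k + ΣΣ n (λ γ δ → flatTerm F (inside ∷ γ ⋈ δ)) k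
        ≡⟨ cong₂ _+_ (ΣΣ-cong n (λ γ δ → flatTerm-boolean α β γ δ dis) k)
                     (trans (ΣΣ-cong n (λ γ δ → flatTerm-boolean-inside α β γ δ) k) (ΣΣ-𝟎 n k)) ⟩
      ΣΣ n (BooleanFlats.term (zip α β) δ₀) k + 0ℤ
        ≡⟨ ℤₚ.+-identityʳ _ ⟩
      ΣΣ n (BooleanFlats.term (zip α β) δ₀) k
        ≡⟨ BooleanFlats.factorise (zip α β) δ₀ k ⟩
      BooleanFlats.totalᵛ (zip α β) δ₀ k
        ≡⟨ BooleanFlats.total-power α β δ₀ dis k ⟩
      linPow 0ℤ -1ℤ r δ₀ k
        ≡⟨ linPow-sign 0ℤ 1ℤ r δ₀ k ⟩
      sign r * linPow 0ℤ 1ℤ r δ₀ k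
        ≡⟨ cong₂ (λ d x → sign d * x) (sym (rk-split α β dis)) (shⁿ-linPow r δ₀ k) ⟩
      sign (rk (T n) F) * shⁿ r δ₀ k ∎)
    where
    open ≡-Reasoning
    F = outside ∷ α ⋈ β
    r = ∣ α ∪ β ∣
  τ-reversal (spanning σ) = v ,
    subst₂ (λ r i → Reversal r (𝒬 i) v) (sym (rk-spanning σ)) (cong ∣_∣ (sym (take-++ n σ σ))) (𝒬-reversal s) ,
    λ k → sym (begin
      Σs (suc (n ℕ.+ n)) (flatTerm F) k
        ≡⟨ Σs-halves (flatTerm F) k ⟩
      ΣΣ n (λ γ δ → flatTerm F (outside ∷ γ ⋈ δ)) k + ΣΣ n (λ γ δ → flatTerm F (inside ∷ γ ⋈ δ)) k
        ≡⟨ cong₂ _+_ (ΣΣ-cong n (flatTerm-split σ) k) (ΣΣ-cong n (flatTerm-spanning σ) k) ⟩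
      ΣΣ n (SplitFlats.term σ (lin 1ℤ -1ℤ δ₀)) k + ΣΣ n (λ γ δ → lin -1ℤ 0ℤ (spanTerm σ 𝒬 γ δ)) k
        ≡⟨ cong₂ _+_
             (trans (SplitFlats.factorise σ (lin 1ℤ -1ℤ δ₀) k)
               (trans (SplitFlats.total-power σ (lin 1ℤ -1ℤ δ₀) k)
                 (trans (linPow-sign 1ℤ (+ 2) s (lin 1ℤ -1ℤ δ₀) k)
                   (•-cong (sign s) (linPow-lin 1ℤ (+ 2) 1ℤ -1ℤ s δ₀) k))))
             (trans (ΣΣ-lin n -1ℤ 0ℤ (spanTerm σ 𝒬) k)
               (trans (lin-cong -1ℤ 0ℤ (spanning-sum σ 𝒬) k) (lin-• -1ℤ 0ℤ (sign s) B k))) ⟩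
      sign s * L k + sign s * lin -1ℤ 0ℤ B k
        ≡⟨ collect (sign s) (L k) (B k) (sh B k) ⟩
      sign (suc s) * v k
        ≡⟨ cong (λ d → sign d * v k) (sym (rk-spanning σ)) ⟩
      sign (rk (T n) F) * v k ∎)
    where
    open ≡-Reasoning
    F = inside ∷ σ ⋈ σ
    s = ∣ σ ∣
    B = binomial -1ℤ 1ℤ 𝒬 s
    L = lin 1ℤ -1ℤ (linPow 1ℤ (+ 2) s δ₀)
    v = B ⊞ -1ℤ • L
    collect : ∀ s l b c → s * l + s * (-1ℤ * b + 0ℤ * c) ≡ - s * (b + -1ℤ * l)
    collect = solve-∀

  τ-rank-zero : ∀ {F} → Good n F → rk (T n) F ≡ 0 → τ F ≗ δ₀
  τ-rank-zero (split _ _ _) _ k = refl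
  τ-rank-zero (spanning σ)  e k = contradiction (trans (sym (rk-spanning σ)) e) λ ()

  τ-degree : ∀ {F} → Good n F → rk (T n) F ≢ 0 → ∀ k → rk (T n) F ≤ 2 ℕ.* k → τ F k ≡ 0ℤ
  τ-degree (split _ _ _) r≢0 zero    l = contradiction (ℕₚ.n≤0⇒n≡0 l) r≢0
  τ-degree (split _ _ _) r≢0 (suc k) l = refl
  τ-degree (spanning σ)  r≢0 k       l rewrite take-++ n σ σ | rk-spanning σ | ℕₚ.+-identityʳ k =
    𝒬-degree ∣ σ ∣ k l

⊤-⋈ : ∀ n → ⊤ {suc (n ℕ.+ n)} ≡ inside ∷ ⊤ {n} ⋈ ⊤ {n}
⊤-⋈ n = cong (inside ∷_) (go n n)
  where
  go : ∀ m n → ⊤ {m ℕ.+ n} ≡ ⊤ {m} ++ᵛ ⊤ {n}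
  go zero    n = refl
  go (suc m) n = cong (inside ∷_) (go m n)

coeff-T : ∀ Q → IsInverseKL Q → ∀ n → coeff (Q (T n)) ≗ 𝒬 n
coeff-T Q isQ n k = trans
  -- The restriction of `T n` to its ground set `⊤` is `T n` by definition.
  (unique (subst (Good n) (sym (⊤-⋈ n)) (spanning ⊤)) k)
  (cong (λ i → 𝒬 i k) (trans (cong (λ { (_ ∷ X) → ∣ Vec.take n X ∣ }) (⊤-⋈ n))
                             (trans (cong ∣_∣ (take-++ n ⊤ ⊤)) (∣⊤∣≡n n))))
  where
  open Uniqueness (T n) (isMatroid-T n) (loopless-T n) (Good n) (τ {n}) (λ _ _ → ∈⊤) good-flat-T
         τ-rank-zero τ-degree τ-reversal Q isQ

-- Finite sums of integers

Σ< : ℕ → (ℕ → ℤ) → ℤ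
Σ< zero    f = 0ℤ
Σ< (suc n) f = f 0 + Σ< n (f ∘ suc)

Σ<-cong : ∀ n {f g} → (∀ i → i < n → f i ≡ g i) → Σ< n f ≡ Σ< n g
Σ<-cong zero    p = refl
Σ<-cong (suc n) p = cong₂ _+_ (p 0 (s≤s z≤n)) (Σ<-cong n (λ i l → p (suc i) (s≤s l)))

Σ<-+ : ∀ n f g → Σ< n (λ i → f i + g i) ≡ Σ< n f + Σ< n g
Σ<-+ zero    f g = refl
Σ<-+ (suc n) f g = trans (cong (λ x → f 0 + g 0 + x) (Σ<-+ n (f ∘ suc) (g ∘ suc)))
                         (+-interchange (f 0) (g 0) _ _)

Σ<-zero : ∀ n f → (∀ i → i < n → f i ≡ 0ℤ) → Σ< n f ≡ 0ℤ
Σ<-zero zero    f z = refl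
Σ<-zero (suc n) f z = cong₂ _+_ (z 0 (s≤s z≤n)) (Σ<-zero n (f ∘ suc) (λ i l → z (suc i) (s≤s l)))

Σ<-append : ∀ m n f → Σ< (m ℕ.+ n) f ≡ Σ< m f + Σ< n (f ∘ (m ℕ.+_))
Σ<-append zero    n f = sym (ℤₚ.+-identityˡ _)
Σ<-append (suc m) n f = trans (cong (λ x → f 0 + x) (Σ<-append m n (f ∘ suc))) (sym (ℤₚ.+-assoc (f 0) _ _))

Σ<-last : ∀ n f → Σ< (suc n) f ≡ Σ< n f + f n
Σ<-last zero    f = ℤₚ.+-comm (f 0) 0ℤ
Σ<-last (suc n) f = trans (cong (λ x → f 0 + x) (Σ<-last n (f ∘ suc))) (sym (ℤₚ.+-assoc (f 0) _ _))

Σ<-extend : ∀ {n n′} f → n ≤ n′ → (∀ i → n ≤ i → f i ≡ 0ℤ) → Σ< n f ≡ Σ< n′ f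
Σ<-extend {zero}  {n′} f l z = sym (Σ<-zero n′ f (λ i _ → z i z≤n))
Σ<-extend {suc n} f (s≤s l) z = cong (λ x → f 0 + x) (Σ<-extend (f ∘ suc) l (λ i p → z (suc i) (s≤s p)))

Σ<-swap : ∀ m n (f : ℕ → ℕ → ℤ) → Σ< m (λ i → Σ< n (f i)) ≡ Σ< n (λ j → Σ< m (λ i → f i j))
Σ<-swap zero    n f = sym (Σ<-zero n _ (λ _ _ → refl))
Σ<-swap (suc m) n f = trans (cong (λ x → Σ< n (f 0) + x) (Σ<-swap m n (f ∘ suc)))
                            (sym (Σ<-+ n (f 0) (λ j → Σ< m (λ i → f (suc i) j))))

Σ<-triangle : ∀ n (f : ℕ → ℕ → ℤ) →
  Σ< n (λ l → Σ< (suc l) (f l)) ≡ Σ< n (λ i → Σ< (n ∸ i) (λ e → f (i ℕ.+ e) i))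
Σ<-triangle zero    f = refl
Σ<-triangle (suc n) f = begin
  Σ< (suc n) (λ l → f l 0 + Σ< l (f l ∘ suc))
    ≡⟨ Σ<-+ (suc n) (λ l → f l 0) (λ l → Σ< l (f l ∘ suc)) ⟩
  Σ< (suc n) (λ l → f l 0) + (0ℤ + Σ< n (λ l → Σ< (suc l) (f (suc l) ∘ suc)))
    ≡⟨ cong (λ x → Σ< (suc n) (λ l → f l 0) + x)
         (trans (ℤₚ.+-identityˡ _) (Σ<-triangle n (λ l i → f (suc l) (suc i)))) ⟩
  Σ< (suc n) (λ l → f l 0) + Σ< n (λ i → Σ< (n ∸ i) (λ e → f (suc i ℕ.+ e) (suc i))) ∎
  where open ≡-Reasoning

Σ<-constant : ∀ {c n} f v → c ≤ n → (∀ i → i < c → f i ≡ v) → (∀ i → c ≤ i → f i ≡ 0ℤ) → Σ< n f ≡ + c * v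
Σ<-constant {c} {n} f v c≤n const zero′ = trans (sym (Σ<-extend f c≤n zero′)) (go c f const)
  where
  go : ∀ c f → (∀ i → i < c → f i ≡ v) → Σ< c f ≡ + c * v
  go zero    f p = sym (ℤₚ.*-zeroˡ v)
  go (suc c) f p = trans (cong₂ _+_ (p 0 (s≤s z≤n)) (go c (f ∘ suc) (λ i l → p (suc i) (s≤s l))))
    (sym (ℤₚ.suc-* (+ c) v))

-- Coefficients as numbers of two-row tableaux

nC0≡1 : ∀ n → n C 0 ≡ 1
nC0≡1 n = trans (nCk≡nC[n∸k] {0} {n} z≤n) (nCn≡1 n)

binomial₁-sum : ∀ w k n → binomial 1ℤ 0ℤ w n k ≡ Σ< (suc n) (λ s → + (n C s) * w s k)
binomial₁-sum w k zero    = sym (trans (ℤₚ.+-identityʳ _) (ℤₚ.*-identityˡ (w 0 k)))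
binomial₁-sum w k (suc n) = begin
  lin 1ℤ 0ℤ (binomial 1ℤ 0ℤ w n) k + binomial 1ℤ 0ℤ (w ∘ suc) n k
    ≡⟨ cong₂ _+_ (trans (lin-id (binomial 1ℤ 0ℤ w n) k) (binomial₁-sum w k n)) (binomial₁-sum (w ∘ suc) k n) ⟩
  Σ< (suc n) (λ s → + (n C s) * w s k) + Σ< (suc n) (λ s → + (n C s) * w (suc s) k)
    ≡⟨ cong (_+ Σ< (suc n) (λ s → + (n C s) * w (suc s) k))
         (Σ<-extend {suc n} {suc (suc n)} (λ s → + (n C s) * w s k) (ℕₚ.n≤1+n (suc n)) beyond) ⟩
  (+ (n C 0) * w 0 k + Σ< (suc n) (λ s → + (n C suc s) * w (suc s) k)) + Σ< (suc n) (λ s → + (n C s) * w (suc s) k)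
    ≡⟨ ℤₚ.+-assoc (+ (n C 0) * w 0 k) _ _ ⟩
  + (n C 0) * w 0 k + (Σ< (suc n) (λ s → + (n C suc s) * w (suc s) k) + Σ< (suc n) (λ s → + (n C s) * w (suc s) k))
    ≡⟨ cong₂ _+_ (cong (λ c → + c * w 0 k) (trans (nC0≡1 n) (sym (nC0≡1 (suc n)))))
         (trans (sym (Σ<-+ (suc n) (λ s → + (n C suc s) * w (suc s) k) (λ s → + (n C s) * w (suc s) k)))
                (Σ<-cong (suc n) (λ s _ → pascal s))) ⟩
  + (suc n C 0) * w 0 k + Σ< (suc n) (λ s → + (suc n C suc s) * w (suc s) k) ∎
  where
  open ≡-Reasoning
  beyond : ∀ s → suc n ≤ s → + (n C s) * w s k ≡ 0ℤ
  beyond s l = cong (λ c → + c * w s k) (k>n⇒nCk≡0 l)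
  pascal : ∀ s → + (n C suc s) * w (suc s) k + + (n C s) * w (suc s) k ≡ + (suc n C suc s) * w (suc s) k
  pascal s = trans (sym (ℤₚ.*-distribʳ-+ (w (suc s) k) (+ (n C suc s)) (+ (n C s))))
    (cong (_* w (suc s) k) (trans (sym (ℤₚ.pos-+ (n C suc s) (n C s)))
      (cong +_ (trans (ℕₚ.+-comm (n C suc s) (n C s)) (nCk+nC[k+1]≡[n+1]C[k+1] n s)))))

-- The number of pairs (S, standard tableau of shape (k + l, k) on S) with S ⊆ [n].
pairs : ℕ → ℕ → ℕ → ℤ
pairs n k l = + (n C (k ℕ.+ k ℕ.+ l)) * ballot (k ℕ.+ k ℕ.+ l) k

-- Sizes `s < 2k` are cut off by the truncation, so `s = 2k + l`. The range of `l` runs up to `n`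
-- for every `k`, since binomial coefficients with `s > n` vanish.
𝒬-pairs : ∀ n k → 𝒬 n k ≡ Σ< (suc n) (pairs n k)
𝒬-pairs n k = begin
  𝒬 n k
    ≡⟨ binomial₁-sum halfBallot k n ⟩
  Σ< (suc n) term
    ≡⟨ Σ<-extend term (ℕₚ.m≤n+m (suc n) 2k) beyond ⟩
  Σ< (2k ℕ.+ suc n) term
    ≡⟨ Σ<-append 2k (suc n) term ⟩
  Σ< 2k term + Σ< (suc n) (term ∘ (2k ℕ.+_))
    ≡⟨ cong₂ _+_ (Σ<-zero 2k term (λ s l → trans (cong (+ (n C s) *_) (halfBallot-high s k l)) (ℤₚ.*-zeroʳ (+ (n C s)))))
         (Σ<-cong (suc n) (λ l _ → cong (+ (n C (2k ℕ.+ l)) *_) (halfBallot-low (2k ℕ.+ l) k (ℕₚ.m≤m+n 2k l)))) ⟩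
  0ℤ + Σ< (suc n) (pairs n k)
    ≡⟨ ℤₚ.+-identityˡ _ ⟩
  Σ< (suc n) (pairs n k) ∎
  where
  open ≡-Reasoning
  2k = k ℕ.+ k
  term : ℕ → ℤ
  term s = + (n C s) * halfBallot s k
  beyond : ∀ s → suc n ≤ s → term s ≡ 0ℤ
  beyond s l = cong (λ c → + c * halfBallot s k) (k>n⇒nCk≡0 l)

-- The hook length formula for three rows

-- tableaux n x y z is the number of standard tableaux with row lengths (x − 2, y − 1, z), for x + y + z = n + 3,
-- extended antisymmetrically.
tableaux : ℕ → ℕ → ℕ → ℕ → ℤ
tableaux zero 2 1 0 = 1ℤ
tableaux zero 1 2 0 = -1ℤ
tableaux zero 0 2 1 = 1ℤ
tableaux zero 2 0 1 = -1ℤ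
tableaux zero 1 0 2 = 1ℤ
tableaux zero 0 1 2 = -1ℤ
tableaux zero _ _ _ = 0ℤ
tableaux (suc n) x y z =
  (sh (λ x → tableaux n x y z) x + sh (λ y → tableaux n x y z) y) + sh (λ z → tableaux n x y z) z

vandermonde : ℤ → ℤ → ℤ → ℤ
vandermonde x y z = ((x - y) * (x - z)) * (y - z)

-- Frobenius' form of the hook length formula, here for `x`, `y`, `z` in any order. Removing a box
-- from the first row turns `1/x!` into `x` times that factor, and similarly for the others. So with
-- `V` the Vandermonde product the induction rests on `x V(x−1,y,z) + y V(x,y−1,z) + z V(x,y,z−1) =
-- (x + y + z − 3) V(x,y,z)`, where the factor on the right is `n + 1`.
hook-formula : ∀ n x y z → x ℕ.+ y ℕ.+ z ≡ n ℕ.+ 3 →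
  tableaux n x y z * (+ (x !) * + (y !) * + (z !)) ≡ + (n !) * vandermonde (+ x) (+ y) (+ z)
hook-formula zero 0 0 .3 refl = refl
hook-formula zero 0 1 .2 refl = refl
hook-formula zero 0 2 .1 refl = refl
hook-formula zero 0 3 .0 refl = refl
hook-formula zero 1 0 .2 refl = refl
hook-formula zero 1 1 .1 refl = refl
hook-formula zero 1 2 .0 refl = refl
hook-formula zero 2 0 .1 refl = refl
hook-formula zero 2 1 .0 refl = refl
hook-formula zero 3 0 .0 refl = refl
hook-formula (suc n) x y z e = begin
  (X x + Y y + Z z) * D
    ≡⟨ distr (X x) (Y y) (Z z) D ⟩
  X x * D + Y y * D + Z z * D
    ≡⟨ cong₂ _+_ (cong₂ _+_ (step-x x e) (step-y y e)) (step-z z e) ⟩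
  + x * (N * vandermonde (+ x - 1ℤ) (+ y) (+ z)) + + y * (N * vandermonde (+ x) (+ y - 1ℤ) (+ z))
    + + z * (N * vandermonde (+ x) (+ y) (+ z - 1ℤ))
    ≡⟨ identity (+ x) (+ y) (+ z) N ⟩
  (((+ x + + y) + + z) - + 3) * N * vandermonde (+ x) (+ y) (+ z)
    ≡⟨ cong (λ c → c * N * vandermonde (+ x) (+ y) (+ z)) total ⟩
  + suc n * N * vandermonde (+ x) (+ y) (+ z)
    ≡⟨ cong (_* vandermonde (+ x) (+ y) (+ z)) (sym (ℤₚ.pos-* (suc n) (n !))) ⟩
  + (suc n !) * vandermonde (+ x) (+ y) (+ z) ∎
  where
  open ≡-Reasoning
  N = + (n !)
  D = + (x !) * + (y !) * + (z !)
  X Y Z : ℕ → ℤ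
  X = sh (λ x → tableaux n x y z)
  Y = sh (λ y → tableaux n x y z)
  Z = sh (λ z → tableaux n x y z)
  distr : ∀ a b c d → (a + b + c) * d ≡ a * d + b * d + c * d
  distr = solve-∀
  identity : ∀ x y z N →
    x * (N * (((x - 1ℤ - y) * (x - 1ℤ - z)) * (y - z))) + y * (N * (((x - (y - 1ℤ)) * (x - z)) * ((y - 1ℤ) - z)))
      + z * (N * (((x - y) * (x - (z - 1ℤ))) * (y - (z - 1ℤ))))
    ≡ (((x + y) + z) - + 3) * N * (((x - y) * (x - z)) * (y - z))
  identity = solve-∀
  total : ((+ x + + y) + + z) - + 3 ≡ + suc n
  total = trans (cong (λ a → + a - + 3) e) (cancel (+ suc n))
    where
    cancel : ∀ a → (a + + 3) - + 3 ≡ a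
    cancel = solve-∀
  pred : ∀ a → + suc a - 1ℤ ≡ + a
  pred a = cancel (+ a)
    where
    cancel : ∀ a → (1ℤ + a) - 1ℤ ≡ a
    cancel = solve-∀
  step-x : ∀ x′ → x′ ℕ.+ y ℕ.+ z ≡ suc n ℕ.+ 3 →
    X x′ * (+ (x′ !) * + (y !) * + (z !)) ≡ + x′ * (N * vandermonde (+ x′ - 1ℤ) (+ y) (+ z))
  step-x zero     e = refl
  step-x (suc x′) e =
    trans (cong (λ a → tableaux n x′ y z * (a * + (y !) * + (z !))) (ℤₚ.pos-* (suc x′) (x′ !)))
      (trans (pull (tableaux n x′ y z) (+ suc x′) (+ (x′ !)) (+ (y !)) (+ (z !)))
        (cong (+ suc x′ *_) (trans (hook-formula n x′ y z (ℕₚ.suc-injective e))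
          (cong (λ a → N * vandermonde a (+ y) (+ z)) (sym (pred x′))))))
    where
    pull : ∀ t x a b c → t * (x * a * b * c) ≡ x * (t * (a * b * c))
    pull = solve-∀
  step-y : ∀ y′ → x ℕ.+ y′ ℕ.+ z ≡ suc n ℕ.+ 3 →
    sh (λ y → tableaux n x y z) y′ * (+ (x !) * + (y′ !) * + (z !)) ≡
    + y′ * (N * vandermonde (+ x) (+ y′ - 1ℤ) (+ z))
  step-y zero     e = refl
  step-y (suc y′) e =
    trans (cong (λ b → tableaux n x y′ z * (+ (x !) * b * + (z !))) (ℤₚ.pos-* (suc y′) (y′ !)))
      (trans (pull (tableaux n x y′ z) (+ suc y′) (+ (x !)) (+ (y′ !)) (+ (z !)))
        (cong (+ suc y′ *_)
          (trans (hook-formula n x y′ z (ℕₚ.suc-injective (trans (cong (ℕ._+ z) (sym (ℕₚ.+-suc x y′))) e)))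
            (cong (λ b → N * vandermonde (+ x) b (+ z)) (sym (pred y′))))))
    where
    pull : ∀ t y a b c → t * (a * (y * b) * c) ≡ y * (t * (a * b * c))
    pull = solve-∀
  step-z : ∀ z′ → x ℕ.+ y ℕ.+ z′ ≡ suc n ℕ.+ 3 →
    sh (λ z → tableaux n x y z) z′ * (+ (x !) * + (y !) * + (z′ !)) ≡
    + z′ * (N * vandermonde (+ x) (+ y) (+ z′ - 1ℤ))
  step-z zero     e = refl
  step-z (suc z′) e =
    trans (cong (λ c → tableaux n x y z′ * (+ (x !) * + (y !) * c)) (ℤₚ.pos-* (suc z′) (z′ !)))
      (trans (pull (tableaux n x y z′) (+ suc z′) (+ (x !)) (+ (y !)) (+ (z′ !)))
        (cong (+ suc z′ *_)
          (trans (hook-formula n x y z′ (ℕₚ.suc-injective (trans (sym (ℕₚ.+-suc (x ℕ.+ y) z′)) e)))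
            (cong (λ c → N * vandermonde (+ x) (+ y) c) (sym (pred z′))))))
    where
    pull : ∀ t z a b c → t * (a * b * (z * c)) ≡ z * (t * (a * b * c))
    pull = solve-∀

factorials≢0 : ∀ x y z → NonZero (x ! ℕ.* y ! ℕ.* z !)
factorials≢0 x y z = ℕₚ.m*n≢0 (x ! ℕ.* y !) (z !) {{ℕₚ.m*n≢0 (x !) (y !) {{x ℕₚ.!≢0}} {{y ℕₚ.!≢0}}}} {{z ℕₚ.!≢0}}

tableaux-zero : ∀ n x y z → x ℕ.+ y ℕ.+ z ≡ n ℕ.+ 3 → vandermonde (+ x) (+ y) (+ z) ≡ 0ℤ → tableaux n x y z ≡ 0ℤ
tableaux-zero n x y z e v with ℤₚ.i*j≡0⇒i≡0∨j≡0 (tableaux n x y z)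
  (trans (hook-formula n x y z e) (trans (cong (+ (n !) *_) v) (ℤₚ.*-zeroʳ (+ (n !)))))
... | inj₁ t≡0 = t≡0
... | inj₂ d≡0 = contradiction (ℤₚ.+-injective (trans factorials d≡0))
  (ℕ.≢-nonZero⁻¹ (x ! ℕ.* y ! ℕ.* z !) {{factorials≢0 x y z}})
  where
  factorials : + (x ! ℕ.* y ! ℕ.* z !) ≡ + (x !) * + (y !) * + (z !)
  factorials = trans (ℤₚ.pos-* (x ! ℕ.* y !) (z !)) (cong (_* + (z !)) (ℤₚ.pos-* (x !) (y !)))

tableaux-wall-xy : ∀ n x z → x ℕ.+ x ℕ.+ z ≡ n ℕ.+ 3 → tableaux n x x z ≡ 0ℤ
tableaux-wall-xy n x z e = tableaux-zero n x x z e (vanish (+ x) (+ z))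
  where
  vanish : ∀ x z → ((x - x) * (x - z)) * (x - z) ≡ 0ℤ
  vanish = solve-∀

tableaux-wall-yz : ∀ n x y → x ℕ.+ y ℕ.+ y ≡ n ℕ.+ 3 → tableaux n x y y ≡ 0ℤ
tableaux-wall-yz n x y e = tableaux-zero n x y y e (vanish (+ x) (+ y))
  where
  vanish : ∀ x y → ((x - y) * (x - y)) * (y - y) ≡ 0ℤ
  vanish = solve-∀

-- Pieri's rule for adding a horizontal strip

-- Σ_{x ≥ m} tableaux n x y z, where x + y + z = n + 3 leaves at most one term.
tail : ℕ → ℕ → ℕ → ℕ → ℤ
tail n m y z = if m ℕ.+ y ℕ.+ z ≤ᵇ n ℕ.+ 3 then tableaux n (n ℕ.+ 3 ∸ (y ℕ.+ z)) y z else 0ℤ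

tail-value : ∀ n m x y z → x ℕ.+ y ℕ.+ z ≡ n ℕ.+ 3 → m ≤ x → tail n m y z ≡ tableaux n x y z
tail-value n m x y z e l
  rewrite ≤ᵇ-true {m ℕ.+ y ℕ.+ z} {n ℕ.+ 3}
            (ℕₚ.≤-trans (ℕₚ.+-monoˡ-≤ z (ℕₚ.+-monoˡ-≤ y l)) (ℕₚ.≤-reflexive e)) =
  cong (λ x → tableaux n x y z)
    (trans (cong (_∸ (y ℕ.+ z)) (trans (sym e) (ℕₚ.+-assoc x y z))) (ℕₚ.m+n∸n≡m x (y ℕ.+ z)))

tail-vanish : ∀ n m y z → n ℕ.+ 3 < m ℕ.+ y ℕ.+ z → tail n m y z ≡ 0ℤ
tail-vanish n m y z l rewrite ≤ᵇ-false {m ℕ.+ y ℕ.+ z} {n ℕ.+ 3} l = refl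

tail-cases : ∀ n m y z → (∃ λ x → x ℕ.+ y ℕ.+ z ≡ n ℕ.+ 3 × m ≤ x) ⊎ n ℕ.+ 3 < m ℕ.+ y ℕ.+ z
tail-cases n m y z with (m ℕ.+ y ℕ.+ z) ℕₚ.≤? (n ℕ.+ 3)
... | no ¬l = inj₂ (ℕₚ.≰⇒> ¬l)
... | yes l = inj₁ (n ℕ.+ 3 ∸ (y ℕ.+ z) ,
  trans (ℕₚ.+-assoc (n ℕ.+ 3 ∸ (y ℕ.+ z)) y z) (ℕₚ.m∸n+n≡m (ℕₚ.m+n≤o⇒n≤o m l′)) ,
  ℕₚ.m+n≤o⇒m≤o∸n m l′)
  where
  l′ : m ℕ.+ (y ℕ.+ z) ≤ n ℕ.+ 3
  l′ = ℕₚ.≤-trans (ℕₚ.≤-reflexive (sym (ℕₚ.+-assoc m y z))) l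

-- The recurrence of `tableaux` summed over `x`: a box removed from the first row lowers the bound
-- on `x`, a box removed from another row keeps it.
tail-suc : ∀ n m y z → tail (suc n) (suc m) y z ≡
  (tail n m y z + sh (λ y → tail n (suc m) y z) y) + sh (λ z → tail n (suc m) y z) z
tail-suc n m y z with tail-cases (suc n) (suc m) y z
... | inj₁ (suc x , e , s≤s l) = trans (tail-value (suc n) (suc m) (suc x) y z e (s≤s l))
  (cong₂ _+_ (cong₂ _+_ (sym (tail-value n m x y z (ℕₚ.suc-injective e) l)) (step-y y e)) (step-z z e))
  where
  step-y : ∀ y → suc x ℕ.+ y ℕ.+ z ≡ suc n ℕ.+ 3 →
           sh (λ y → tableaux n (suc x) y z) y ≡ sh (λ y → tail n (suc m) y z) y
  step-y zero    e = refl
  step-y (suc y) e = sym (tail-value n (suc m) (suc x) y z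
    (ℕₚ.suc-injective (trans (cong (ℕ._+ z) (sym (ℕₚ.+-suc (suc x) y))) e)) (s≤s l))
  step-z : ∀ z → suc x ℕ.+ y ℕ.+ z ≡ suc n ℕ.+ 3 →
           sh (λ z → tableaux n (suc x) y z) z ≡ sh (λ z → tail n (suc m) y z) z
  step-z zero    e = refl
  step-z (suc z) e = sym (tail-value n (suc m) (suc x) y z
    (ℕₚ.suc-injective (trans (sym (ℕₚ.+-suc (suc x ℕ.+ y) z)) e)) (s≤s l))
... | inj₂ l = trans (tail-vanish (suc n) (suc m) y z l)
  (sym (cong₂ _+_ (cong₂ _+_ (tail-vanish n m y z (ℕₚ.≤-pred l)) (step-y y l)) (step-z z l)))
  where
  step-y : ∀ y → suc n ℕ.+ 3 < suc m ℕ.+ y ℕ.+ z → sh (λ y → tail n (suc m) y z) y ≡ 0ℤ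
  step-y zero    l = refl
  step-y (suc y) l = tail-vanish n (suc m) y z
    (ℕₚ.≤-pred (ℕₚ.≤-trans l (ℕₚ.≤-reflexive (cong (ℕ._+ z) (ℕₚ.+-suc (suc m) y)))))
  step-z : ∀ z → suc n ℕ.+ 3 < suc m ℕ.+ y ℕ.+ z → sh (λ z → tail n (suc m) y z) z ≡ 0ℤ
  step-z zero    l = refl
  step-z (suc z) l = tail-vanish n (suc m) y z
    (ℕₚ.≤-pred (ℕₚ.≤-trans l (ℕₚ.≤-reflexive (ℕₚ.+-suc (suc m ℕ.+ y) z))))

-- The bounds differ only by the term `x = m = y`, which has two equal shifted row lengths and
-- vanishes.
tail-wall-xy : ∀ n m z → tail n m m z ≡ tail n (suc m) m z
tail-wall-xy n m z with tail-cases n m m z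
... | inj₂ l = trans (tail-vanish n m m z l) (sym (tail-vanish n (suc m) m z (ℕₚ.m<n⇒m<1+n l)))
... | inj₁ (x , e , l) with ℕₚ.m≤n⇒m<n∨m≡n l
...   | inj₁ m<x  = trans (tail-value n m x m z e l) (sym (tail-value n (suc m) x m z e m<x))
...   | inj₂ refl = trans (tail-value n m m m z e l) (trans (tableaux-wall-xy n m z e)
  (sym (tail-vanish n (suc m) m z (ℕₚ.≤-reflexive (cong suc (sym e))))))

tail-wall-yz : ∀ n m y → tail n m y y ≡ 0ℤ
tail-wall-yz n m y with tail-cases n m y y
... | inj₁ (x , e , l) = trans (tail-value n m x y y e l) (tableaux-wall-yz n x y e)
... | inj₂ l = tail-vanish n m y y l

-- The sum over the shapes λ with λ₁ ≥ k + l − 2 ≥ λ₂ ≥ k − 1 ≥ λ₃ (in shifted coordinates, x ≥ k + l > y ≥ k > z):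
-- those obtained from (k + l − 2, k − 1) by adding a horizontal strip.
strips : ℕ → ℕ → ℕ → ℤ
strips n k l = Σ< l (λ i → Σ< k (λ z → tail n (k ℕ.+ l) (k ℕ.+ i) z))

-- Removing the largest entry from row one, two or three gives the sums `A`, `B` and `b`, whose
-- ranges are off by a row. The last row `y = μ` of `A` has its bound on `x` raised at the wall
-- `x = y` and completes `B` at the top. The first row `y = k` of `B` loses its entry `z = k` on the
-- wall `y = z` and completes `b` at the bottom.
strips-suc : ∀ n k l → strips (suc n) (suc k) (suc l) ≡
  strips n (suc k) (suc l) + (strips n (suc k) l + strips n k (suc (suc l)))
strips-suc n k l = begin
  Σ< (suc l) (λ i → Σ< (suc k) (λ z → tail (suc n) (suc μ) (suc (k ℕ.+ i)) z))
    ≡⟨ Σ<-cong (suc l) (λ i _ → row i) ⟩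
  Σ< (suc l) (λ i → (A i + B (k ℕ.+ i)) + b (suc k ℕ.+ i))
    ≡⟨ trans (Σ<-+ (suc l) (λ i → A i + B (k ℕ.+ i)) (λ i → b (suc k ℕ.+ i)))
             (cong (_+ Σ< (suc l) (λ i → b (suc k ℕ.+ i))) (Σ<-+ (suc l) A (λ i → B (k ℕ.+ i)))) ⟩
  (Σ< (suc l) A + (B (k ℕ.+ 0) + Σ< l (λ i → B (k ℕ.+ suc i)))) + Σ< (suc l) (λ i → b (suc k ℕ.+ i))
    ≡⟨ cong₂ (λ x y → (x + y) + Σ< (suc l) (λ i → b (suc k ℕ.+ i)))
         (trans (Σ<-last l A) (cong₂ _+_ A-strips A-last))
         (cong₂ _+_ B-first (Σ<-cong l (λ i _ → cong B (ℕₚ.+-suc k i)))) ⟩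
  ((strips n (suc k) l + B (suc k ℕ.+ l)) + (b (k ℕ.+ 0) + Σ< l (λ i → B (suc k ℕ.+ i))))
    + Σ< (suc l) (λ i → b (suc k ℕ.+ i))
    ≡⟨ regroup (strips n (suc k) l) (B (suc k ℕ.+ l)) (b (k ℕ.+ 0)) (Σ< l (λ i → B (suc k ℕ.+ i))) _ ⟩
  (Σ< l (λ i → B (suc k ℕ.+ i)) + B (suc k ℕ.+ l))
    + (strips n (suc k) l + (b (k ℕ.+ 0) + Σ< (suc l) (λ i → b (suc k ℕ.+ i))))
    ≡⟨ cong₂ (λ x y → x + (strips n (suc k) l + y)) (sym (Σ<-last l (λ i → B (suc k ℕ.+ i)))) b-strips ⟩
  strips n (suc k) (suc l) + (strips n (suc k) l + strips n k (suc (suc l))) ∎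
  where
  open ≡-Reasoning
  μ = k ℕ.+ suc l
  A B b : ℕ → ℤ
  A i = Σ< (suc k) (λ z → tail n μ (suc k ℕ.+ i) z)
  B y = Σ< (suc k) (λ z → tail n (suc μ) y z)
  b y = Σ< k (λ z → tail n (suc μ) y z)
  regroup : ∀ s x y z t → ((s + x) + (y + z)) + t ≡ (z + x) + (s + (y + t))
  regroup = solve-∀
  row : ∀ i → Σ< (suc k) (λ z → tail (suc n) (suc μ) (suc (k ℕ.+ i)) z) ≡ (A i + B (k ℕ.+ i)) + b (suc k ℕ.+ i)
  row i = begin
    Σ< (suc k) (λ z → tail (suc n) (suc μ) (suc (k ℕ.+ i)) z)
      ≡⟨ Σ<-cong (suc k) (λ z _ → tail-suc n μ (suc (k ℕ.+ i)) z) ⟩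
    Σ< (suc k) (λ z → (tail n μ (suc k ℕ.+ i) z + tail n (suc μ) (k ℕ.+ i) z) + sh (tail n (suc μ) (suc k ℕ.+ i)) z)
      ≡⟨ Σ<-+ (suc k) (λ z → tail n μ (suc k ℕ.+ i) z + tail n (suc μ) (k ℕ.+ i) z) (sh (tail n (suc μ) (suc k ℕ.+ i))) ⟩
    Σ< (suc k) (λ z → tail n μ (suc k ℕ.+ i) z + tail n (suc μ) (k ℕ.+ i) z) + (0ℤ + b (suc k ℕ.+ i))
      ≡⟨ cong₂ _+_ (Σ<-+ (suc k) (tail n μ (suc k ℕ.+ i)) (tail n (suc μ) (k ℕ.+ i))) (ℤₚ.+-identityˡ _) ⟩
    (A i + B (k ℕ.+ i)) + b (suc k ℕ.+ i) ∎
  A-strips : Σ< l A ≡ strips n (suc k) l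
  A-strips = cong (λ μ → Σ< l (λ i → Σ< (suc k) (λ z → tail n μ (suc k ℕ.+ i) z))) (ℕₚ.+-suc k l)
  A-last : A l ≡ B (suc k ℕ.+ l)
  A-last = Σ<-cong (suc k) (λ z _ → trans (cong (λ y → tail n μ y z) (sym (ℕₚ.+-suc k l)))
    (trans (tail-wall-xy n μ z) (cong (λ y → tail n (suc μ) y z) (ℕₚ.+-suc k l))))
  B-first : B (k ℕ.+ 0) ≡ b (k ℕ.+ 0)
  B-first = trans (Σ<-last k (tail n (suc μ) (k ℕ.+ 0)))
    (trans (cong (λ x → b (k ℕ.+ 0) + x)
             (trans (cong (λ y → tail n (suc μ) y k) (ℕₚ.+-identityʳ k)) (tail-wall-yz n (suc μ) k)))
           (ℤₚ.+-identityʳ _))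
  b-strips : b (k ℕ.+ 0) + Σ< (suc l) (λ i → b (suc k ℕ.+ i)) ≡ strips n k (suc (suc l))
  b-strips = trans
    (cong (λ x → b (k ℕ.+ 0) + x) (Σ<-cong (suc l) (λ i _ → cong b (sym (ℕₚ.+-suc k i)))))
    (cong (λ μ → Σ< (suc (suc l)) (λ i → Σ< k (λ z → tail n μ (k ℕ.+ i) z))) (sym (ℕₚ.+-suc k (suc l))))

-- The element `n + 1` is either outside `S` or the largest entry of the tableau, at the end of its
-- first or second row.
pairs-suc : ∀ n s k → + (suc n C suc s) * ballot (suc s) k ≡
  + (n C suc s) * ballot (suc s) k + (+ (n C s) * ballot s k + + (n C s) * sh (ballot s) k)
pairs-suc n s k = trans
  (cong (λ c → + c * ballot (suc s) k) (sym (nCk+nC[k+1]≡[n+1]C[k+1] n s)))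
  (trans (cong (_* ballot (suc s) k) (ℤₚ.pos-+ (n C s) (n C suc s)))
         (distr (+ (n C s)) (+ (n C suc s)) (ballot s k) (sh (ballot s) k)))
  where
  distr : ∀ c d x y → (c + d) * (1ℤ * x + 1ℤ * y) ≡ d * (1ℤ * x + 1ℤ * y) + (c * x + c * y)
  distr = solve-∀

strips≡pairs-zero : ∀ k l → 0 < k ℕ.+ k ℕ.+ l → strips 0 (suc k) (suc l) ≡ pairs 0 k l
strips≡pairs-zero k l pos = trans
  (Σ<-zero (suc l) _ (λ i _ → Σ<-zero (suc k) _ (λ z _ → tail-vanish 0 (suc k ℕ.+ suc l) (suc k ℕ.+ i) z (big i z))))
  (sym (cong (λ c → + c * ballot (k ℕ.+ k ℕ.+ l) k) (k>n⇒nCk≡0 pos)))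
  where
  shuffle : ∀ k l i z → suc k ℕ.+ suc l ℕ.+ (suc k ℕ.+ i) ℕ.+ z ≡ 3 ℕ.+ (k ℕ.+ k ℕ.+ l) ℕ.+ (i ℕ.+ z)
  shuffle = ℕSolver.solve-∀
  big : ∀ i z → 3 < suc k ℕ.+ suc l ℕ.+ (suc k ℕ.+ i) ℕ.+ z
  big i z = ℕₚ.≤-trans (ℕₚ.≤-trans (ℕₚ.+-monoʳ-≤ 3 pos) (ℕₚ.m≤m+n _ (i ℕ.+ z))) (ℕₚ.≤-reflexive (sym (shuffle k l i z)))

-- Pieri's rule for the dimensions of Specht modules.
strips≡pairs : ∀ n k l → strips n (suc k) (suc l) ≡ pairs n k l
strips≡pairs zero zero    zero    = refl
strips≡pairs zero zero    (suc l) = strips≡pairs-zero 0 (suc l) (s≤s z≤n)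
strips≡pairs zero (suc k) l       = strips≡pairs-zero (suc k) l (s≤s z≤n)
strips≡pairs (suc n) k l = trans (strips-suc n k l) (trans
  (cong (_+ (strips n (suc k) l + strips n k (suc (suc l)))) (strips≡pairs n k l)) (go k l))
  where
  no-strips : ∀ k → strips n 0 k ≡ 0ℤ
  no-strips k = Σ<-zero k _ (λ _ _ → refl)
  go : ∀ k l → pairs n k l + (strips n (suc k) l + strips n k (suc (suc l))) ≡ pairs (suc n) k l
  go zero zero = trans (cong (λ x → pairs n 0 0 + (0ℤ + x)) (no-strips 2))
    (trans (ℤₚ.+-identityʳ _) (cong (λ c → + c * ballot 0 0) (trans (nC0≡1 n) (sym (nC0≡1 (suc n))))))
  go zero (suc l) = trans
    (cong₂ (λ x y → pairs n 0 (suc l) + (x + y)) (strips≡pairs n 0 l)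
      (trans (no-strips (suc (suc (suc l)))) (sym (ℤₚ.*-zeroʳ (+ (n C l))))))
    (sym (pairs-suc n l 0))
  -- With equal rows no box can be removed from the first one: the corresponding sum of strips is
  -- empty, and on the other side stands the middle coefficient of a ballot polynomial, which is 0.
  go (suc k) zero = trans
    (cong (λ x → pairs n (suc k) 0 + (0ℤ + x)) (strips≡pairs n k 1))
    (trans (cong₂ (λ x y → pairs n (suc k) 0 + (x + y))
             (sym (trans (cong (+ (n C s) *_) (trans (cong (λ s → ballot s (suc k)) middle) (ballot-middle k))) (ℤₚ.*-zeroʳ (+ (n C s)))))
             (cong (λ s → + (n C s) * ballot s k) (trans (ℕₚ.+-comm (k ℕ.+ k) 1) (sym middle))))
           (sym (pairs-suc n s (suc k))))
    where
    s = k ℕ.+ suc k ℕ.+ 0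
    middle : s ≡ suc (k ℕ.+ k)
    middle = trans (ℕₚ.+-identityʳ (k ℕ.+ suc k)) (ℕₚ.+-suc k k)
  go (suc k) (suc l) = trans
    (cong₂ (λ x y → pairs n (suc k) (suc l) + (x + y)) (strips≡pairs n (suc k) l) (strips≡pairs n k (suc (suc l))))
    (trans (cong₂ (λ x y → pairs n (suc k) (suc l) + (x + y))
             (cong (λ s → + (n C s) * ballot s (suc k)) (shuffle₁ k l))
             (cong (λ s → + (n C s) * ballot s k) (shuffle₂ k l)))
           (sym (pairs-suc n (k ℕ.+ suc k ℕ.+ suc l) (suc k))))
    where
    shuffle₁ : ∀ k l → suc k ℕ.+ suc k ℕ.+ l ≡ k ℕ.+ suc k ℕ.+ suc l
    shuffle₁ = ℕSolver.solve-∀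
    shuffle₂ : ∀ k l → k ℕ.+ k ℕ.+ suc (suc l) ≡ k ℕ.+ suc k ℕ.+ suc l
    shuffle₂ = ℕSolver.solve-∀

-- Comparison with the formula of the theorem

ι : ℤ → ℚ
ι a = a ℚ./ 1

/≡ι : ∀ a d .{{_ : NonZero d}} b → a ≡ b * + d → a ℚ./ d ≡ ι b
/≡ι a (suc d) b e = ℚₚ.fromℚᵘ-cong {mkℚᵘ a d} {mkℚᵘ b 0} (*≡* (trans (ℤₚ.*-identityʳ a) e))

ι-+ : ∀ a b → ι (a + b) ≡ ι a ℚ.+ ι b
ι-+ a b = ℚₚ.toℚᵘ-injective (begin
  ℚ.toℚᵘ (ι (a + b))               ≈⟨ ℚₚ.toℚᵘ-fromℚᵘ (mkℚᵘ (a + b) 0) ⟩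
  mkℚᵘ (a + b) 0                   ≈⟨ *≡* (unit a b) ⟩
  mkℚᵘ a 0 ℚᵘ.+ mkℚᵘ b 0           ≈⟨ ℚᵘₚ.+-cong (ℚₚ.toℚᵘ-fromℚᵘ (mkℚᵘ a 0)) (ℚₚ.toℚᵘ-fromℚᵘ (mkℚᵘ b 0)) ⟨
  ℚ.toℚᵘ (ι a) ℚᵘ.+ ℚ.toℚᵘ (ι b)   ≈⟨ ℚₚ.toℚᵘ-homo-+ (ι a) (ι b) ⟨
  ℚ.toℚᵘ (ι a ℚ.+ ι b)             ∎)
  where
  open ℚᵘₚ.≃-Reasoning
  unit : ∀ a b → (a + b) * 1ℤ ≡ (a * 1ℤ + b * 1ℤ) * 1ℤ
  unit = solve-∀

ℚsum-ι : ∀ n (f : ℕ → ℚ) g → (∀ i → i < n → f i ≡ ι (g i)) → ℚsum (applyUpTo f n) ≡ ι (Σ< n g)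
ℚsum-ι zero    f g p = refl
ℚsum-ι (suc n) f g p = trans
  (cong₂ ℚ._+_ (p 0 (s≤s z≤n)) (ℚsum-ι n (f ∘ suc) (g ∘ suc) (λ i l → p (suc i) (s≤s l))))
  (sym (ι-+ (g 0) (Σ< n (g ∘ suc))))

-- The shape is `λ = (z + j + p, z + j, z)`, with `p = λ₁ − λ₂ = n − 3z − 2j`. The differences of
-- its shifted row lengths are `p + 1`, `j + p + 2` and `j + 1`. They use up all factors of the
-- numerator but one `p + 1`, which remains as the multiplicity.
summand-value : ∀ n z j p → n ≡ 3 ℕ.* z ℕ.+ 2 ℕ.* j ℕ.+ p →
  summand n z j ≡ ι (+ suc p * tableaux n (z ℕ.+ j ℕ.+ p ℕ.+ 2) (z ℕ.+ j ℕ.+ 1) z)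
summand-value n z j p e = /≡ι _ _ {{factorials≢0 z (z ℕ.+ j ℕ.+ 1) (n ∸ 2 ℕ.* z ∸ j ℕ.+ 2)}} (+ suc p * t) (begin
  + ((j ℕ.+ 1) ℕ.* (n ∸ 3 ℕ.* z ∸ j ℕ.+ 2) ℕ.* ((n ∸ 3 ℕ.* z ∸ 2 ℕ.* j ℕ.+ 1) ℕ.^ 2) ℕ.* n !)
    ≡⟨ cong₂ (λ a b → + ((j ℕ.+ 1) ℕ.* (a ℕ.+ 2) ℕ.* ((b ℕ.+ 1) ℕ.^ 2) ℕ.* n !)) e₁ e₂ ⟩
  + ((j ℕ.+ 1) ℕ.* (j ℕ.+ p ℕ.+ 2) ℕ.* ((p ℕ.+ 1) ℕ.^ 2) ℕ.* n !)
    ≡⟨ trans (ℤₚ.pos-* ((j ℕ.+ 1) ℕ.* (j ℕ.+ p ℕ.+ 2) ℕ.* ((p ℕ.+ 1) ℕ.^ 2)) (n !)) (cong (_* + (n !))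
         (trans (ℤₚ.pos-* ((j ℕ.+ 1) ℕ.* (j ℕ.+ p ℕ.+ 2)) ((p ℕ.+ 1) ℕ.^ 2))
           (cong₂ _*_ (ℤₚ.pos-* (j ℕ.+ 1) (j ℕ.+ p ℕ.+ 2))
             (trans (ℤₚ.pos-* (p ℕ.+ 1) ((p ℕ.+ 1) ℕ.* 1)) (cong (+ (p ℕ.+ 1) *_) (ℤₚ.pos-* (p ℕ.+ 1) 1)))))) ⟩
  ((+ j + 1ℤ) * (+ j + + p + + 2)) * ((+ p + 1ℤ) * ((+ p + 1ℤ) * 1ℤ)) * + (n !)
    ≡⟨ identity (+ z) (+ j) (+ p) (+ (n !)) ⟩
  (1ℤ + + p) * (+ (n !) * vandermonde (+ x) (+ y) (+ z))
    ≡⟨ cong ((1ℤ + + p) *_) (sym (hook-formula n x y z sum)) ⟩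
  (1ℤ + + p) * (t * (+ (x !) * + (y !) * + (z !)))
    ≡⟨ reorder (1ℤ + + p) t (+ (x !)) (+ (y !)) (+ (z !)) ⟩
  ((1ℤ + + p) * t) * (+ (z !) * + (y !) * + (x !))
    ≡⟨ cong (((1ℤ + + p) * t) *_) (sym (trans (ℤₚ.pos-* (z ! ℕ.* y !) (x !)) (cong (_* + (x !)) (ℤₚ.pos-* (z !) (y !))))) ⟩
  (+ suc p * t) * + (z ! ℕ.* y ! ℕ.* x !)
    ≡⟨ cong (λ a → (+ suc p * t) * + (z ! ℕ.* y ! ℕ.* (a ℕ.+ 2) !)) (sym e₃) ⟩
  (+ suc p * t) * + (z ! ℕ.* (z ℕ.+ j ℕ.+ 1) ! ℕ.* (n ∸ 2 ℕ.* z ∸ j ℕ.+ 2) !) ∎)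
  where
  open ≡-Reasoning
  x = z ℕ.+ j ℕ.+ p ℕ.+ 2
  y = z ℕ.+ j ℕ.+ 1
  t = tableaux n x y z
  subtract : ∀ a b c → n ≡ a ℕ.+ b ℕ.+ c → n ∸ a ∸ b ≡ c
  subtract a b c e = trans (ℕₚ.∸-+-assoc n a b) (trans (cong (_∸ (a ℕ.+ b)) e) (ℕₚ.m+n∸m≡n (a ℕ.+ b) c))
  e₁ : n ∸ 3 ℕ.* z ∸ j ≡ j ℕ.+ p
  e₁ = subtract (3 ℕ.* z) j (j ℕ.+ p) (trans e (shuffle z j p))
    where
    shuffle : ∀ z j p → 3 ℕ.* z ℕ.+ 2 ℕ.* j ℕ.+ p ≡ 3 ℕ.* z ℕ.+ j ℕ.+ (j ℕ.+ p)
    shuffle = ℕSolver.solve-∀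
  e₂ : n ∸ 3 ℕ.* z ∸ 2 ℕ.* j ≡ p
  e₂ = subtract (3 ℕ.* z) (2 ℕ.* j) p e
  e₃ : n ∸ 2 ℕ.* z ∸ j ≡ z ℕ.+ j ℕ.+ p
  e₃ = subtract (2 ℕ.* z) j (z ℕ.+ j ℕ.+ p) (trans e (shuffle z j p))
    where
    shuffle : ∀ z j p → 3 ℕ.* z ℕ.+ 2 ℕ.* j ℕ.+ p ≡ 2 ℕ.* z ℕ.+ j ℕ.+ (z ℕ.+ j ℕ.+ p)
    shuffle = ℕSolver.solve-∀
  sum : x ℕ.+ y ℕ.+ z ≡ n ℕ.+ 3
  sum = trans (shuffle z j p) (cong (ℕ._+ 3) (sym e))
    where
    shuffle : ∀ z j p → z ℕ.+ j ℕ.+ p ℕ.+ 2 ℕ.+ (z ℕ.+ j ℕ.+ 1) ℕ.+ z ≡ 3 ℕ.* z ℕ.+ 2 ℕ.* j ℕ.+ p ℕ.+ 3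
    shuffle = ℕSolver.solve-∀
  identity : ∀ z j p N →
    ((j + 1ℤ) * (j + p + + 2)) * ((p + 1ℤ) * ((p + 1ℤ) * 1ℤ)) * N ≡
    (1ℤ + p) * (N * ((((z + j + p + + 2) - (z + j + 1ℤ)) * ((z + j + p + + 2) - z)) * ((z + j + 1ℤ) - z)))
  identity = solve-∀
  reorder : ∀ c t a b d → c * (t * (a * b * d)) ≡ (c * t) * (d * b * a)
  reorder = solve-∀

-- The contribution of the shapes with λ₂ = k + i and λ₃ = z: each of them is counted once for every
-- m with λ₂ ≤ m ≤ λ₁, which explains the second factor n − 3i − 2j + 1 in the theorem.
column : ℕ → ℕ → ℕ → ℕ → ℤ
column n k z i = Σ< (suc n ∸ i) (λ e → tail n (suc k ℕ.+ suc (i ℕ.+ e)) (suc k ℕ.+ i) z)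

-- Pieri's rule lists the shapes for each size `2k + l` of `S`. Writing `l = i + e` and summing over
-- `e` first collects the contributions by their second and third rows instead.
𝒬-columns : ∀ n k → 𝒬 n k ≡ Σ< (suc k) (λ z → Σ< (suc n) (column n k z))
𝒬-columns n k = begin
  𝒬 n k
    ≡⟨ 𝒬-pairs n k ⟩
  Σ< (suc n) (pairs n k)
    ≡⟨ Σ<-cong (suc n) (λ l _ → sym (strips≡pairs n k l)) ⟩
  Σ< (suc n) (λ l → Σ< (suc l) (f l))
    ≡⟨ Σ<-triangle (suc n) f ⟩
  Σ< (suc n) (λ i → Σ< (suc n ∸ i) (λ e → f (i ℕ.+ e) i))
    ≡⟨ Σ<-cong (suc n) (λ i _ → Σ<-swap (suc n ∸ i) (suc k)
         (λ e z → tail n (suc k ℕ.+ suc (i ℕ.+ e)) (suc k ℕ.+ i) z)) ⟩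
  Σ< (suc n) (λ i → Σ< (suc k) (λ z → column n k z i))
    ≡⟨ Σ<-swap (suc n) (suc k) (λ i z → column n k z i) ⟩
  Σ< (suc k) (λ z → Σ< (suc n) (column n k z)) ∎
  where
  open ≡-Reasoning
  f : ℕ → ℕ → ℤ
  f l i = Σ< (suc k) (λ z → tail n (suc k ℕ.+ suc l) (suc k ℕ.+ i) z)

column-vanish : ∀ n z a i → n < 3 ℕ.* z ℕ.+ 2 ℕ.* (a ℕ.+ i) → column n (z ℕ.+ a) z i ≡ 0ℤ
column-vanish n z a i l = Σ<-zero (suc n ∸ i) _ (λ e _ → tail-vanish n (suc (z ℕ.+ a) ℕ.+ suc (i ℕ.+ e)) (suc (z ℕ.+ a) ℕ.+ i) z (begin-strict
  n ℕ.+ 3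
    <⟨ ℕₚ.+-monoˡ-< 3 l ⟩
  3 ℕ.* z ℕ.+ 2 ℕ.* (a ℕ.+ i) ℕ.+ 3
    ≤⟨ ℕₚ.m≤m+n _ e ⟩
  3 ℕ.* z ℕ.+ 2 ℕ.* (a ℕ.+ i) ℕ.+ 3 ℕ.+ e
    ≡⟨ shuffle z a i e ⟩
  suc (z ℕ.+ a) ℕ.+ suc (i ℕ.+ e) ℕ.+ (suc (z ℕ.+ a) ℕ.+ i) ℕ.+ z ∎))
  where
  open ℕₚ.≤-Reasoning
  shuffle : ∀ z a i e → 3 ℕ.* z ℕ.+ 2 ℕ.* (a ℕ.+ i) ℕ.+ 3 ℕ.+ e ≡
            suc (z ℕ.+ a) ℕ.+ suc (i ℕ.+ e) ℕ.+ (suc (z ℕ.+ a) ℕ.+ i) ℕ.+ z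
  shuffle = ℕSolver.solve-∀

-- The size `n` leaves only `x = z + j + p + 2`, with `j = a + i`. It meets the bound
-- `z + j + e + 2` exactly for `e ≤ p`, which makes `p + 1` equal terms.
column-value : ∀ n z a i p → n ≡ 3 ℕ.* z ℕ.+ 2 ℕ.* (a ℕ.+ i) ℕ.+ p →
  column n (z ℕ.+ a) z i ≡ + suc p * tableaux n (z ℕ.+ (a ℕ.+ i) ℕ.+ p ℕ.+ 2) (z ℕ.+ (a ℕ.+ i) ℕ.+ 1) z
column-value n z a i p e = Σ<-constant _ _ range below above
  where
  j = a ℕ.+ i
  x = z ℕ.+ j ℕ.+ p ℕ.+ 2
  y = z ℕ.+ j ℕ.+ 1
  y≡ : suc (z ℕ.+ a) ℕ.+ i ≡ y
  y≡ = shuffle z a i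
    where
    shuffle : ∀ z a i → suc (z ℕ.+ a) ℕ.+ i ≡ z ℕ.+ (a ℕ.+ i) ℕ.+ 1
    shuffle = ℕSolver.solve-∀
  first : ∀ e → suc (z ℕ.+ a) ℕ.+ suc (i ℕ.+ e) ≡ z ℕ.+ j ℕ.+ e ℕ.+ 2
  first e = shuffle z a i e
    where
    shuffle : ∀ z a i e → suc (z ℕ.+ a) ℕ.+ suc (i ℕ.+ e) ≡ z ℕ.+ (a ℕ.+ i) ℕ.+ e ℕ.+ 2
    shuffle = ℕSolver.solve-∀
  sum : x ℕ.+ y ℕ.+ z ≡ n ℕ.+ 3
  sum = trans (shuffle z j p) (cong (ℕ._+ 3) (sym e))
    where
    shuffle : ∀ z j p → z ℕ.+ j ℕ.+ p ℕ.+ 2 ℕ.+ (z ℕ.+ j ℕ.+ 1) ℕ.+ z ≡ 3 ℕ.* z ℕ.+ 2 ℕ.* j ℕ.+ p ℕ.+ 3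
    shuffle = ℕSolver.solve-∀
  range : suc p ≤ suc n ∸ i
  range = ℕₚ.m+n≤o⇒m≤o∸n (suc p) (s≤s (ℕₚ.≤-trans (ℕₚ.m≤m+n (p ℕ.+ i) (3 ℕ.* z ℕ.+ (a ℕ.+ j)))
    (ℕₚ.≤-reflexive (trans (shuffle z a i p) (sym e)))))
    where
    shuffle : ∀ z a i p → p ℕ.+ i ℕ.+ (3 ℕ.* z ℕ.+ (a ℕ.+ (a ℕ.+ i))) ≡ 3 ℕ.* z ℕ.+ 2 ℕ.* (a ℕ.+ i) ℕ.+ p
    shuffle = ℕSolver.solve-∀
  below : ∀ e → e < suc p → tail n (suc (z ℕ.+ a) ℕ.+ suc (i ℕ.+ e)) (suc (z ℕ.+ a) ℕ.+ i) z ≡ tableaux n x y z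
  below e (s≤s l) = trans (cong₂ (λ m y → tail n m y z) (first e) y≡)
    (tail-value n (z ℕ.+ j ℕ.+ e ℕ.+ 2) x y z sum (ℕₚ.+-monoˡ-≤ 2 (ℕₚ.+-monoʳ-≤ (z ℕ.+ j) l)))
  above : ∀ e → suc p ≤ e → tail n (suc (z ℕ.+ a) ℕ.+ suc (i ℕ.+ e)) (suc (z ℕ.+ a) ℕ.+ i) z ≡ 0ℤ
  above e l = trans (cong₂ (λ m y → tail n m y z) (first e) y≡)
    (tail-vanish n (z ℕ.+ j ℕ.+ e ℕ.+ 2) y z (ℕₚ.≤-trans (s≤s (ℕₚ.≤-reflexive (sym sum)))
      (ℕₚ.+-monoˡ-< z (ℕₚ.+-monoˡ-< y (ℕₚ.+-monoˡ-< 2 (ℕₚ.+-monoʳ-< (z ℕ.+ j) l))))))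

half-≤ : ∀ j n → j ≤ n div 2 → 2 ℕ.* j ≤ n
half-≤ j n l = ℕₚ.≤-trans (ℕₚ.*-monoʳ-≤ 2 l) (ℕₚ.≤-trans (ℕₚ.≤-reflexive (ℕₚ.*-comm 2 (n div 2))) (m/n*n≤m n 2))

half-> : ∀ j n → n div 2 < j → n < 2 ℕ.* j
half-> j n l = ℕₚ.≰⇒> λ 2j≤n → ℕₚ.<⇒≱ l (ℕₚ.≤-trans (ℕₚ.≤-reflexive (sym (m*n/n≡m j 2)))
  (/-monoˡ-≤ 2 (ℕₚ.≤-trans (ℕₚ.≤-reflexive (ℕₚ.*-comm j 2)) 2j≤n)))

-- With `k = z + a` the index of the formula is `j = a + i`. Where its range ends, `3z + 2j` exceeds
-- `n` and no shape with these lower rows has size `n`, so the columns vanish; for `3z > n` this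
-- happens from the start, in accordance with the empty sum.
inner-sum : ∀ n z a →
  (if 3 ℕ.* z ≤ᵇ n then sumFromTo a ((n ∸ 3 ℕ.* z) div 2) (summand n z) else ℚ.0ℚ) ≡
  ι (Σ< (suc n) (column n (z ℕ.+ a) z))
inner-sum n z a with (3 ℕ.* z) ℕₚ.≤? n
... | no ¬l rewrite ≤ᵇ-false {3 ℕ.* z} {n} (ℕₚ.≰⇒> ¬l) =
  cong ι (sym (Σ<-zero (suc n) (column n (z ℕ.+ a) z)
    (λ i _ → column-vanish n z a i (ℕₚ.≤-trans (ℕₚ.≰⇒> ¬l) (ℕₚ.m≤m+n (3 ℕ.* z) _)))))
... | yes l rewrite ≤ᵇ-true {3 ℕ.* z} {n} l =
  trans (ℚsum-ι (suc hi ∸ a) (λ d → summand n z (a ℕ.+ d)) (column n (z ℕ.+ a) z) in-range)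
        (cong ι (Σ<-extend (column n (z ℕ.+ a) z) short past-range))
  where
  hi = (n ∸ 3 ℕ.* z) div 2
  short : suc hi ∸ a ≤ suc n
  short = ℕₚ.≤-trans (ℕₚ.m∸n≤m (suc hi) a) (s≤s (ℕₚ.≤-trans (m/n≤m (n ∸ 3 ℕ.* z) 2) (ℕₚ.m∸n≤m n (3 ℕ.* z))))
  in-range : ∀ i → i < suc hi ∸ a → summand n z (a ℕ.+ i) ≡ ι (column n (z ℕ.+ a) z i)
  in-range i i< = trans (summand-value n z (a ℕ.+ i) p e) (cong ι (sym (column-value n z a i p e)))
    where
    a≤ : a ≤ suc hi
    a≤ = ℕₚ.<⇒≤ (ℕₚ.m∸n≢0⇒n<m λ d≡0 → ℕₚ.n≮0 (subst (i <_) d≡0 i<))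
    j≤hi : a ℕ.+ i ≤ hi
    j≤hi = ℕₚ.≤-trans (ℕₚ.≤-reflexive (ℕₚ.+-comm a i)) (ℕₚ.≤-pred (ℕₚ.m≤o∸n⇒m+n≤o (suc i) a≤ i<))
    p = n ∸ 3 ℕ.* z ∸ 2 ℕ.* (a ℕ.+ i)
    e : n ≡ 3 ℕ.* z ℕ.+ 2 ℕ.* (a ℕ.+ i) ℕ.+ p
    e = sym (trans (ℕₚ.+-assoc (3 ℕ.* z) (2 ℕ.* (a ℕ.+ i)) p)
      (trans (cong (3 ℕ.* z ℕ.+_) (ℕₚ.m+[n∸m]≡n (half-≤ (a ℕ.+ i) (n ∸ 3 ℕ.* z) j≤hi))) (ℕₚ.m+[n∸m]≡n l)))
  past-range : ∀ i → suc hi ∸ a ≤ i → column n (z ℕ.+ a) z i ≡ 0ℤ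
  past-range i ≤i = column-vanish n z a i (ℕₚ.≤-trans (s≤s (ℕₚ.≤-reflexive (sym (ℕₚ.m+[n∸m]≡n l))))
    (ℕₚ.+-monoʳ-< (3 ℕ.* z) (half-> (a ℕ.+ i) (n ∸ 3 ℕ.* z) (ℕₚ.≤-trans (ℕₚ.m≤n+m∸n (suc hi) a) (ℕₚ.+-monoʳ-≤ a ≤i)))))

𝒬≡formulaCoeff : ∀ n k → ι (𝒬 n k) ≡ formulaCoeff n k
𝒬≡formulaCoeff n k with k ℕₚ.≤? n div 2
... | no ¬l rewrite ≤ᵇ-false {k} {n div 2} (ℕₚ.≰⇒> ¬l) =
  cong ι (𝒬-degree n k (ℕₚ.≤-trans (half-> k n (ℕₚ.≰⇒> ¬l)) (ℕₚ.≤-reflexive (cong (k ℕ.+_) (ℕₚ.+-identityʳ k)))))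
... | yes l rewrite ≤ᵇ-true {k} {n div 2} l =
  trans (cong ι (𝒬-columns n k)) (sym (ℚsum-ι (suc k) _ (λ z → Σ< (suc n) (column n k z)) row))
  where
  row : ∀ z → z < suc k →
    (if 3 ℕ.* z ≤ᵇ n then sumFromTo (k ∸ z) ((n ∸ 3 ℕ.* z) div 2) (summand n z) else ℚ.0ℚ) ≡
    ι (Σ< (suc n) (column n k z))
  row z (s≤s z≤k) = trans (inner-sum n z (k ∸ z))
    (cong (λ k → ι (Σ< (suc n) (column n k z))) (ℕₚ.m+[n∸m]≡n z≤k))

theorem3p4 : (Q : RankData → Poly) → IsInverseKL Q →
    (n k : ℕ) → coeff (Q (T n)) k / 1 ≡ formulaCoeff n k
theorem3p4 Q isQ n k = trans (cong ι (coeff-T Q isQ n k)) (𝒬≡formulaCoeff n k)
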